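{- Suppose $1/n\ll 1/K\ll\lambda\ll\alpha$. If $G$ is a digraph of order $n$ with $\delta^0(G)\ge(1/2+\alpha)n$, then $G$ contains every oriented tree $T$ of order $n$ with $\Delta(T)\le n^{(K\log n)^{ -1/2}}$ such that $T$ contains (i) at least $\lambda n$ vertex-disjoint bare paths of order $7$, or (ii) at least $\lambda n$ vertex-disjoint edges incident to leaves.
   Context: Hierarchy notation: a statement holding for $1/n\ll 1/K\ll\lambda\ll\alpha$ means that for every $\alpha>0$ there is $\lambda_0>0$ such that for every $0<\lambda<\lambda_0$ there is $K_0$ such that for every $K\ge K_0$ there is $n_0$ such that the statement holds for all $n\ge n_0$. $\log$ is the natural logarithm. A digraph has no loops and at most one edge in each direction between two vertices; $\delta^0(G)$ is the minimum over vertices of the minimum of in- and outdegree. An oriented tree is an orientation of a tree; $\Delta(T)$ is the maximum degree of the underlying tree. A leaf is a vertex of (underlying) degree $1$. A bare path $p_1p_2\cdots p_s$ in $T$ is a path whose internal vertices $p_2,\dots,p_{s-1}$ all have degree $2$ in the underlying graph of $T$; its order is its number of vertices. "$G$ contains $T$" means $G$ has a subdigraph isomorphic to $T$. -}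

module Defs where

open import Data.Nat using (ℕ; zero; suc; _+_; _*_; _^_; _≤_; _!)

open import Data.Fin using (Fin; zero; suc; inject₁; fromℕ)
open import Data.Bool using (Bool; true; false; _∨_)
open import Data.Product using (_×_; Σ; _,_)
open import Relation.Binary.PropositionalEquality using (_≡_)
open import Relation.Nullary using (¬_)
open import Function.Definitions using (Injective)

count : {n : ℕ} → (Fin n → Bool) → ℕ
count {zero}  p = 0
count {suc n} p with p zero
... | true  = suc (count (λ i → p (suc i)))
... | false = count (λ i → p (suc i))

record Digraph (n : ℕ) : Set where
  field
    adj     : Fin n → Fin n → Bool
    loopless : ∀ v → adj v v ≡ false
open Digraph public

outdeg indeg : {n : ℕ} → Digraph n → Fin n → ℕ
outdeg G v = count (λ w → adj G v w)
indeg  G v = count (λ w → adj G w v)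

-- δ⁰(G) ≥ (1/2 + 1/(a+1)) n, cleared of denominators:
-- (a+3) n ≤ 2(a+1) d  for d every in- and outdegree.
MinSemiDegAtLeastHalfPlus : {n : ℕ} → (a : ℕ) → Digraph n → Set
MinSemiDegAtLeastHalfPlus {n} a G =
  ∀ v → ((a + 3) * n ≤ 2 * (suc a) * outdeg G v)
      × ((a + 3) * n ≤ 2 * (suc a) * indeg G v)

und : {n : ℕ} → Digraph n → Fin n → Fin n → Bool
und G u v = adj G u v ∨ adj G v u

deg : {n : ℕ} → Digraph n → Fin n → ℕ
deg G v = count (λ w → und G v w)

data Walk {n : ℕ} (G : Digraph n) : Fin n → Fin n → Set where
  here : ∀ {u} → Walk G u u
  step : ∀ {u v w} → und G u v ≡ true → Walk G v w → Walk G u w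

Connected : {n : ℕ} → Digraph n → Set
Connected G = ∀ u v → Walk G u v

IsCycle : {n : ℕ} → Digraph n → (k : ℕ) → (Fin (suc (suc (suc k))) → Fin n) → Set
IsCycle G k c =
  Injective _≡_ _≡_ c
  × (∀ (i : Fin (suc (suc k))) → und G (c (inject₁ i)) (c (suc i)) ≡ true)
  × (und G (c (fromℕ (suc (suc k)))) (c zero) ≡ true)

Acyclic : {n : ℕ} → Digraph n → Set
Acyclic G = ∀ k c → ¬ IsCycle G k c

IsOrientedTree : {n : ℕ} → Digraph n → Set
IsOrientedTree G =
  (∀ u v → adj G u v ≡ true → adj G v u ≡ false)
  × Connected G
  × Acyclic G

Contains : {m n : ℕ} → Digraph n → Digraph m → Set
Contains {m} {n} G T =
  Σ (Fin m → Fin n) λ f →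
    Injective _≡_ _≡_ f × (∀ u v → adj T u v ≡ true → adj G (f u) (f v) ≡ true)

-- Exponential comparison with natural exponents, in ℕ only.
-- expSum m N = N! · Σ_{k ≤ N} m^k / k!
expSum : ℕ → ℕ → ℕ
expSum m zero    = 1
expSum m (suc N) = suc N * expSum m N + m ^ suc N

-- e^m ≤ X  (the partial sums of the exponential series increase to e^m)
ExpLe : ℕ → ℕ → Set
ExpLe m X = ∀ N → expSum m N ≤ X * (N !)

-- DegBound K n d  ⇔  d ≤ n^{(K log n)^{-1/2}}   (for n ≥ 2, natural log)
-- Via:  d ≤ n^{(K ln n)^{-1/2}} ⇔ K (ln d)² ≤ ln n (d ≥ 1), which holds iff
-- for all rationals r = a/b ≥ 0 with r ≤ ln d (i.e. e^a ≤ d^b) we have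
-- K r² ≤ ln n (i.e. e^{K a²} ≤ n^{b²}).  (d = 0 satisfies it vacuously.)
DegBound : ℕ → ℕ → ℕ → Set
DegBound K n d =
  ∀ (a b : ℕ) → ExpLe a (d ^ suc b) → ExpLe (K * (a * a)) (n ^ (suc b * suc b))

MaxDegBound : {n : ℕ} → ℕ → Digraph n → Set
MaxDegBound {n} K T = ∀ v → DegBound K n (deg T v)

IsBarePath7 : {n : ℕ} → Digraph n → (Fin 7 → Fin n) → Set
IsBarePath7 T p =
  (∀ (i : Fin 6) → und T (p (inject₁ i)) (p (suc i)) ≡ true)
  × (∀ (i : Fin 5) → deg T (p (suc (inject₁ i))) ≡ 2)

DisjointBarePaths7 : {n : ℕ} → Digraph n → ℕ → Set
DisjointBarePaths7 {n} T L =
  Σ (Fin L → Fin 7 → Fin n) λ P →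
    (∀ i → IsBarePath7 T (P i))
    × (∀ i j i' j' → P i j ≡ P i' j' → (i ≡ i') × (j ≡ j'))

DisjointLeafEdges : {n : ℕ} → Digraph n → ℕ → Set
DisjointLeafEdges {n} T L =
  Σ (Fin L → Fin 2 → Fin n) λ E →
    (∀ i → und T (E i zero) (E i (suc zero)) ≡ true)
    × (∀ i → deg T (E i (suc zero)) ≡ 1)
    × (∀ i j i' j' → E i j ≡ E i' j' → (i ≡ i') × (j ≡ j'))

-- Write α = 1 / (a + 1). For all directions, two vertices of G have at least about 2αn common
-- neighbours. The tree is embedded from a root outwards, parents before children, in three stages.
--
-- First comes a small subtree containing many vertices q with at most one child. Placing such a q,
-- its parent and its child at random, the following happens with probability at least α³: q may be
-- moved to r, keeping its edges, and the old image of q is a neighbour of v in direction s. By the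
-- method of conditional expectations it happens for many q simultaneously for all r, v and s.
--
-- Then the rest of the tree, cut into pieces of size n^o(1), is embedded piece by piece so that in
-- the pool of free vertices all in- and outdegrees stay above half of the pool. In such a pool there is
-- a doubly stochastic matrix supported on the arcs and with all these entries of the same order. Any two
-- vertices have many common neighbours, so two steps of its random walk contract, and a random
-- image of a piece is almost uniform in the pool. Hence some image does not increase an exponential
-- potential that punishes the vertices losing too many of their free neighbours.
--
-- Finally a remaining vertex x whose parent is at v takes the image of some q as above, which
-- moves to an arbitrary free vertex r; this never gets stuck.
--
-- Mixing up to an error Δ^(-O(1)) takes O(log Δ) steps, hence pieces of size Δ^O(log Δ); the bound on
-- the degrees says that this is a small power of n.
module Submission where

open import Defs
open import Data.Bool using (T; Bool; true; false; _∧_; _∨_; not; if_then_else_)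
open import Data.Empty using (⊥; ⊥-elim)
open import Data.Fin using (Fin; zero; suc; toℕ; fromℕ; fromℕ<; inject₁; combine; remQuot)
import Data.Fin.Properties as Fin
open import Data.Fin.Permutation using (Permutation′; _⟨$⟩ʳ_; _∘ₚ_; transpose; permutation)
open import Data.List using (List; []; _∷_; _++_; length; map; lookup; allFin; concatMap)
import Data.List.Properties as List
open import Data.List.Membership.Propositional using (_∈_; _∉_)
open import Data.List.Membership.Propositional.Properties
  using (∈-++⁺ˡ; ∈-++⁺ʳ; ∈-++⁻; ∈-map⁺; ∈-map⁻; ∈-allFin; ∈-lookup; ∈-∃++; ∈-concatMap⁺)
open import Data.List.Relation.Binary.Permutation.Propositional
  using (_↭_; prep; ↭-refl; ↭-sym; ↭-trans; ↭-reflexive)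
import Data.List.Relation.Binary.Permutation.Propositional as Permutation
import Data.List.Relation.Binary.Permutation.Propositional.Properties as ↭
import Data.List.Relation.Binary.Permutation.Setoid.Properties as ↭ₛ
open import Data.List.Relation.Binary.Permutation.Propositional.Properties using (∈-resp-↭)
open import Data.List.Relation.Unary.All using (All; []; _∷_)
import Data.List.Relation.Unary.All as All
import Data.List.Relation.Unary.All.Properties as All
open import Data.List.Relation.Unary.Any using (here; there)
import Data.List.Relation.Unary.Any as Any
open import Data.List.Relation.Unary.AllPairs using ([]; _∷_)
open import Data.List.Relation.Unary.Unique.Propositional using (Unique)
import Data.List.Relation.Unary.Unique.Propositional.Properties as Unique
open import Data.Nat
  using (ℕ; zero; suc; _+_; _*_; _∸_; _^_; _≤_; _<_; z≤n; s≤s; pred; _!; NonZero; >-nonZero; >-nonZero⁻¹; _/_; _%_; _≤ᵇ_)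
open import Data.Nat.DivMod using (m≡m%n+[m/n]*n; m%n<n; m/n*n≤m; m<n*o⇒m/o<n; m*n/n≡m; /-monoˡ-≤)
open import Data.Nat.Properties
open import Algebra.Properties.CommutativeMonoid.Sum +-0-commutativeMonoid
  using (sum-permute) renaming (sum to ∑)
open import Data.Nat.Tactic.RingSolver using (solve-∀)
open import Data.Product using (Σ; ∃; ∃₂; _×_; _,_; proj₁; proj₂)
open import Data.Unit using (tt)
open import Data.Sum using (_⊎_; inj₁; inj₂; [_,_]′)
open import Function using (_∘_; id; case_of_)
open import Relation.Binary.PropositionalEquality
  using (_≡_; _≢_; refl; sym; trans; cong; cong₂; subst; subst₂; module ≡-Reasoning)
import Relation.Binary.PropositionalEquality as ≡
open import Relation.Nullary using (¬_; Dec; yes; no; does; contradiction)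

-- Finite sums

-- Probability is replaced by counting: an expectation is a sum whose denominator stays on the other
-- side, and a random choice is an index at which one sum falls below another. The matrix meets
-- three demands at once. Equal column sums keep the uniform distribution stationary; entries of at
-- least 1 on every arc make two steps contract; entries of at most `C` let the positions already
-- used by the same piece be avoided at little loss. The image of a piece is almost uniform in one
-- respect only: the sum over it of the first-order price in the potential is within Ψ / Q per
-- vertex of the average. These errors add up to order n / Q and are paid from the gap between the
-- density 1/2 + 2/q of the host and the 1/2 + 1/q that the walk needs. In a pool of fewer than `g₀`
-- vertices that gap is too small, so the loop stops there and the absorbers take over. The small
-- subtree is found by moving the root to a vertex below which there are at least `s₀` vertices,
-- itself included, but fewer than `s₀` in each branch; the degrees then limit it to order Δ s₀.

⟦_⟧ : Bool → ℕ
⟦ true ⟧  = 1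
⟦ false ⟧ = 0

⟦⟧≤1 : ∀ b → ⟦ b ⟧ ≤ 1
⟦⟧≤1 true  = ≤-refl
⟦⟧≤1 false = z≤n

⟦⟧>0 : ∀ {b} → 0 < ⟦ b ⟧ → b ≡ true
⟦⟧>0 {true} _ = refl

⟦∧⟧ : ∀ b c → ⟦ b ⟧ + ⟦ c ⟧ ≤ 1 + ⟦ b ∧ c ⟧
⟦∧⟧ true  true  = ≤-refl
⟦∧⟧ true  false = ≤-refl
⟦∧⟧ false c     = ≤-trans (⟦⟧≤1 c) (m≤m+n 1 0)

∧-true : ∀ {b c} → b ∧ c ≡ true → b ≡ true × c ≡ true
∧-true {true} {true} _ = refl , refl

∧-intro : ∀ {b c} → b ≡ true → c ≡ true → b ∧ c ≡ true
∧-intro refl refl = refl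

true≢false : ∀ {b} → b ≡ true → b ≡ false → ⊥
true≢false refl ()

not-true : ∀ {b} → not b ≡ true → b ≡ false
not-true {false} _ = refl

_==_ : ∀ {n} → Fin n → Fin n → Bool
i == j = does (i Fin.≟ j)

==-refl : ∀ {n} (i : Fin n) → (i == i) ≡ true
==-refl i with i Fin.≟ i
... | yes _ = refl
... | no ne = ⊥-elim (ne refl)

==-true : ∀ {n} {i j : Fin n} → (i == j) ≡ true → i ≡ j
==-true {i = i} {j} h with i Fin.≟ j
... | yes e = e

==-sym : ∀ {n} (i j : Fin n) → (i == j) ≡ (j == i)
==-sym i j with i Fin.≟ j | j Fin.≟ i
... | yes _ | yes _ = refl
... | no _  | no _  = refl
... | yes e | no ne = ⊥-elim (ne (sym e))
... | no ne | yes e = ⊥-elim (ne (sym e))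

≤-by : ∀ {a b} k → b ≡ a + k → a ≤ b
≤-by {a} k e = subst (a ≤_) (sym e) (m≤m+n a k)

slack : ∀ {a b} → a ≤ b → ∃ λ k → b ≡ a + k
slack {a} {b} le = b ∸ a , sym (m+[n∸m]≡n le)

opaque

  sum : ∀ {m} → (Fin m → ℕ) → ℕ
  sum {zero}  f = 0
  sum {suc m} f = f zero + sum (f ∘ suc)

  sum-[] : (f : Fin 0 → ℕ) → sum f ≡ 0
  sum-[] f = refl

  sum-suc : ∀ {m} (f : Fin (suc m) → ℕ) → sum f ≡ f zero + sum (f ∘ suc)
  sum-suc f = refl

  sum-cong : ∀ {m} {f g : Fin m → ℕ} → (∀ i → f i ≡ g i) → sum f ≡ sum g
  sum-cong {zero}  h = refl
  sum-cong {suc m} h = cong₂ _+_ (h zero) (sum-cong (h ∘ suc))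

  +-interchange : ∀ a b c d → a + b + (c + d) ≡ a + c + (b + d)
  +-interchange = solve-∀

  sum-+ : ∀ {m} (f g : Fin m → ℕ) → sum (λ i → f i + g i) ≡ sum f + sum g
  sum-+ {zero}  f g = refl
  sum-+ {suc m} f g = trans (cong (f zero + g zero +_) (sum-+ (f ∘ suc) (g ∘ suc)))
                            (+-interchange (f zero) (g zero) _ _)

  sum≡∑ : ∀ {m} (f : Fin m → ℕ) → sum f ≡ ∑ f
  sum≡∑ {zero}  f = refl
  sum≡∑ {suc m} f = cong (f zero +_) (sum≡∑ (f ∘ suc))

  sum-perm : ∀ {m} (f : Fin m → ℕ) (π : Permutation′ m) → sum (λ i → f (π ⟨$⟩ʳ i)) ≡ sum f
  sum-perm {m} f π = trans (sum≡∑ {m} (λ i → f (π ⟨$⟩ʳ i))) (trans (sym (sum-permute f π)) (sym (sum≡∑ f)))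

  sum-mono : ∀ {m} {f g : Fin m → ℕ} → (∀ i → f i ≤ g i) → sum f ≤ sum g
  sum-mono {zero}  h = z≤n
  sum-mono {suc m} h = +-mono-≤ (h zero) (sum-mono (h ∘ suc))

  sum-const : ∀ m c → sum {m} (λ _ → c) ≡ m * c
  sum-const zero    c = refl
  sum-const (suc m) c = cong (c +_) (sum-const m c)

  sum-*ˡ : ∀ {m} c (f : Fin m → ℕ) → sum (λ i → c * f i) ≡ c * sum f
  sum-*ˡ {zero}  c f = sym (*-zeroʳ c)
  sum-*ˡ {suc m} c f = trans (cong (c * f zero +_) (sum-*ˡ c (f ∘ suc))) (sym (*-distribˡ-+ c _ _))

  sum-*ʳ : ∀ {m} c (f : Fin m → ℕ) → sum (λ i → f i * c) ≡ sum f * c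
  sum-*ʳ c f = trans (sum-cong (λ i → *-comm (f i) c)) (trans (sum-*ˡ c f) (*-comm c _))

  sum-comm : ∀ {m k} (F : Fin m → Fin k → ℕ) → sum (λ i → sum (F i)) ≡ sum (λ j → sum (λ i → F i j))
  sum-comm {zero} {k} F = sym (trans (sum-const k 0) (*-zeroʳ k))
  sum-comm {suc m} F = trans (cong (sum (F zero) +_) (sum-comm (F ∘ suc))) (sym (sum-+ (F zero) _))

  -- The first moment method: the averaging arguments below obtain their witnesses here.
  sum-<⇒∃ : ∀ {m} {f g : Fin m → ℕ} → sum f < sum g → ∃ λ i → f i < g i
  sum-<⇒∃ {suc m} {f} {g} h with f zero <? g zero
  ... | yes lt = zero , lt
  ... | no nlt with sum-<⇒∃ {m} {f ∘ suc} {g ∘ suc} (+-cancelˡ-< (f zero) _ _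
                      (<-≤-trans h (+-monoˡ-≤ _ (≮⇒≥ nlt))))
  ...   | i , lt = suc i , lt

  term≤sum : ∀ {m} (f : Fin m → ℕ) i → f i ≤ sum f
  term≤sum f zero    = m≤m+n _ _
  term≤sum f (suc i) = ≤-trans (term≤sum (f ∘ suc) i) (m≤n+m _ _)

  sum-strict : ∀ {m} {f g : Fin m → ℕ} → (∀ i → f i ≤ g i) → ∀ i → f i < g i → sum f < sum g
  sum-strict h zero    lt = +-mono-<-≤ lt (sum-mono (h ∘ suc))
  sum-strict h (suc i) lt = +-mono-≤-< (h zero) (sum-strict (h ∘ suc) i lt)

  sum-zero : ∀ {m} {f : Fin m → ℕ} → sum f ≡ 0 → ∀ i → f i ≡ 0
  sum-zero {f = f} e i = n≤0⇒n≡0 (subst (f i ≤_) e (term≤sum f i))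

  ==-suc : ∀ {m} (i j : Fin m) → (Fin.suc i == Fin.suc j) ≡ (i == j)
  ==-suc i j with i Fin.≟ j
  ... | yes _ = refl
  ... | no _  = refl

  sum-δ : ∀ {m} (i : Fin m) (g : Fin m → ℕ) → sum (λ j → ⟦ i == j ⟧ * g j) ≡ g i
  sum-δ {suc m} zero g = begin
    g zero + 0 + sum {m} (λ _ → 0)  ≡⟨ cong (g zero + 0 +_) (trans (sum-const m 0) (*-zeroʳ m)) ⟩
    g zero + 0 + 0                  ≡⟨ trans (+-identityʳ _) (+-identityʳ _) ⟩
    g zero                          ∎
    where open ≡-Reasoning
  sum-δ {suc m} (suc i) g = trans (sum-cong (λ j → cong (λ b → ⟦ b ⟧ * g (suc j)) (==-suc i j))) (sum-δ i (g ∘ suc))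

  sum-δ₁ : ∀ {m} (i : Fin m) → sum (λ j → ⟦ i == j ⟧) ≡ 1
  sum-δ₁ {m} i = trans (sum-cong {m} {λ j → ⟦ i == j ⟧} {λ j → ⟦ i == j ⟧ * 1} (λ j → sym (*-identityʳ _))) (sum-δ i (λ _ → 1))

  count≡sum : ∀ {m} (p : Fin m → Bool) → count p ≡ sum (λ i → ⟦ p i ⟧)
  count≡sum {zero}  p = refl
  count≡sum {suc m} p with p zero
  ... | true  = cong suc (count≡sum (p ∘ suc))
  ... | false = count≡sum (p ∘ suc)

sum->0 : ∀ {m} (f : Fin m → ℕ) → 0 < sum f → ∃ λ i → 0 < f i
sum->0 {m} f h = sum-<⇒∃ (subst (_< sum f) (sym (trans (sum-const m 0) (*-zeroʳ m))) h)

module _ {A : Set} where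

  ΣL : (A → ℕ) → List A → ℕ
  ΣL f []       = 0
  ΣL f (x ∷ xs) = f x + ΣL f xs

  ΣL-++ : ∀ f xs ys → ΣL f (xs ++ ys) ≡ ΣL f xs + ΣL f ys
  ΣL-++ f []       ys = refl
  ΣL-++ f (x ∷ xs) ys = trans (cong (f x +_) (ΣL-++ f xs ys)) (sym (+-assoc (f x) _ _))

  ΣL-↭ : ∀ f {xs ys} → xs ↭ ys → ΣL f xs ≡ ΣL f ys
  ΣL-↭ f Permutation.refl         = refl
  ΣL-↭ f (Permutation.prep x p)   = cong (f x +_) (ΣL-↭ f p)
  ΣL-↭ f (Permutation.swap {xs} {ys} x y p) =
    trans (cong (λ z → f x + (f y + z)) (ΣL-↭ f p)) (swap+ (f x) (f y) (ΣL f ys))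
    where swap+ : ∀ a b c → a + (b + c) ≡ b + (a + c)
          swap+ = solve-∀
  ΣL-↭ f (Permutation.trans p q)  = trans (ΣL-↭ f p) (ΣL-↭ f q)

  opaque
    unfolding sum

    ΣL-lookup : ∀ f (xs : List A) → sum (f ∘ lookup xs) ≡ ΣL f xs
    ΣL-lookup f []       = refl
    ΣL-lookup f (x ∷ xs) = cong (f x +_) (ΣL-lookup f xs)

  ΣL-length : ∀ {f} → (∀ x → f x ≤ 1) → ∀ (xs : List A) → ΣL f xs ≤ length xs
  ΣL-length h []       = z≤n
  ΣL-length h (x ∷ xs) = +-mono-≤ (h x) (ΣL-length h xs)

  ΣL-mono : ∀ {f g} → (∀ x → f x ≤ g x) → ∀ (xs : List A) → ΣL f xs ≤ ΣL g xs
  ΣL-mono h []       = z≤n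
  ΣL-mono h (x ∷ xs) = +-mono-≤ (h x) (ΣL-mono h xs)

  ΣL-cong : ∀ {f g} → (∀ x → f x ≡ g x) → ∀ (xs : List A) → ΣL f xs ≡ ΣL g xs
  ΣL-cong h []       = refl
  ΣL-cong h (x ∷ xs) = cong₂ _+_ (h x) (ΣL-cong h xs)

  ΣL-+ : ∀ f g (xs : List A) → ΣL (λ x → f x + g x) xs ≡ ΣL f xs + ΣL g xs
  ΣL-+ f g []       = refl
  ΣL-+ f g (x ∷ xs) = trans (cong (f x + g x +_) (ΣL-+ f g xs)) (+-interchange (f x) (g x) (ΣL f xs) (ΣL g xs))

  ΣL-const : ∀ c (xs : List A) → ΣL (λ _ → c) xs ≡ length xs * c
  ΣL-const c []       = refl
  ΣL-const c (x ∷ xs) = cong (c +_) (ΣL-const c xs)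

  ΣL-*ˡ : ∀ c f (xs : List A) → ΣL (λ x → c * f x) xs ≡ c * ΣL f xs
  ΣL-*ˡ c f []       = sym (*-zeroʳ c)
  ΣL-*ˡ c f (x ∷ xs) = trans (cong (c * f x +_) (ΣL-*ˡ c f xs)) (sym (*-distribˡ-+ c _ _))

  ΣL-sum : ∀ {m} (F : Fin m → A → ℕ) xs → ΣL (λ x → sum (λ i → F i x)) xs ≡ sum (λ i → ΣL (F i) xs)
  ΣL-sum {m} F []       = sym (trans (sum-const m 0) (*-zeroʳ m))
  ΣL-sum F (x ∷ xs) = trans (cong (sum (λ i → F i x) +_) (ΣL-sum F xs)) (sym (sum-+ (λ i → F i x) (λ i → ΣL (F i) xs)))

  ΣL->0 : ∀ f (xs : List A) → 0 < ΣL f xs → ∃ λ x → x ∈ xs × 0 < f x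
  ΣL->0 f (x ∷ xs) h with f x in e
  ... | suc k = x , here refl , subst (0 <_) (sym e) (s≤s z≤n)
  ... | zero with ΣL->0 f xs h
  ...   | y , y∈ , lt = y , there y∈ , lt

ΣL-map : ∀ {A B : Set} (f : B → ℕ) (g : A → B) xs → ΣL f (map g xs) ≡ ΣL (f ∘ g) xs
ΣL-map f g []       = refl
ΣL-map f g (x ∷ xs) = cong (f (g x) +_) (ΣL-map f g xs)

opaque
  unfolding sum

  ΣL-allFin : ∀ n (f : Fin n → ℕ) → ΣL f (allFin n) ≡ sum f
  ΣL-allFin zero    f = refl
  ΣL-allFin (suc n) f = cong (f zero +_)
    (trans (cong (ΣL f) (sym (List.map-tabulate id suc))) (trans (ΣL-map f suc (allFin n)) (ΣL-allFin n (f ∘ suc))))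

Unique-↭ : ∀ {A : Set} {xs ys : List A} → xs ↭ ys → Unique xs → Unique ys
Unique-↭ {A} p u = ↭ₛ.Unique-resp-↭ (≡.setoid A) (Permutation.↭⇒↭ₛ p) u

ΣL-concatMap : ∀ {A B : Set} (f : B → ℕ) (g : A → List B) xs → ΣL f (concatMap g xs) ≡ ΣL (λ x → ΣL f (g x)) xs
ΣL-concatMap f g []       = refl
ΣL-concatMap f g (x ∷ xs) = trans (ΣL-++ f (g x) (concatMap g xs)) (cong (ΣL f (g x) +_) (ΣL-concatMap f g xs))

concatMap-All : ∀ {A B : Set} {P : B → Set} {g : A → List B} → (∀ x → All P (g x)) → ∀ xs → All P (concatMap g xs)
concatMap-All h []       = []
concatMap-All h (x ∷ xs) = All.++⁺ (h x) (concatMap-All h xs)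

map-All : ∀ {A B : Set} {P : B → Set} {g : A → B} → (∀ x → P (g x)) → ∀ xs → All P (map g xs)
map-All h []       = []
map-All h (x ∷ xs) = h x ∷ map-All h xs

-- A doubly stochastic matrix supported on a dense relation

-- The left side is at least 1 and the right side at most 2, so a strict inequality forces both
-- wanted events and excludes all three unwanted ones.
pick-all : ∀ b₁ b₂ j o₁ o₂ → 1 + ⟦ j ⟧ + ⟦ o₁ ⟧ + ⟦ o₂ ⟧ < ⟦ b₁ ⟧ + ⟦ b₂ ⟧ →
           b₁ ≡ true × b₂ ≡ true × j ≡ false × o₁ ≡ false × o₂ ≡ false
pick-all true  true  false false false _ = refl , refl , refl , refl , refl
pick-all true  true  false false true  (s≤s (s≤s ()))
pick-all true  true  false true  o₂    (s≤s (s≤s ()))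
pick-all true  true  true  o₁    o₂    (s≤s (s≤s ()))
pick-all true  false j     o₁    o₂    (s≤s ())
pick-all false true  j     o₁    o₂    (s≤s ())
pick-all false false j     o₁    o₂    ()

transpose-cases : ∀ {m} (i a x : Fin m) →
  (x ≡ i × transpose i a ⟨$⟩ʳ x ≡ a) ⊎ (x ≡ a × transpose i a ⟨$⟩ʳ x ≡ i) ⊎
  (x ≢ i × x ≢ a × transpose i a ⟨$⟩ʳ x ≡ x)
transpose-cases i a x with x Fin.≟ i
... | yes e = inj₁ (e , refl)
... | no ne with x Fin.≟ a
...   | yes e = inj₂ (inj₁ (e , refl))
...   | no ne′ = inj₂ (inj₂ (ne , ne′ , refl))

-- A relation in which all degrees exceed half of m by m / q.
record Dense {m : ℕ} (q : ℕ) (E : Fin m → Fin m → Bool) : Set where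
  field
    row : ∀ i → (q + 2) * m ≤ 2 * q * sum (λ j → ⟦ E i j ⟧)
    col : ∀ j → (q + 2) * m ≤ 2 * q * sum (λ i → ⟦ E i j ⟧)

-- `J` marks rows whose correct entries must survive, `ov` the entries already too heavy to be used
-- again. Both are sparse enough for the counting in `exchange`.
module Repair {m q : ℕ} {E : Fin m → Fin m → Bool} (dense : Dense q E) (0<m : 0 < m)
  (J : Fin m → Bool) (J-small : 2 * q * sum (λ i → ⟦ J i ⟧) ≤ m)
  (ov : Fin m → Fin m → Bool)
  (ov-row : ∀ i → 4 * q * sum (λ j → ⟦ ov i j ⟧) ≤ m)
  (ov-col : ∀ j → 4 * q * sum (λ i → ⟦ ov i j ⟧) ≤ m) where

  open Dense dense

  abstract
    -- The row degree of `i` and the column degree of its image add up to at least m + 2m/q, while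
    -- `J` excludes at most m/(2q) candidates and each of the two overload conditions at most
    -- m/(4q).
    exchange : ∀ (σ : Permutation′ m) i → ∃ λ a →
      E i (σ ⟨$⟩ʳ a) ≡ true × E a (σ ⟨$⟩ʳ i) ≡ true × J a ≡ false ×
      ov i (σ ⟨$⟩ʳ a) ≡ false × ov a (σ ⟨$⟩ʳ i) ≡ false
    exchange σ i with sum-<⇒∃ {f = f} {g} lt
      where
      f g : Fin m → ℕ
      f a = 1 + ⟦ J a ⟧ + ⟦ ov i (σ ⟨$⟩ʳ a) ⟧ + ⟦ ov a (σ ⟨$⟩ʳ i) ⟧
      g a = ⟦ E i (σ ⟨$⟩ʳ a) ⟧ + ⟦ E a (σ ⟨$⟩ʳ i) ⟧
      R C j o₁ o₂ : ℕ
      R = sum (λ v → ⟦ E i v ⟧)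
      C = sum (λ a → ⟦ E a (σ ⟨$⟩ʳ i) ⟧)
      j = sum (λ a → ⟦ J a ⟧)
      o₁ = sum (λ v → ⟦ ov i v ⟧)
      o₂ = sum (λ a → ⟦ ov a (σ ⟨$⟩ʳ i) ⟧)
      sumf : sum f ≡ m + j + o₁ + o₂
      sumf = begin
        sum f ≡⟨ sum-+ (λ a → 1 + ⟦ J a ⟧ + ⟦ ov i (σ ⟨$⟩ʳ a) ⟧) _ ⟩
        sum (λ a → 1 + ⟦ J a ⟧ + ⟦ ov i (σ ⟨$⟩ʳ a) ⟧) + o₂
          ≡⟨ cong (_+ o₂) (sum-+ (λ a → 1 + ⟦ J a ⟧) _) ⟩
        sum (λ a → 1 + ⟦ J a ⟧) + sum (λ a → ⟦ ov i (σ ⟨$⟩ʳ a) ⟧) + o₂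
          ≡⟨ cong₂ (λ x y → x + y + o₂) (sum-+ (λ _ → 1) (λ a → ⟦ J a ⟧)) (sum-perm (λ v → ⟦ ov i v ⟧) σ) ⟩
        sum {m} (λ _ → 1) + j + o₁ + o₂
          ≡⟨ cong (λ x → x + j + o₁ + o₂) (trans (sum-const m 1) (*-identityʳ m)) ⟩
        m + j + o₁ + o₂ ∎
        where open ≡-Reasoning
      sumg : sum g ≡ R + C
      sumg = trans (sum-+ (λ a → ⟦ E i (σ ⟨$⟩ʳ a) ⟧) _) (cong (_+ C) (sum-perm (λ v → ⟦ E i v ⟧) σ))
      arith : 2 * q * (m + j + o₁ + o₂) + m ≤ 2 * q * (R + C)
      arith = *-cancelˡ-≤ 2 (begin
        2 * (2 * q * (m + j + o₁ + o₂) + m)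
          ≡⟨ e₁ q m j o₁ o₂ ⟩
        2 * (2 * q * j) + 4 * q * o₁ + 4 * q * o₂ + (4 * q * m + 2 * m)
          ≤⟨ +-monoˡ-≤ _ (+-mono-≤ (+-mono-≤ (*-monoʳ-≤ 2 J-small) (ov-row i)) (ov-col (σ ⟨$⟩ʳ i))) ⟩
        2 * m + m + m + (4 * q * m + 2 * m)
          ≤⟨ ≤-by (2 * m) (e₂ q m) ⟩
        2 * ((q + 2) * m + (q + 2) * m)
          ≤⟨ *-monoʳ-≤ 2 (+-mono-≤ (row i) (col (σ ⟨$⟩ʳ i))) ⟩
        2 * (2 * q * R + 2 * q * C)
          ≡⟨ cong (2 *_) (sym (*-distribˡ-+ (2 * q) R C)) ⟩
        2 * (2 * q * (R + C)) ∎)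
        where
        open ≤-Reasoning
        e₁ : ∀ q m j o₁ o₂ → 2 * (2 * q * (m + j + o₁ + o₂) + m) ≡
             2 * (2 * q * j) + 4 * q * o₁ + 4 * q * o₂ + (4 * q * m + 2 * m)
        e₁ = solve-∀
        e₂ : ∀ q m → 2 * ((q + 2) * m + (q + 2) * m) ≡ 2 * m + m + m + (4 * q * m + 2 * m) + 2 * m
        e₂ = solve-∀
      lt : sum f < sum g
      lt = *-cancelˡ-< (2 * q) _ _ (begin-strict
        2 * q * sum f                 ≡⟨ cong (2 * q *_) sumf ⟩
        2 * q * (m + j + o₁ + o₂)     <⟨ m<m+n _ 0<m ⟩
        2 * q * (m + j + o₁ + o₂) + m ≤⟨ arith ⟩
        2 * q * (R + C)               ≡⟨ cong (2 * q *_) (sym sumg) ⟩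
        2 * q * sum g                 ∎)
        where open ≤-Reasoning
    ... | a , lt = a , pick-all _ _ (J a) _ _ lt

  bad : Permutation′ m → ℕ
  bad σ = sum (λ x → ⟦ not (E x (σ ⟨$⟩ʳ x)) ⟧)

  -- The first half is what keeps the entries of the matrix bounded, the second what makes it cover
  -- all arcs.
  Moved : Permutation′ m → Permutation′ m → Set
  Moved σ σ′ =
    (∀ x → σ′ ⟨$⟩ʳ x ≡ σ ⟨$⟩ʳ x ⊎ ov x (σ′ ⟨$⟩ʳ x) ≡ false) ×
    (∀ x → J x ≡ true → E x (σ ⟨$⟩ʳ x) ≡ true → σ′ ⟨$⟩ʳ x ≡ σ ⟨$⟩ʳ x)

  Moved-trans : ∀ {σ σ₁ σ₂} → Moved σ σ₁ → Moved σ₁ σ₂ → Moved σ σ₂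
  Moved-trans {σ} {σ₁} {σ₂} (f , g) (f′ , g′) = h , k
    where
    h : ∀ x → σ₂ ⟨$⟩ʳ x ≡ σ ⟨$⟩ʳ x ⊎ ov x (σ₂ ⟨$⟩ʳ x) ≡ false
    h x with f′ x | f x
    ... | inj₂ o | _      = inj₂ o
    ... | inj₁ e | inj₁ d = inj₁ (trans e d)
    ... | inj₁ e | inj₂ o = inj₂ (trans (cong (ov x) e) o)
    k : ∀ x → J x ≡ true → E x (σ ⟨$⟩ʳ x) ≡ true → σ₂ ⟨$⟩ʳ x ≡ σ ⟨$⟩ʳ x
    k x Jx Ex = trans (g′ x Jx (trans (cong (E x) (g x Jx Ex)) Ex)) (g x Jx Ex)

  -- Row `i` turns from bad to good and row `a` is good afterwards whatever it was, so `bad` drops.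
  -- A good row in `J` is neither `i` nor `a`.
  swap-moved : ∀ σ i a → E i (σ ⟨$⟩ʳ i) ≡ false → E i (σ ⟨$⟩ʳ a) ≡ true → E a (σ ⟨$⟩ʳ i) ≡ true →
    J a ≡ false → ov i (σ ⟨$⟩ʳ a) ≡ false → ov a (σ ⟨$⟩ʳ i) ≡ false →
    bad (transpose i a ∘ₚ σ) < bad σ × Moved σ (transpose i a ∘ₚ σ)
  swap-moved σ i a Ei Eia Eai Ja oia oai = sum-strict pt i strict , g₂ , g₃
    where
    σ₁ : Permutation′ m
    σ₁ = transpose i a ∘ₚ σ
    at : ∀ x {y} → transpose i a ⟨$⟩ʳ x ≡ y → σ₁ ⟨$⟩ʳ x ≡ σ ⟨$⟩ʳ y
    at x e = cong (σ ⟨$⟩ʳ_) e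
    good₁ : ∀ x y → transpose i a ⟨$⟩ʳ x ≡ y → E x (σ ⟨$⟩ʳ y) ≡ true → ⟦ not (E x (σ₁ ⟨$⟩ʳ x)) ⟧ ≡ 0
    good₁ x y e h = cong (⟦_⟧ ∘ not) (trans (cong (E x) (at x e)) h)
    pt : ∀ x → ⟦ not (E x (σ₁ ⟨$⟩ʳ x)) ⟧ ≤ ⟦ not (E x (σ ⟨$⟩ʳ x)) ⟧
    pt x with transpose-cases i a x
    ... | inj₁ (refl , e) = ≤-trans (≤-reflexive (good₁ x a e Eia)) z≤n
    ... | inj₂ (inj₁ (refl , e)) = ≤-trans (≤-reflexive (good₁ x i e Eai)) z≤n
    ... | inj₂ (inj₂ (_ , _ , e)) = ≤-reflexive (cong (λ y → ⟦ not (E x y) ⟧) (at x e))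
    strict : ⟦ not (E i (σ₁ ⟨$⟩ʳ i)) ⟧ < ⟦ not (E i (σ ⟨$⟩ʳ i)) ⟧
    strict with transpose-cases i a i
    ... | inj₁ (_ , e) = subst₂ _<_ (sym (good₁ i a e Eia)) (sym (cong (⟦_⟧ ∘ not) Ei)) (s≤s z≤n)
    ... | inj₂ (inj₁ (refl , e)) = subst₂ _<_ (sym (good₁ i i e Eai)) (sym (cong (⟦_⟧ ∘ not) Ei)) (s≤s z≤n)
    ... | inj₂ (inj₂ (ne , _)) = ⊥-elim (ne refl)
    g₂ : ∀ x → σ₁ ⟨$⟩ʳ x ≡ σ ⟨$⟩ʳ x ⊎ ov x (σ₁ ⟨$⟩ʳ x) ≡ false
    g₂ x with transpose-cases i a x
    ... | inj₁ (refl , e′) = inj₂ (trans (cong (ov x) (at x e′)) oia)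
    ... | inj₂ (inj₁ (refl , e′)) = inj₂ (trans (cong (ov x) (at x e′)) oai)
    ... | inj₂ (inj₂ (_ , _ , e′)) = inj₁ (at x e′)
    g₃ : ∀ x → J x ≡ true → E x (σ ⟨$⟩ʳ x) ≡ true → σ₁ ⟨$⟩ʳ x ≡ σ ⟨$⟩ʳ x
    g₃ x Jx Ex with transpose-cases i a x
    ... | inj₁ (refl , _) = ⊥-elim (true≢false Ex Ei)
    ... | inj₂ (inj₁ (refl , _)) = ⊥-elim (true≢false Jx Ja)
    ... | inj₂ (inj₂ (_ , _ , e)) = at x e

  improve : ∀ σ → 0 < bad σ → ∃ λ σ₁ → bad σ₁ < bad σ × Moved σ σ₁
  improve σ h =
    let i , badi = sum->0 _ h
        a , Eia , Eai , Ja , oia , oai = exchange σ i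
    in transpose i a ∘ₚ σ , swap-moved σ i a (not-true (⟦⟧>0 badi)) Eia Eai Ja oia oai

  Repaired : Permutation′ m → Permutation′ m → Set
  Repaired σ σ′ = (∀ x → E x (σ′ ⟨$⟩ʳ x) ≡ true) × Moved σ σ′

  no-bad : ∀ σ → bad σ ≡ 0 → ∀ x → E x (σ ⟨$⟩ʳ x) ≡ true
  no-bad σ eq x with E x (σ ⟨$⟩ʳ x) in e
  ... | true = refl
  ... | false = contradiction (trans (sym (cong (⟦_⟧ ∘ not) e)) (sum-zero eq x)) λ ()

  abstract
    repair : ∀ fuel σ → bad σ ≤ fuel → ∃ (Repaired σ)
    repair zero σ le = σ , no-bad σ (n≤0⇒n≡0 le) , (λ x → inj₁ refl) , (λ _ _ _ → refl)
    repair (suc fuel) σ le with 0 <? bad σ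
    ... | no z = σ , no-bad σ (n≤0⇒n≡0 (≮⇒≥ z)) , (λ x → inj₁ refl) , (λ _ _ _ → refl)
    ... | yes h =
      let σ₁ , less , mv = improve σ h
          σ₂ , good , mv′ = repair fuel σ₁ (≤-pred (≤-trans less le))
      in σ₂ , good , Moved-trans {σ} {σ₁} {σ₂} mv mv′

-- W / M is a doubly stochastic matrix.
record Kernel {m : ℕ} (E : Fin m → Fin m → Bool) (M C : ℕ) : Set where
  field
    W   : Fin m → Fin m → ℕ
    row : ∀ i → sum (W i) ≡ M
    col : ∀ j → sum (λ i → W i j) ≡ M
    sup : ∀ i j → 0 < W i j → E i j ≡ true
    cov : ∀ i j → E i j ≡ true → 1 ≤ W i j
    cap : ∀ i j → W i j ≤ C

module Process {m q : ℕ} {E : Fin m → Fin m → Bool} (dense : Dense q E) (0<m : 0 < m)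
  (C₀ Tot : ℕ) (0<C₀ : 0 < C₀) (C₀-large : 4 * q * Tot ≤ C₀ * m) where

  Task : Set
  Task = Permutation′ m × (Fin m → Bool)

  uses : Fin m → Fin m → Task → ℕ
  uses x v (τ , _) = ⟦ (τ ⟨$⟩ʳ x) == v ⟧

  -- An entry grows either because it was below `C₀`, or because the permutation of the task had it
  -- from the start; `uses` counts the second case, hence the form of `cap`.
  record Processed (ts : List Task) : Set where
    field
      W   : Fin m → Fin m → ℕ
      row : ∀ i → sum (W i) ≡ length ts
      col : ∀ j → sum (λ i → W i j) ≡ length ts
      sup : ∀ i j → 0 < W i j → E i j ≡ true
      cap : ∀ i j → W i j ≤ C₀ + ΣL (uses i j) ts
      cov : ∀ {τ J} → (τ , J) ∈ ts → ∀ x → J x ≡ true → E x (τ ⟨$⟩ʳ x) ≡ true → 1 ≤ W x (τ ⟨$⟩ʳ x)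

  over : ℕ → Bool
  over w = C₀ ≤ᵇ w

  over-≤ : ∀ w → C₀ * ⟦ over w ⟧ ≤ w
  over-≤ w with C₀ ≤ᵇ w in e
  ... | true  = ≤-trans (≤-reflexive (*-identityʳ C₀)) (≤ᵇ⇒≤ C₀ w (subst T (sym e) tt))
  ... | false = ≤-trans (≤-reflexive (*-zeroʳ C₀)) z≤n

  not-over : ∀ w → over w ≡ false → w < C₀
  not-over w e = ≰⇒> (λ le → subst T e (≤⇒≤ᵇ le))

  -- Markov's inequality: at most Tot / C₀ entries of a row or column reach `C₀`.
  over-count : ∀ (w : Fin m → ℕ) → sum w ≤ Tot → 4 * q * sum (λ i → ⟦ over (w i) ⟧) ≤ m
  over-count w le = *-cancelˡ-≤ C₀ {{>-nonZero 0<C₀}} (begin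
    C₀ * (4 * q * o)      ≡⟨ e C₀ q o ⟩
    4 * q * (C₀ * o)      ≡⟨ cong (4 * q *_) (sym (sum-*ˡ C₀ (λ i → ⟦ over (w i) ⟧))) ⟩
    4 * q * sum (λ i → C₀ * ⟦ over (w i) ⟧) ≤⟨ *-monoʳ-≤ (4 * q) (≤-trans (sum-mono (over-≤ ∘ w)) le) ⟩
    4 * q * Tot           ≤⟨ C₀-large ⟩
    C₀ * m                ∎)
    where
    open ≤-Reasoning
    o = sum (λ i → ⟦ over (w i) ⟧)
    e : ∀ c q o → c * (4 * q * o) ≡ 4 * q * (c * o)
    e = solve-∀

  module _ (τ : Permutation′ m) (J : Fin m → Bool) (ts : List Task) (prev : Processed ts)
    (le : length ts ≤ Tot) (small : 2 * q * sum (λ i → ⟦ J i ⟧) ≤ m) where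

    open Processed prev
    open Repair dense 0<m J small (λ i j → over (W i j))
      (λ i → over-count (W i) (≤-trans (≤-reflexive (row i)) le))
      (λ j → over-count (λ i → W i j) (≤-trans (≤-reflexive (col j)) le))

    module _ (σ : Permutation′ m) (rep : Repaired τ σ) where

      process-step : Processed ((τ , J) ∷ ts)
      process-step = record
        { W = W′
        ; row = λ i → trans (sum-+ (W i) _) (trans (cong₂ _+_ (row i) (sum-δ₁ (σ ⟨$⟩ʳ i))) (+-comm _ 1))
        ; col = λ j → trans (sum-+ (λ i → W i j) _) (trans (cong₂ _+_ (col j) (col-δ j)) (+-comm _ 1))
        ; sup = sup′
        ; cap = cap′
        ; cov = cov′
        }
        where
        W′ : Fin m → Fin m → ℕ
        W′ x v = W x v + ⟦ (σ ⟨$⟩ʳ x) == v ⟧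
        col-δ : ∀ j → sum (λ i → ⟦ (σ ⟨$⟩ʳ i) == j ⟧) ≡ 1
        col-δ j = trans (sum-perm (λ v → ⟦ v == j ⟧) σ)
          (trans (sum-cong (λ v → cong ⟦_⟧ (==-sym v j))) (sum-δ₁ j))
        sup′ : ∀ i j → 0 < W′ i j → E i j ≡ true
        sup′ i j h with (σ ⟨$⟩ʳ i) == j in e
        ... | true  = subst (λ v → E i v ≡ true) (==-true e) (proj₁ rep i)
        ... | false = sup i j (subst (0 <_) (+-identityʳ _) h)
        cap′ : ∀ i j → W′ i j ≤ C₀ + (⟦ (τ ⟨$⟩ʳ i) == j ⟧ + ΣL (uses i j) ts)
        cap′ i j with (σ ⟨$⟩ʳ i) == j in e
        ... | false = ≤-trans (≤-reflexive (+-identityʳ _)) (≤-trans (cap i j) (+-monoʳ-≤ C₀ (m≤n+m _ _)))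
        ... | true with proj₁ (proj₂ rep) i
        ...   | inj₁ same = begin
          W i j + 1                        ≤⟨ +-monoˡ-≤ 1 (cap i j) ⟩
          C₀ + ΣL (uses i j) ts + 1        ≡⟨ trans (+-assoc C₀ _ 1) (cong (C₀ +_) (+-comm _ 1)) ⟩
          C₀ + (1 + ΣL (uses i j) ts)      ≡⟨ cong (λ b → C₀ + (⟦ b ⟧ + ΣL (uses i j) ts)) (sym (trans (cong (_== j) (sym same)) e)) ⟩
          C₀ + (⟦ (τ ⟨$⟩ʳ i) == j ⟧ + ΣL (uses i j) ts) ∎
          where open ≤-Reasoning
        ...   | inj₂ o = begin
          W i j + 1  ≡⟨ +-comm _ 1 ⟩
          suc (W i j) ≤⟨ not-over _ (subst (λ v → over (W i v) ≡ false) (==-true e) o) ⟩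
          C₀          ≤⟨ m≤m+n _ _ ⟩
          C₀ + (⟦ (τ ⟨$⟩ʳ i) == j ⟧ + ΣL (uses i j) ts) ∎
          where open ≤-Reasoning
        cov′ : ∀ {τ₁ J₁} → (τ₁ , J₁) ∈ (τ , J) ∷ ts → ∀ x → J₁ x ≡ true → E x (τ₁ ⟨$⟩ʳ x) ≡ true → 1 ≤ W′ x (τ₁ ⟨$⟩ʳ x)
        cov′ (there p) x Jx Ex = ≤-trans (cov p x Jx Ex) (m≤m+n _ _)
        cov′ (here refl) x Jx Ex = ≤-trans (≤-reflexive (cong ⟦_⟧ (sym (trans (cong (_== (τ ⟨$⟩ʳ x))
          (proj₂ (proj₂ rep) x Jx Ex)) (==-refl (τ ⟨$⟩ʳ x)))))) (m≤n+m _ _)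

    process-cons : Processed ((τ , J) ∷ ts)
    process-cons = let σ , rep = repair (bad τ) τ ≤-refl in process-step σ rep

  process : ∀ ts → length ts ≤ Tot → All (λ t → 2 * q * sum (λ i → ⟦ proj₂ t i ⟧) ≤ m) ts → Processed ts
  process [] _ _ = record
    { W = λ _ _ → 0
    ; row = λ i → trans (sum-const m 0) (*-zeroʳ m)
    ; col = λ i → trans (sum-const m 0) (*-zeroʳ m)
    ; sup = λ _ _ ()
    ; cap = λ _ _ → z≤n
    ; cov = λ ()
    }
  process ((τ , J) ∷ ts) le (small ∷ smalls) =
    let le′ = ≤-trans (n≤1+n _) le in process-cons τ J ts (process ts le′ smalls) le′ small

module Reflection (m : ℕ) where

  -- Congruence of x + v and k modulo m, for residues. The reflections x ↦ k - x are their own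
  -- inverses, and each pair (x, v) lies on exactly one of them, so these m permutations partition
  -- all pairs.
  Refl : ℕ → ℕ → ℕ → Set
  Refl k x v = x + v ≡ k ⊎ x + v ≡ m + k

  Refl-sym : ∀ {k x v} → Refl k x v → Refl k v x
  Refl-sym {k} {x} {v} = [ inj₁ ∘ trans (+-comm v x) , inj₂ ∘ trans (+-comm v x) ]′

  Refl-unique : ∀ {k x v v′} → v < m → v′ < m → Refl k x v → Refl k x v′ → v ≡ v′
  Refl-unique {k} {x} {v} {v′} lt lt′ = go
    where
    clash : ∀ {v v′} → v < m → x + v ≡ m + k → x + v′ ≡ k → ⊥
    clash {v} {v′} lt e e′ = <-irrefl refl (<-≤-trans lt (≤-trans (m≤m+n m v′)
      (≤-reflexive (sym (+-cancelˡ-≡ x _ _ (trans e (trans (cong (m +_) (sym e′)) (sw m x v′))))))))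
      where sw : ∀ m x v → m + (x + v) ≡ x + (m + v)
            sw = solve-∀
    go : Refl k x v → Refl k x v′ → v ≡ v′
    go (inj₁ e) (inj₁ e′) = +-cancelˡ-≡ x _ _ (trans e (sym e′))
    go (inj₂ e) (inj₂ e′) = +-cancelˡ-≡ x _ _ (trans e (sym e′))
    go (inj₁ e) (inj₂ e′) = ⊥-elim (clash lt′ e′ e)
    go (inj₂ e) (inj₁ e′) = ⊥-elim (clash lt e e′)

  Refl-centre : ∀ {k k′ x v} → k < m → k′ < m → Refl k x v → Refl k′ x v → k ≡ k′
  Refl-centre lt lt′ (inj₁ e) (inj₁ e′) = trans (sym e) e′
  Refl-centre lt lt′ (inj₂ e) (inj₂ e′) = +-cancelˡ-≡ m _ _ (trans (sym e) e′)
  Refl-centre lt lt′ (inj₁ e) (inj₂ e′) = ⊥-elim (<-irrefl refl (<-≤-trans lt (≤-trans (m≤m+n m _) (≤-reflexive (trans (sym e′) e)))))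
  Refl-centre lt lt′ (inj₂ e) (inj₁ e′) = ⊥-elim (<-irrefl refl (<-≤-trans lt′ (≤-trans (m≤m+n m _) (≤-reflexive (trans (sym e) e′)))))

  reflect : (k x : Fin m) → Σ (Fin m) λ v → Refl (toℕ k) (toℕ x) (toℕ v)
  reflect k x with toℕ x ≤? toℕ k
  ... | yes le = fromℕ< lt , inj₁ (trans (cong (toℕ x +_) (Fin.toℕ-fromℕ< lt)) (m+[n∸m]≡n le))
    where lt : toℕ k ∸ toℕ x < m
          lt = ≤-<-trans (m∸n≤m (toℕ k) (toℕ x)) (Fin.toℕ<n k)
  ... | no gt = fromℕ< lt , inj₂ (trans (cong (toℕ x +_) (Fin.toℕ-fromℕ< lt)) (m+[n∸m]≡n le))
    where le : toℕ x ≤ m + toℕ k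
          le = ≤-trans (<⇒≤ (Fin.toℕ<n x)) (m≤m+n m _)
          lt : m + toℕ k ∸ toℕ x < m
          lt = +-cancelˡ-< (toℕ x) _ _ (subst₂ _<_ (sym (m+[n∸m]≡n le)) (+-comm m (toℕ x)) (+-monoʳ-< m (≰⇒> gt)))

  ρ : Fin m → Fin m → Fin m
  ρ k x = proj₁ (reflect k x)

  ρ-unique : ∀ {k x v} → Refl (toℕ k) (toℕ x) (toℕ v) → ρ k x ≡ v
  ρ-unique {k} {x} {v} r = Fin.toℕ-injective
    (Refl-unique (Fin.toℕ<n _) (Fin.toℕ<n v) (proj₂ (reflect k x)) r)

  ρ-involutive : ∀ k x → ρ k (ρ k x) ≡ x
  ρ-involutive k x = ρ-unique {k} {ρ k x} {x} (Refl-sym {toℕ k} {toℕ x} {toℕ (ρ k x)} (proj₂ (reflect k x)))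

  centre : ∀ x v → ∃ λ k → Refl (toℕ k) (toℕ x) (toℕ v)
  centre x v with toℕ x + toℕ v <? m
  ... | yes lt = fromℕ< lt , inj₁ (sym (Fin.toℕ-fromℕ< lt))
  ... | no ge = fromℕ< lt , inj₂ (sym (trans (cong (m +_) (Fin.toℕ-fromℕ< lt)) (m+[n∸m]≡n (≮⇒≥ ge))))
    where lt : toℕ x + toℕ v ∸ m < m
          lt = +-cancelˡ-< m _ _ (subst (_< m + m) (sym (m+[n∸m]≡n (≮⇒≥ ge))) (+-mono-< {toℕ x} {m} {toℕ v} {m} (Fin.toℕ<n x) (Fin.toℕ<n v)))

  perm : Fin m → Permutation′ m
  perm k = permutation (ρ k) (ρ k) (ρ-involutive k) (ρ-involutive k)

  perm-uses : ∀ x v → sum (λ k → ⟦ ρ k x == v ⟧) ≤ 1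
  perm-uses x v with centre x v
  ... | c , r = ≤-trans (sum-mono pt) (≤-reflexive (sum-δ₁ c))
    where
    pt : ∀ k → ⟦ ρ k x == v ⟧ ≤ ⟦ c == k ⟧
    pt k with ρ k x == v in e
    ... | false = z≤n
    ... | true = ≤-reflexive (cong ⟦_⟧ (sym (trans (cong (_== k) ck) (==-refl k))))
      where
      ck : c ≡ k
      ck = Fin.toℕ-injective (Refl-centre {x = toℕ x} {toℕ v} (Fin.toℕ<n c) (Fin.toℕ<n k) r
             (subst (λ y → Refl (toℕ k) (toℕ x) (toℕ y)) (==-true e) (proj₂ (reflect k x))))

-- The indicator of the interval from lo to lo + s - 1, recursive in all arguments so that its
-- points can be counted by induction.
inI : ℕ → ℕ → ℕ → Bool
inI (suc lo) s       zero    = false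
inI (suc lo) s       (suc x) = inI lo s x
inI zero     zero    x       = false
inI zero     (suc s) zero    = true
inI zero     (suc s) (suc x) = inI zero s x

inI-true : ∀ lo s k → k < s → inI lo s (lo + k) ≡ true
inI-true (suc lo) s k lt = inI-true lo s k lt
inI-true zero (suc s) zero lt = refl
inI-true zero (suc s) (suc k) (s≤s lt) = inI-true zero s k lt

inI-count : ∀ m lo s → sum {m} (λ x → ⟦ inI lo s (toℕ x) ⟧) ≤ s
inI-count zero lo s = ≤-trans (≤-reflexive (sum-[] _)) z≤n
inI-count (suc m) (suc lo) s = ≤-trans (≤-reflexive (sum-suc _)) (inI-count m lo s)
inI-count (suc m) zero zero = ≤-reflexive (trans (sum-const (suc m) 0) (*-zeroʳ m))
inI-count (suc m) zero (suc s) = ≤-trans (≤-reflexive (sum-suc _)) (s≤s (inI-count m zero s))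

factor>0 : ∀ {m} b s → 0 < m → m ≤ b * s → 0 < b
factor>0 zero    s 0<m le = ⊥-elim (<-irrefl refl (<-≤-trans 0<m le))
factor>0 (suc b) s 0<m le = s≤s z≤n

module _ {m q : ℕ} {E : Fin m → Fin m → Bool} (dense : Dense q E) (0<m : 0 < m)
  (s b : ℕ) (0<q : 0 < q) (0<s : 0 < s) (s-small : 2 * q * s ≤ m) (b-large : m ≤ b * s) where

  private instance
    s-nonZero : NonZero s
    s-nonZero = >-nonZero 0<s

  open Reflection m

  private
    0<b : 0 < b
    0<b = factor>0 b s 0<m b-large

    C₀ = 4 * q * b
    0<C₀ : 0 < C₀
    0<C₀ = *-mono-≤ (*-mono-≤ (s≤s {0} {3} z≤n) 0<q) 0<b

    C₀-large : ∀ q m b → 4 * q * (m * b) ≡ 4 * q * b * m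
    C₀-large = solve-∀

    open Process dense 0<m C₀ (m * b) 0<C₀ (≤-reflexive (C₀-large q m b))

    block : Fin b → Fin m → Bool
    block β x = inI (toℕ β * s) s (toℕ x)

    -- One task for each reflection and each block of rows. A reflection cannot be protected as a
    -- whole, because `exchange` needs a small `J`; it is repaired once per block instead.
    tasks : List Task
    tasks = concatMap (λ k → map (λ β → perm k , block β) (allFin b)) (allFin m)

    ΣL-tasks : ∀ f → ΣL f tasks ≡ sum (λ k → sum (λ β → f (perm k , block β)))
    ΣL-tasks f = trans (ΣL-concatMap f _ (allFin m)) (trans (ΣL-allFin m _)
      (sum-cong (λ k → trans (ΣL-map f _ (allFin b)) (ΣL-allFin b _))))

    length-tasks : length tasks ≡ m * b
    length-tasks = begin
      length tasks                           ≡⟨ sym (trans (ΣL-const 1 tasks) (*-identityʳ _)) ⟩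
      ΣL (λ _ → 1) tasks                     ≡⟨ ΣL-tasks (λ _ → 1) ⟩
      sum {m} (λ k → sum {b} (λ β → 1))      ≡⟨ sum-cong {m} (λ _ → trans (sum-const b 1) (*-identityʳ b)) ⟩
      sum {m} (λ k → b)                      ≡⟨ sum-const m b ⟩
      m * b                                  ∎
      where open ≡-Reasoning

    task∈ : ∀ k β → (perm k , block β) ∈ tasks
    task∈ k β = ∈-concatMap⁺ _ (Any.map (λ { refl → ∈-map⁺ _ (∈-allFin β) }) (∈-allFin k))

    all-small : All (λ t → 2 * q * sum (λ i → ⟦ proj₂ t i ⟧) ≤ m) tasks
    all-small = concatMap-All (λ k → map-All (λ β →
      ≤-trans (*-monoʳ-≤ (2 * q) (inI-count m (toℕ β * s) s)) s-small) (allFin b)) (allFin m)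

    P : Processed tasks
    P = process tasks (≤-reflexive length-tasks) all-small

    module P = Processed P

    in-block : ∀ x → ∃ λ β → block β x ≡ true
    in-block x = β , subst (λ y → inI (toℕ β * s) s y ≡ true) (sym e) (inI-true (toℕ β * s) s _ (m%n<n (toℕ x) s))
      where
      lt : toℕ x / s < b
      lt = m<n*o⇒m/o<n (<-≤-trans (Fin.toℕ<n x) b-large)
      β = fromℕ< lt
      e : toℕ x ≡ toℕ β * s + toℕ x % s
      e = trans (m≡m%n+[m/n]*n (toℕ x) s) (trans (+-comm (toℕ x % s) _)
            (cong (λ y → y * s + toℕ x % s) (sym (Fin.toℕ-fromℕ< lt))))

  -- An arc from x to v lies on the reflection with centre x + v, and the task for the block of x
  -- preserves it there. Each pair is used by the `b` tasks of one reflection only, which adds `b`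
  -- to the cap.
  kernel : Kernel E (m * b) (4 * q * b + b)
  kernel = record
    { W = P.W
    ; row = λ i → trans (P.row i) length-tasks
    ; col = λ j → trans (P.col j) length-tasks
    ; sup = P.sup
    ; cov = cov
    ; cap = cap
    }
    where
    cov : ∀ x v → E x v ≡ true → 1 ≤ P.W x v
    cov x v Exv = subst (λ y → 1 ≤ P.W x y) e
        (P.cov (task∈ (proj₁ (centre x v)) (proj₁ (in-block x))) x (proj₂ (in-block x)) (trans (cong (E x) e) Exv))
      where e : ρ (proj₁ (centre x v)) x ≡ v
            e = ρ-unique {proj₁ (centre x v)} {x} {v} (proj₂ (centre x v))
    cap : ∀ x v → P.W x v ≤ 4 * q * b + b
    cap x v = ≤-trans (P.cap x v) (+-monoʳ-≤ C₀ (begin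
      ΣL (uses x v) tasks                       ≡⟨ ΣL-tasks (uses x v) ⟩
      sum (λ k → sum {b} (λ β → ⟦ ρ k x == v ⟧)) ≡⟨ sum-cong (λ k → sum-const b _) ⟩
      sum (λ k → b * ⟦ ρ k x == v ⟧)            ≡⟨ sum-*ˡ b _ ⟩
      b * sum (λ k → ⟦ ρ k x == v ⟧)            ≤⟨ *-monoʳ-≤ b (perm-uses x v) ⟩
      b * 1                                     ≡⟨ *-identityʳ b ⟩
      b                                         ∎))
      where open ≤-Reasoning

-- Tree-indexed random walks

data Tree (A : Set) : Set where
  node : A → List (Bool × Tree A) → Tree A

Forest : Set → Set
Forest A = List (Bool × Tree A)

module _ {A : Set} where

  size : Forest A → ℕ
  size []                    = 0
  size ((s , node x cs) ∷ F) = suc (size cs + size F)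

  levels : ℕ → Forest A → ℕ
  levels zero    F                     = 0
  levels (suc d) []                    = 0
  levels (suc d) ((s , node x cs) ∷ F) = suc (levels d cs + levels (suc d) F)

-- Depth is counted in pairs of levels, since the walk contracts once in two steps.
double : ℕ → ℕ
double zero    = 0
double (suc h) = suc (suc (double h))

mem : ∀ {m} → Fin m → List (Fin m) → Bool
mem j []      = false
mem j (v ∷ F) = (v == j) ∨ mem j F

mem-∉ : ∀ {m} {j : Fin m} F → mem j F ≡ false → j ∉ F
mem-∉ {j = j} (v ∷ F) e (here refl) with j == j | ==-refl j
... | true | _ = case e of λ ()
mem-∉ {j = j} (v ∷ F) e (there p) with v == j
... | false = mem-∉ F e p

⟦∨⟧ : ∀ b c → ⟦ b ∨ c ⟧ ≤ ⟦ b ⟧ + ⟦ c ⟧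
⟦∨⟧ true  c = s≤s z≤n
⟦∨⟧ false c = ≤-refl

⟦⟧-split : ∀ b w → w ≡ ⟦ b ⟧ * w + ⟦ not b ⟧ * w
⟦⟧-split true  w = sym (trans (+-identityʳ _) (+-identityʳ w))
⟦⟧-split false w = sym (+-identityʳ w)

-- With M = R + b this is 1 - (R / M) ^ H ≤ H b / M: the share lost when every one of H steps avoids
-- a set of weight b.
bernoulli : ∀ R b H → (R + b) ^ H * (R + b) ≤ R ^ H * (R + b) + (R + b) ^ H * (H * b)
bernoulli R b zero = ≤-reflexive (sym (+-identityʳ _))
bernoulli R b (suc H) = begin
  (R + b) * (R + b) ^ H * (R + b)
    ≡⟨ *-assoc (R + b) _ _ ⟩
  (R + b) * ((R + b) ^ H * (R + b))
    ≤⟨ *-monoʳ-≤ (R + b) (bernoulli R b H) ⟩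
  (R + b) * (R ^ H * (R + b) + (R + b) ^ H * (H * b))
    ≡⟨ e₁ R b H (R ^ H) ((R + b) ^ H) ⟩
  R * R ^ H * (R + b) + ((R + b) * R ^ H * b + (R + b) * (R + b) ^ H * (H * b))
    ≤⟨ +-monoʳ-≤ (R * R ^ H * (R + b)) (+-monoˡ-≤ _ (*-monoˡ-≤ b (*-monoʳ-≤ (R + b) (^-monoˡ-≤ H (m≤m+n R b))))) ⟩
  R * R ^ H * (R + b) + ((R + b) * (R + b) ^ H * b + (R + b) * (R + b) ^ H * (H * b))
    ≡⟨ e₂ R b H (R ^ H) ((R + b) ^ H) ⟩
  R * R ^ H * (R + b) + (R + b) * (R + b) ^ H * (b + H * b) ∎
  where
  open ≤-Reasoning
  e₁ : ∀ R b H x y → (R + b) * (x * (R + b) + y * (H * b)) ≡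
       R * x * (R + b) + ((R + b) * x * b + (R + b) * y * (H * b))
  e₁ = solve-∀
  e₂ : ∀ R b H x y → R * x * (R + b) + ((R + b) * y * b + (R + b) * y * (H * b)) ≡
       R * x * (R + b) + (R + b) * y * (b + H * b)
  e₂ = solve-∀

record SignedKernel {m : ℕ} (E : Bool → Fin m → Fin m → Bool) (M C : ℕ) : Set where
  field
    W   : Bool → Fin m → Fin m → ℕ
    row : ∀ s i → sum (W s i) ≡ M
    col : ∀ s j → sum (λ i → W s i j) ≡ M
    sup : ∀ s i j → 0 < W s i j → E s i j ≡ true
    cov : ∀ s i j → E s i j ≡ true → 1 ≤ W s i j
    cap : ∀ s i j → W s i j ≤ C

-- positions, in preorder, of a forest whose roots hang from a given position
data Emb {m : ℕ} (E : Bool → Fin m → Fin m → Bool) {A : Set} : Fin m → Forest A → List (Fin m) → Set where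
  []   : ∀ {i} → Emb E i [] []
  cons : ∀ {i s x cs F j js ks} → E s i j ≡ true → Emb E j cs js → Emb E i F ks →
         Emb E i ((s , node x cs) ∷ F) (j ∷ js ++ ks)

Emb-length : ∀ {m} {E : Bool → Fin m → Fin m → Bool} {A : Set} {i} {F : Forest A} {js} → Emb E i F js → length js ≡ size F
Emb-length [] = refl
Emb-length (cons {js = js} _ d d′) = cong suc (trans (List.length-++ js) (cong₂ _+_ (Emb-length d) (Emb-length d′)))

module TreeWalk {m : ℕ} {E : Bool → Fin m → Fin m → Bool} {M C : ℕ} (kernel : SignedKernel E M C)
  (0<m : 0 < m) (Φ : Fin m → ℕ) (Ψ : ℕ) (Φ≤Ψ : ∀ i → Φ i ≤ Ψ) where

  open SignedKernel kernel

  S : ℕ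
  S = sum Φ

  -- The transition operator without its denominator, that is M times an expectation.
  P : Bool → (Fin m → ℕ) → Fin m → ℕ
  P s φ i = sum (λ j → W s i j * φ j)

  P-mono : ∀ s {φ ψ} i → (∀ j → φ j ≤ ψ j) → P s φ i ≤ P s ψ i
  P-mono s i h = sum-mono (λ j → *-monoʳ-≤ (W s i j) (h j))

  P-+ : ∀ s φ ψ i → P s (λ j → φ j + ψ j) i ≡ P s φ i + P s ψ i
  P-+ s φ ψ i = trans (sum-cong (λ j → *-distribˡ-+ (W s i j) (φ j) (ψ j)))
                      (sum-+ (λ j → W s i j * φ j) (λ j → W s i j * ψ j))

  P-* : ∀ s c φ i → P s (λ j → c * φ j) i ≡ c * P s φ i
  P-* s c φ i = trans (sum-cong (λ j → e (W s i j) c (φ j))) (sum-*ˡ c (λ j → W s i j * φ j))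
    where e : ∀ w c x → w * (c * x) ≡ c * (w * x)
          e = solve-∀

  P-const : ∀ s c i → P s (λ _ → c) i ≡ M * c
  P-const s c i = trans (sum-*ʳ c (W s i)) (cong (_* c) (row s i))

  P-≤ : ∀ s φ c i → (∀ j → φ j ≤ c) → P s φ i ≤ M * c
  P-≤ s φ c i h = ≤-trans (P-mono s i h) (≤-reflexive (P-const s c i))

  P-sum : ∀ s φ → sum (P s φ) ≡ M * sum φ
  P-sum s φ = begin
    sum (λ i → sum (λ j → W s i j * φ j)) ≡⟨ sum-comm (λ i j → W s i j * φ j) ⟩
    sum (λ j → sum (λ i → W s i j * φ j)) ≡⟨ sum-cong (λ j → trans (sum-*ʳ (φ j) (λ i → W s i j)) (cong (_* φ j) (col s j))) ⟩
    sum (λ j → M * φ j)                   ≡⟨ sum-*ˡ M φ ⟩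
    M * sum φ                             ∎
    where open ≡-Reasoning

  P-cov : ∀ s i φ → sum (λ j → ⟦ E s i j ⟧ * φ j) ≤ P s φ i
  P-cov s i φ = sum-mono (λ j → *-monoˡ-≤ (φ j) (pt j))
    where
    pt : ∀ j → ⟦ E s i j ⟧ ≤ W s i j
    pt j with E s i j in e
    ... | true  = cov s i j e
    ... | false = z≤n

  module _ {A : Set} where

    -- M ^ H times the expected value of Φ summed over the forest, whose roots hang from i, when
    -- every vertex moves from its parent's position by the transition matrix W / M.
    DF : ℕ → Forest A → Fin m → ℕ
    DF zero    F                     i = 0
    DF (suc H) []                    i = 0
    DF (suc H) ((s , node x cs) ∷ F) i = P s (λ j → M ^ H * Φ j + DF H cs j) i + DF (suc H) F i

    DF-cons : ∀ H s x cs F i → DF (suc H) ((s , node x cs) ∷ F) i ≡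
              M ^ H * P s Φ i + P s (DF H cs) i + DF (suc H) F i
    DF-cons H s x cs F i = cong (_+ DF (suc H) F i)
      (trans (P-+ s (λ j → M ^ H * Φ j) (DF H cs) i) (cong (_+ P s (DF H cs) i) (P-* s (M ^ H) Φ i)))

    -- Column sums of M make a uniform start stationary, so each vertex of the forest contributes
    -- the average of Φ. Vertices deeper than `H` are not counted, hence an inequality.
    DF-sum : ∀ H F → sum (DF H F) ≤ M ^ H * (size F * S)
    DF-sum zero F = ≤-trans (≤-reflexive (trans (sum-const m 0) (*-zeroʳ m))) z≤n
    DF-sum (suc H) [] = ≤-trans (≤-reflexive (trans (sum-const m 0) (*-zeroʳ m))) z≤n
    DF-sum (suc H) ((s , node x cs) ∷ F) = begin
      sum (λ i → P s (λ j → M ^ H * Φ j + DF H cs j) i + DF (suc H) F i)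
        ≡⟨ sum-+ (P s (λ j → M ^ H * Φ j + DF H cs j)) (DF (suc H) F) ⟩
      sum (P s (λ j → M ^ H * Φ j + DF H cs j)) + sum (DF (suc H) F)
        ≡⟨ cong (_+ sum (DF (suc H) F)) (trans (P-sum s _) (cong (M *_)
             (trans (sum-+ (λ j → M ^ H * Φ j) (DF H cs)) (cong (_+ sum (DF H cs)) (sum-*ˡ (M ^ H) Φ))))) ⟩
      M * (M ^ H * S + sum (DF H cs)) + sum (DF (suc H) F)
        ≤⟨ +-mono-≤ (*-monoʳ-≤ M (+-monoʳ-≤ (M ^ H * S) (DF-sum H cs))) (DF-sum (suc H) F) ⟩
      M * (M ^ H * S + M ^ H * (size cs * S)) + M * M ^ H * (size F * S)
        ≡⟨ e M (M ^ H) S (size cs) (size F) ⟩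
      M * M ^ H * (suc (size cs + size F) * S) ∎
      where
      open ≤-Reasoning
      e : ∀ M x S a b → M * (x * S + x * (a * S)) + M * x * (b * S) ≡ M * x * (suc (a + b) * S)
      e = solve-∀

    DF-max : ∀ H F i → DF H F i ≤ M ^ H * (size F * Ψ)
    DF-max zero F i = z≤n
    DF-max (suc H) [] i = z≤n
    DF-max (suc H) ((s , node x cs) ∷ F) i = begin
      P s (λ j → M ^ H * Φ j + DF H cs j) i + DF (suc H) F i
        ≤⟨ +-mono-≤ (P-≤ s _ (M ^ H * Ψ + M ^ H * (size cs * Ψ)) i
             (λ j → +-mono-≤ (*-monoʳ-≤ (M ^ H) (Φ≤Ψ j)) (DF-max H cs j))) (DF-max (suc H) F i) ⟩
      M * (M ^ H * Ψ + M ^ H * (size cs * Ψ)) + M * M ^ H * (size F * Ψ)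
        ≡⟨ e M (M ^ H) Ψ (size cs) (size F) ⟩
      M * M ^ H * (suc (size cs + size F) * Ψ) ∎
      where
      open ≤-Reasoning
      e : ∀ M x S a b → M * (x * S + x * (a * S)) + M * x * (b * S) ≡ M * x * (suc (a + b) * S)
      e = solve-∀

  module Mix (κ η : ℕ) (M²≤ : M * M ≤ suc κ * (m * η))
    (two-step : ∀ s s′ i w → η ≤ sum (λ j → ⟦ E s i j ⟧ * ⟦ E s′ j w ⟧)) where

    K : ℕ
    K = suc κ

    -- Doeblin's condition: any two positions are joined by at least η two-step paths of weight at
    -- least 1, so by `M²≤` every two-step transition has probability at least 1 / (K m).
    PP-lower : ∀ s s′ ψ i → η * sum ψ ≤ P s (P s′ ψ) i
    PP-lower s s′ ψ i = begin
      η * sum ψ ≡⟨ sym (sum-*ˡ η ψ) ⟩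
      sum (λ w → η * ψ w) ≤⟨ sum-mono (λ w → *-monoˡ-≤ (ψ w) (two-step s s′ i w)) ⟩
      sum (λ w → sum (λ j → ⟦ E s i j ⟧ * ⟦ E s′ j w ⟧) * ψ w)
        ≡⟨ sum-cong (λ w → trans (sym (sum-*ʳ (ψ w) (λ j → ⟦ E s i j ⟧ * ⟦ E s′ j w ⟧)))
             (sum-cong (λ j → *-assoc ⟦ E s i j ⟧ ⟦ E s′ j w ⟧ (ψ w)))) ⟩
      sum (λ w → sum (λ j → ⟦ E s i j ⟧ * (⟦ E s′ j w ⟧ * ψ w)))
        ≡⟨ sum-comm (λ w j → ⟦ E s i j ⟧ * (⟦ E s′ j w ⟧ * ψ w)) ⟩
      sum (λ j → sum (λ w → ⟦ E s i j ⟧ * (⟦ E s′ j w ⟧ * ψ w)))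
        ≡⟨ sum-cong (λ j → sum-*ˡ ⟦ E s i j ⟧ (λ w → ⟦ E s′ j w ⟧ * ψ w)) ⟩
      sum (λ j → ⟦ E s i j ⟧ * sum (λ w → ⟦ E s′ j w ⟧ * ψ w))
        ≤⟨ sum-mono (λ j → *-monoʳ-≤ ⟦ E s i j ⟧ (P-cov s′ j ψ)) ⟩
      sum (λ j → ⟦ E s i j ⟧ * P s′ ψ j) ≤⟨ P-cov s i (P s′ ψ) ⟩
      P s (P s′ ψ) i ∎
      where open ≤-Reasoning

    -- Two steps of the walk contract: the lower bound PP-lower is applied to U ∸ φ.
    PP-contract : ∀ s s′ φ U i → (∀ j → φ j ≤ U) → K * (m * P s (P s′ φ) i) ≤ M * M * (κ * (m * U) + sum φ)
    PP-contract s s′ φ U i φ≤U = +-cancelʳ-≤ (K * (m * b)) _ _ (begin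
      K * (m * a) + K * (m * b) ≡⟨ e₁ K m a b ⟩
      K * (m * (a + b))         ≡⟨ cong (λ x → K * (m * x)) total ⟩
      K * (m * (M * (M * U)))   ≡⟨ e₂ κ m M U ⟩
      M * M * (κ * (m * U) + m * U) ≡⟨ cong (λ x → M * M * (κ * (m * U) + x)) (sym tσ) ⟩
      M * M * (κ * (m * U) + (sum φ + t)) ≡⟨ e₃ (M * M) (κ * (m * U)) (sum φ) t ⟩
      M * M * (κ * (m * U) + sum φ) + M * M * t
        ≤⟨ +-monoʳ-≤ _ (*-monoˡ-≤ t M²≤) ⟩
      M * M * (κ * (m * U) + sum φ) + K * (m * η) * t
        ≡⟨ cong (M * M * (κ * (m * U) + sum φ) +_) (e₄ K m η t) ⟩
      M * M * (κ * (m * U) + sum φ) + K * (m * (η * t))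
        ≤⟨ +-monoʳ-≤ (M * M * (κ * (m * U) + sum φ)) (*-monoʳ-≤ (suc κ) (*-monoʳ-≤ m (PP-lower s s′ ψ i))) ⟩
      M * M * (κ * (m * U) + sum φ) + K * (m * b) ∎)
      where
      open ≤-Reasoning
      ψ : Fin m → ℕ
      ψ j = U ∸ φ j
      a = P s (P s′ φ) i
      b = P s (P s′ ψ) i
      t = sum ψ
      φ+ψ : ∀ j → φ j + ψ j ≡ U
      φ+ψ j = m+[n∸m]≡n (φ≤U j)
      total : a + b ≡ M * (M * U)
      total = trans (sym (P-+ s (P s′ φ) (P s′ ψ) i)) (trans
        (sum-cong (λ j → cong (W s i j *_) (trans (sym (P-+ s′ φ ψ j))
          (trans (sum-cong (λ k → cong (W s′ j k *_) (φ+ψ k))) (P-const s′ U j)))))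
        (P-const s (M * U) i))
      tσ : sum φ + t ≡ m * U
      tσ = trans (sym (sum-+ φ ψ)) (trans (sum-cong φ+ψ) (sum-const m U))
      e₁ : ∀ K m a b → K * (m * a) + K * (m * b) ≡ K * (m * (a + b))
      e₁ = solve-∀
      e₂ : ∀ κ m M U → suc κ * (m * (M * (M * U))) ≡ M * M * (κ * (m * U) + m * U)
      e₂ = solve-∀
      e₃ : ∀ N x y z → N * (x + (y + z)) ≡ N * (x + y) + N * z
      e₃ = solve-∀
      e₄ : ∀ K m η t → K * (m * η) * t ≡ K * (m * (η * t))
      e₄ = solve-∀

    module _ {A : Set} where

      bound : ℕ → ℕ → ℕ → ℕ → ℕ → ℕ
      bound MH h lv k z = MH * (K ^ h * (z * S) + K ^ h * (m * Ψ * lv) + m * Ψ * (k * z))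

      -- After division by `M ^ H`, `K ^ h` and m: the expected sum of Φ is at most S / m per
      -- vertex, plus Ψ for each vertex of the first 2h levels, plus Ψ (κ / K) ^ h per vertex for
      -- imperfect mixing.
      Claim : ℕ → Set
      Claim h = ∀ H (F : Forest A) i →
        K ^ h * (m * DF H F i) ≤ bound (M ^ H) h (levels (double h) F) (κ ^ h) (size F)

      claim-zero : Claim 0
      claim-zero H F i = begin
        1 * (m * DF H F i)             ≤⟨ *-monoʳ-≤ 1 (*-monoʳ-≤ m (DF-max H F i)) ⟩
        1 * (m * (M ^ H * (size F * Ψ))) ≤⟨ ≤-by (M ^ H * (1 * (size F * S) + 1 * (m * Ψ * 0))) (e m (M ^ H) (size F) Ψ S) ⟩
        bound (M ^ H) 0 0 1 (size F)   ∎
        where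
        open ≤-Reasoning
        e : ∀ m x z Ψ S → x * (1 * (z * S) + 1 * (m * Ψ * 0) + m * Ψ * (1 * z)) ≡
            1 * (m * (x * (z * Ψ))) + x * (1 * (z * S) + 1 * (m * Ψ * 0))
        e = solve-∀

      bound-zero : ∀ h lv k z MH x → x ≡ 0 → K ^ h * (m * x) ≤ bound MH h lv k z
      bound-zero h lv k z MH x refl = ≤-trans (≤-reflexive (trans (cong (K ^ h *_) (*-zeroʳ m)) (*-zeroʳ (K ^ h)))) z≤n

      bound-cons : ∀ h k lv lv′ z z′ MH x a b → x ≤ MH * Ψ →
        K ^ h * (m * a) ≤ bound MH h lv k z → K ^ h * (m * b) ≤ bound MH h lv′ k z′ →
        K ^ h * (m * (x + a + b)) ≤ bound MH h (suc (lv + lv′)) k (suc (z + z′))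
      bound-cons h k lv lv′ z z′ MH x a b hx ha hb = begin
        K ^ h * (m * (x + a + b)) ≡⟨ e₁ (K ^ h) m x a b ⟩
        K ^ h * (m * x) + (K ^ h * (m * a) + K ^ h * (m * b))
          ≤⟨ +-mono-≤ (*-monoʳ-≤ (K ^ h) (*-monoʳ-≤ m hx)) (+-mono-≤ ha hb) ⟩
        K ^ h * (m * (MH * Ψ)) + (bound MH h lv k z + bound MH h lv′ k z′)
          ≤⟨ ≤-by (MH * (K ^ h * S + m * Ψ * k)) (e₂ (K ^ h) m Ψ S MH lv lv′ k z z′) ⟩
        bound MH h (suc (lv + lv′)) k (suc (z + z′)) ∎
        where
        open ≤-Reasoning
        e₁ : ∀ K m x a b → K * (m * (x + a + b)) ≡ K * (m * x) + (K * (m * a) + K * (m * b))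
        e₁ = solve-∀
        e₂ : ∀ K m Ψ S MH lv lv′ k z z′ →
          MH * (K * (suc (z + z′) * S) + K * (m * Ψ * suc (lv + lv′)) + m * Ψ * (k * suc (z + z′))) ≡
          K * (m * (MH * Ψ)) + (MH * (K * (z * S) + K * (m * Ψ * lv) + m * Ψ * (k * z)) +
            MH * (K * (z′ * S) + K * (m * Ψ * lv′) + m * Ψ * (k * z′))) + MH * (K * S + m * Ψ * k)
        e₂ = solve-∀

      -- `Claim h` bounds the function pointwise and `DF-sum` bounds its average. `PP-contract`
      -- combines the two bounds in the ratio κ to 1: the uniform parts add up to K ^ (h + 1), and
      -- the error receives one more factor κ.
      contract : ∀ h → Claim h → ∀ H (F : Forest A) s s′ i →
        K ^ suc h * (m * P s (P s′ (DF H F)) i) ≤ bound (M * (M * M ^ H)) (suc h) (levels (double h) F) (κ ^ suc h) (size F)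
      contract h claim H F s s′ i = *-cancelˡ-≤ m {{>-nonZero 0<m}} (begin
        m * (K * Kh * (m * x)) ≡⟨ e₁ m K Kh x ⟩
        K * (m * (Kh * m * x)) ≡⟨ cong (λ y → K * (m * y)) PPc ⟩
        K * (m * P s (P s′ φ) i) ≤⟨ PP-contract s s′ φ U i φ≤U ⟩
        M * M * (κ * (m * U) + sum φ) ≤⟨ *-monoʳ-≤ (M * M) (+-monoʳ-≤ (κ * (m * U)) sumφ) ⟩
        M * M * (κ * (m * U) + Kh * m * (MH * (z * S)))
          ≤⟨ ≤-by (m * (M * (M * MH)) * (Kh * (m * Ψ * lv))) (e₂ m M κ Kh (κ ^ h) MH z S Ψ lv) ⟩
        m * bound (M * (M * MH)) (suc h) lv (κ ^ suc h) z ∎)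
        where
        open ≤-Reasoning
        Kh = K ^ h
        MH = M ^ H
        z = size F
        lv = levels (double h) F
        x = P s (P s′ (DF H F)) i
        U = bound MH h lv (κ ^ h) z
        φ : Fin m → ℕ
        φ j = Kh * m * DF H F j
        φ≤U : ∀ j → φ j ≤ U
        φ≤U j = ≤-trans (≤-reflexive (*-assoc Kh m _)) (claim H F j)
        PPc : Kh * m * x ≡ P s (P s′ φ) i
        PPc = sym (trans (sum-cong (λ j → cong (W s i j *_) (P-* s′ (Kh * m) (DF H F) j))) (P-* s (Kh * m) (P s′ (DF H F)) i))
        sumφ : sum φ ≤ Kh * m * (MH * (z * S))
        sumφ = ≤-trans (≤-reflexive (sum-*ˡ (Kh * m) (DF H F))) (*-monoʳ-≤ (Kh * m) (DF-sum H F))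
        e₁ : ∀ m K Kh x → m * (K * Kh * (m * x)) ≡ K * (m * (Kh * m * x))
        e₁ = solve-∀
        e₂ : ∀ m M κ Kh κh MH z S Ψ lv →
          m * (M * (M * MH) * (suc κ * Kh * (z * S) + suc κ * Kh * (m * Ψ * lv) + m * Ψ * (κ * κh * z))) ≡
          M * M * (κ * (m * (MH * (Kh * (z * S) + Kh * (m * Ψ * lv) + m * Ψ * (κh * z)))) + Kh * m * (MH * (z * S)))
          + m * (M * (M * MH)) * (Kh * (m * Ψ * lv))
        e₂ = solve-∀

      module _ (h : ℕ) (claim : Claim h) where

        -- The roots of `F` are counted among the top levels; the forests below them are two steps
        -- away from `i`, where `contract` applies.
        inner : ∀ H (F : Forest A) s i →
          K ^ suc h * (m * P s (DF H F) i) ≤ bound (M * M ^ H) (suc h) (levels (suc (double h)) F) (κ ^ suc h) (size F)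
        inner zero F s i = bound-zero (suc h) (levels (suc (double h)) F) (κ ^ suc h) (size F) (M * 1) _ (trans (P-const s 0 i) (*-zeroʳ M))
        inner (suc H) [] s i = bound-zero (suc h) 0 (κ ^ suc h) 0 (M * M ^ suc H) _ (trans (P-const s 0 i) (*-zeroʳ M))
        inner (suc H) ((s′ , node x cs) ∷ F) s i = begin
          K ^ suc h * (m * P s (DF (suc H) ((s′ , node x cs) ∷ F)) i) ≡⟨ cong (λ y → K ^ suc h * (m * y)) split ⟩
          K ^ suc h * (m * (v + P s (P s′ (DF H cs)) i + P s (DF (suc H) F) i))
            ≤⟨ bound-cons (suc h) (κ ^ suc h) (levels (double h) cs) (levels (suc (double h)) F) (size cs) (size F)
                 (M * (M * M ^ H)) v _ _ v≤ (contract h claim H cs s s′ i) (inner (suc H) F s i) ⟩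
          bound (M * (M * M ^ H)) (suc h) (levels (suc (double h)) ((s′ , node x cs) ∷ F)) (κ ^ suc h)
            (size ((s′ , node x cs) ∷ F)) ∎
          where
          open ≤-Reasoning
          v = P s (λ j → M ^ H * P s′ Φ j) i
          split : P s (DF (suc H) ((s′ , node x cs) ∷ F)) i ≡ v + P s (P s′ (DF H cs)) i + P s (DF (suc H) F) i
          split = trans (sum-cong (λ j → cong (W s i j *_) (DF-cons H s′ x cs F j)))
            (trans (P-+ s (λ j → M ^ H * P s′ Φ j + P s′ (DF H cs) j) (DF (suc H) F) i)
              (cong (_+ P s (DF (suc H) F) i) (P-+ s (λ j → M ^ H * P s′ Φ j) (P s′ (DF H cs)) i)))
          v≤ : v ≤ M * (M * M ^ H) * Ψ
          v≤ = ≤-trans (P-≤ s _ (M ^ H * (M * Ψ)) i (λ j → *-monoʳ-≤ (M ^ H) (P-≤ s′ Φ Ψ j Φ≤Ψ)))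
                       (≤-reflexive (e M (M ^ H) Ψ))
            where e : ∀ M x Ψ → M * (x * (M * Ψ)) ≡ M * (M * x) * Ψ
                  e = solve-∀

        claim-suc : Claim (suc h)
        claim-suc zero F i = bound-zero (suc h) (levels (double (suc h)) F) (κ ^ suc h) (size F) 1 _ refl
        claim-suc (suc H) [] i = bound-zero (suc h) 0 (κ ^ suc h) 0 (M ^ suc H) _ refl
        claim-suc (suc H) ((s , node x cs) ∷ F) i = begin
          K ^ suc h * (m * DF (suc H) ((s , node x cs) ∷ F) i)
            ≡⟨ cong (λ y → K ^ suc h * (m * y)) (DF-cons H s x cs F i) ⟩
          K ^ suc h * (m * (M ^ H * P s Φ i + P s (DF H cs) i + DF (suc H) F i))
            ≤⟨ bound-cons (suc h) (κ ^ suc h) (levels (suc (double h)) cs) (levels (double (suc h)) F) (size cs) (size F)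
                 (M * M ^ H) (M ^ H * P s Φ i) _ _ v≤ (inner H cs s i) (claim-suc (suc H) F i) ⟩
          bound (M * M ^ H) (suc h) (levels (double (suc h)) ((s , node x cs) ∷ F)) (κ ^ suc h)
            (size ((s , node x cs) ∷ F)) ∎
          where
          open ≤-Reasoning
          v≤ : M ^ H * P s Φ i ≤ M * M ^ H * Ψ
          v≤ = ≤-trans (*-monoʳ-≤ (M ^ H) (P-≤ s Φ Ψ i Φ≤Ψ)) (≤-reflexive (e M (M ^ H) Ψ))
            where e : ∀ M x Ψ → x * (M * Ψ) ≡ M * x * Ψ
                  e = solve-∀

      mixing : ∀ h → Claim h
      mixing zero    = claim-zero
      mixing (suc h) = claim-suc h (mixing h)

  module Greedy (R bad : ℕ) (M≡ : M ≡ R + bad) (0<R : 0 < R) where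

    -- The forbidden positions carry weight at most `C` each, so weight at least `R` is left, and
    -- some remaining position costs no more than the total divided by `R`.
    choose : ∀ s i Fb (d : Fin m → ℕ) → C * length Fb ≤ bad →
      ∃ λ j → j ∉ Fb × E s i j ≡ true × R * d j ≤ P s d i
    choose s i Fb d small with sum-<⇒∃ {f = f} {g} lt
      where
      w : Fin m → ℕ
      w j = ⟦ not (mem j Fb) ⟧ * W s i j
      f g : Fin m → ℕ
      f j = w j * (R * d j)
      -- The successor makes the inequality of sums strict; a strict term has `w j` positive, and
      -- this shows `j` to be allowed and joined to `i`.
      g j = w j * suc (P s d i)
      inside : ∀ Fb → sum (λ j → ⟦ mem j Fb ⟧ * W s i j) ≤ C * length Fb
      inside [] = ≤-trans (≤-reflexive (trans (sum-const m 0) (*-zeroʳ m))) z≤n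
      inside (v ∷ Fb) = begin
        sum (λ j → ⟦ (v == j) ∨ mem j Fb ⟧ * W s i j)
          ≤⟨ sum-mono (λ j → ≤-trans (*-monoˡ-≤ (W s i j) (⟦∨⟧ (v == j) (mem j Fb))) (≤-reflexive (*-distribʳ-+ (W s i j) ⟦ v == j ⟧ ⟦ mem j Fb ⟧))) ⟩
        sum (λ j → ⟦ v == j ⟧ * W s i j + ⟦ mem j Fb ⟧ * W s i j)
          ≡⟨ sum-+ (λ j → ⟦ v == j ⟧ * W s i j) _ ⟩
        sum (λ j → ⟦ v == j ⟧ * W s i j) + sum (λ j → ⟦ mem j Fb ⟧ * W s i j)
          ≤⟨ +-mono-≤ (≤-trans (≤-reflexive (sum-δ v (W s i))) (cap s i v)) (inside Fb) ⟩
        C + C * length Fb ≡⟨ sym (*-suc C _) ⟩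
        C * suc (length Fb) ∎
        where open ≤-Reasoning
      R≤ : R ≤ sum w
      R≤ = +-cancelʳ-≤ bad R (sum w) (begin
        R + bad ≡⟨ trans (sym M≡) (sym (row s i)) ⟩
        sum (W s i) ≡⟨ trans (sum-cong (λ j → ⟦⟧-split (mem j Fb) (W s i j))) (sum-+ (λ j → ⟦ mem j Fb ⟧ * W s i j) w) ⟩
        sum (λ j → ⟦ mem j Fb ⟧ * W s i j) + sum w ≤⟨ +-monoˡ-≤ (sum w) (≤-trans (inside Fb) small) ⟩
        bad + sum w ≡⟨ +-comm bad _ ⟩
        sum w + bad ∎)
        where open ≤-Reasoning
      lt : sum f < sum g
      lt = begin-strict
        sum f ≡⟨ trans (sum-cong (λ j → e (w j) R (d j))) (sum-*ˡ R (λ j → w j * d j)) ⟩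
        R * sum (λ j → w j * d j) ≤⟨ *-monoʳ-≤ R (sum-mono (λ j → *-monoˡ-≤ (d j) (w≤ j))) ⟩
        R * P s d i <⟨ *-monoʳ-< R {{>-nonZero 0<R}} (n<1+n _) ⟩
        R * suc (P s d i) ≤⟨ *-monoˡ-≤ (suc (P s d i)) R≤ ⟩
        sum w * suc (P s d i) ≡⟨ sym (sum-*ʳ (suc (P s d i)) w) ⟩
        sum g ∎
        where
        open ≤-Reasoning
        e : ∀ w R d → w * (R * d) ≡ R * (w * d)
        e = solve-∀
        w≤ : ∀ j → w j ≤ W s i j
        w≤ j = ≤-trans (*-monoˡ-≤ (W s i j) (⟦⟧≤1 (not (mem j Fb)))) (≤-reflexive (*-identityˡ _))
    ... | j , lt = j , fin (mem j Fb) refl lt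
      where
      fin : ∀ b → mem j Fb ≡ b → ⟦ not b ⟧ * W s i j * (R * d j) < ⟦ not b ⟧ * W s i j * suc (P s d i) →
            j ∉ Fb × E s i j ≡ true × R * d j ≤ P s d i
      fin false e lt = mem-∉ Fb e , sup s i j (pos (W s i j) lt) , ≤-pred (*-cancelˡ-< (1 * W s i j) _ _ lt)
        where
        pos : ∀ w {a b} → 1 * w * a < 1 * w * b → 0 < w
        pos (suc w) _ = s≤s z≤n

    Fresh : List (Fin m) → List (Fin m) → Set
    Fresh js Fb = Unique js × All (_∉ Fb) js

    Fresh-cons : ∀ {j js ks Fb} → j ∉ Fb → Fresh js (j ∷ Fb) → Fresh ks (js ++ j ∷ Fb) → Fresh (j ∷ js ++ ks) Fb
    Fresh-cons {j} {js} {ks} {Fb} j∉ (uj , aj) (uk , ak) =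
      (All.tabulate ne ∷ Unique.++⁺ uj uk (λ { (p , q) → All.lookup ak q (∈-++⁺ˡ p) })) ,
      (j∉ ∷ All.++⁺ (All.map (λ h → h ∘ there) aj) (All.map (λ h → h ∘ ∈-++⁺ʳ js ∘ there) ak))
      where
      ne : ∀ {x} → x ∈ js ++ ks → j ≢ x
      ne p e with ∈-++⁻ js p
      ... | inj₁ q = All.lookup aj q (here (sym e))
      ... | inj₂ q = All.lookup ak q (∈-++⁺ʳ js (here (sym e)))

    -- Conditional expectations: each step down the tree loses at most a factor M / R, so `R ^ H`
    -- stands where `DF` has `M ^ H`. Placed vertices join the forbidden list, whose length never
    -- exceeds `length Fb + size F`.
    greedy : ∀ {A : Set} H (F : Forest A) i Fb → size F ≤ H → C * (length Fb + size F) ≤ bad →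
      ∃ λ js → Emb E i F js × Fresh js Fb × R ^ H * ΣL Φ js ≤ DF H F i
    greedy H [] i Fb le small = [] , [] , ([] , []) , ≤-trans (≤-reflexive (*-zeroʳ (R ^ H))) z≤n
    greedy (suc H) ((s , node x cs) ∷ F) i Fb (s≤s le) small =
      let j , j∉ , Eij , hj = choose s i Fb (λ j → M ^ H * Φ j + DF H cs j)
                                (≤-trans (*-monoʳ-≤ C (m≤m+n (length Fb) _)) small)
          js , d₁ , fr₁ , c₁ = greedy H cs j (j ∷ Fb) (≤-trans (m≤m+n _ _) le)
            (≤-trans (*-monoʳ-≤ C (≤-by (size F) (e₁ (length Fb) (size cs) (size F)))) small)
          ks , d₂ , fr₂ , c₂ = greedy (suc H) F i (js ++ j ∷ Fb) (≤-trans (m≤n+m _ (size cs)) (m≤n⇒m≤1+n le))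
            (≤-trans (*-monoʳ-≤ C (≤-reflexive (trans (cong (_+ size F)
              (trans (List.length-++ js) (cong (_+ suc (length Fb)) (Emb-length d₁)))) (e₂ (length Fb) (size cs) (size F))))) small)
      in j ∷ js ++ ks , cons Eij d₁ d₂ , Fresh-cons j∉ fr₁ fr₂ ,
         cost (Φ j) js ks (DF H cs j) (P s (λ j → M ^ H * Φ j + DF H cs j) i) (DF (suc H) F i) c₁ hj c₂
      where
      e₁ : ∀ a b c → a + suc (b + c) ≡ suc a + b + c
      e₁ = solve-∀
      e₂ : ∀ a b c → b + suc a + c ≡ a + suc (b + c)
      e₂ = solve-∀
      R≤M : R ^ H ≤ M ^ H
      R≤M = ^-monoˡ-≤ H (≤-trans (m≤m+n R bad) (≤-reflexive (sym M≡)))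
      cost : ∀ φ js ks D p q → R ^ H * ΣL Φ js ≤ D → R * (M ^ H * φ + D) ≤ p → R * R ^ H * ΣL Φ ks ≤ q →
             R * R ^ H * (φ + ΣL Φ (js ++ ks)) ≤ p + q
      cost φ js ks D p q h₁ h₂ h₃ = begin
        R * R ^ H * (φ + ΣL Φ (js ++ ks)) ≡⟨ cong (λ y → R * R ^ H * (φ + y)) (ΣL-++ Φ js ks) ⟩
        R * R ^ H * (φ + (ΣL Φ js + ΣL Φ ks)) ≡⟨ e R (R ^ H) φ (ΣL Φ js) (ΣL Φ ks) ⟩
        R * (R ^ H * φ + R ^ H * ΣL Φ js) + R * R ^ H * ΣL Φ ks
          ≤⟨ +-mono-≤ (≤-trans (*-monoʳ-≤ R (+-mono-≤ (*-monoˡ-≤ φ R≤M) h₁)) h₂) h₃ ⟩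
        p + q ∎
        where
        open ≤-Reasoning
        e : ∀ R x φ a b → R * x * (φ + (a + b)) ≡ R * (x * φ + x * a) + R * x * b
        e = solve-∀

    ΣL-Φ≤ : ∀ js → ΣL Φ js ≤ length js * Ψ
    ΣL-Φ≤ js = ≤-trans (ΣL-mono Φ≤Ψ js) (≤-reflexive (ΣL-const Ψ js))

    module _ (κ η : ℕ) (M²≤ : M * M ≤ suc κ * (m * η))
      (two-step : ∀ s s′ i w → η ≤ sum (λ j → ⟦ E s i j ⟧ * ⟦ E s′ j w ⟧)) where

      open Mix κ η M²≤ two-step

      -- Divided by Q m, the cost exceeds the uniform one by at most Ψ / Q per vertex. The
      -- hypotheses bound four errors by an eighth of that each: the prescribed root, the imperfect
      -- mixing, the top levels, and the avoidance of forbidden positions.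
      embed-piece : ∀ {A : Set} (F : Forest A) i h Q → 8 * Q ≤ suc (size F) →
        8 * Q * κ ^ h ≤ suc κ ^ h → 8 * Q * levels (double h) F ≤ suc (size F) →
        8 * Q * (size F * bad) ≤ M → C * suc (size F) ≤ bad →
        ∃ λ js → Emb E i F js × Fresh js (i ∷ []) ×
          Q * m * (Φ i + ΣL Φ js) ≤ Q * suc (size F) * S + suc (size F) * m * Ψ
      embed-piece F i h Q Q≤ κ≤ lv≤ bad≤ fb≤ =
        let js , d , fr , c = greedy (size F) F i (i ∷ []) ≤-refl fb≤
        in js , d , fr , final (ΣL Φ js) c (≤-trans (ΣL-Φ≤ js) (≤-reflexive (cong (_* Ψ) (Emb-length d))))
        where
        z = size F
        H = size F
        lv = levels (double h) F
        Kh = K ^ h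
        MH = M ^ H
        0<M : 0 < M
        0<M = ≤-trans 0<R (≤-trans (m≤m+n R bad) (≤-reflexive (sym M≡)))
        final : ∀ c → R ^ H * c ≤ DF H F i → c ≤ z * Ψ → Q * m * (Φ i + c) ≤ Q * suc z * S + suc z * m * Ψ
        final c hc c≤ = *-cancelˡ-≤ 8 (begin
          8 * (Q * m * (Φ i + c)) ≡⟨ e₁ Q m (Φ i) c ⟩
          8 * Q * (m * Φ i) + 8 * Q * (m * c)
            ≤⟨ +-mono-≤ (*-mono-≤ Q≤ (*-monoʳ-≤ m (Φ≤Ψ i))) step₂ ⟩
          suc z * (m * Ψ) + (8 * Q * (z * S) + m * Ψ * suc z + m * Ψ * z + m * (z * Ψ))
            ≤⟨ ≤-by (8 * Q * S + 4 * (suc z * m * Ψ) + 2 * (m * Ψ)) (e₂ Q m Ψ S z) ⟩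
          8 * (Q * suc z * S + suc z * m * Ψ) ∎)
          where
          open ≤-Reasoning
          e₁ : ∀ Q m φ c → 8 * (Q * m * (φ + c)) ≡ 8 * Q * (m * φ) + 8 * Q * (m * c)
          e₁ = solve-∀
          e₂ : ∀ Q m Ψ S z → 8 * (Q * suc z * S + suc z * m * Ψ) ≡
            suc z * (m * Ψ) + (8 * Q * (z * S) + m * Ψ * suc z + m * Ψ * z + m * (z * Ψ))
            + (8 * Q * S + 4 * (suc z * m * Ψ) + 2 * (m * Ψ))
          e₂ = solve-∀
          -- `bernoulli` replaces `R ^ H` by `M ^ H`; the lost share H bad / M of the cost is at
          -- most 1 / (8Q) and is kept as the last term.
          step₁ : 8 * Q * (Kh * (m * c)) ≤ 8 * Q * (Kh * (z * S) + Kh * (m * Ψ * lv) + m * Ψ * (κ ^ h * z)) + Kh * (m * c)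
          step₁ = *-cancelˡ-≤ (MH * M) {{m*n≢0 MH M {{m^n≢0 M H {{>-nonZero 0<M}}}} {{>-nonZero 0<M}}}} (begin
            MH * M * (8 * Q * (Kh * (m * c))) ≡⟨ f₁ MH M Q Kh m c ⟩
            8 * Q * (Kh * m) * (c * (MH * M))
              ≤⟨ *-monoʳ-≤ (8 * Q * (Kh * m)) (*-monoʳ-≤ c (subst (λ M → M ^ H * M ≤ R ^ H * M + M ^ H * (H * bad)) (sym M≡) (bernoulli R bad H))) ⟩
            8 * Q * (Kh * m) * (c * (R ^ H * M + MH * (H * bad))) ≡⟨ f₂ Q (Kh * m) c (R ^ H) M MH (H * bad) ⟩
            8 * Q * (Kh * m) * M * (R ^ H * c) + Kh * m * c * MH * (8 * Q * (H * bad))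
              ≤⟨ +-mono-≤ (*-monoʳ-≤ (8 * Q * (Kh * m) * M) hc) (*-monoʳ-≤ (Kh * m * c * MH) bad≤) ⟩
            8 * Q * (Kh * m) * M * DF H F i + Kh * m * c * MH * M ≡⟨ f₃ Q Kh m M (DF H F i) c MH ⟩
            8 * Q * M * (Kh * (m * DF H F i)) + MH * M * (Kh * (m * c))
              ≤⟨ +-monoˡ-≤ _ (*-monoʳ-≤ (8 * Q * M) (mixing h H F i)) ⟩
            8 * Q * M * (MH * (Kh * (z * S) + Kh * (m * Ψ * lv) + m * Ψ * (κ ^ h * z))) + MH * M * (Kh * (m * c))
              ≡⟨ f₄ Q M MH (Kh * (z * S) + Kh * (m * Ψ * lv) + m * Ψ * (κ ^ h * z)) (Kh * (m * c)) ⟩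
            MH * M * (8 * Q * (Kh * (z * S) + Kh * (m * Ψ * lv) + m * Ψ * (κ ^ h * z)) + Kh * (m * c)) ∎)
            where
            f₁ : ∀ MH M Q Kh m c → MH * M * (8 * Q * (Kh * (m * c))) ≡ 8 * Q * (Kh * m) * (c * (MH * M))
            f₁ = solve-∀
            f₂ : ∀ Q k c r M MH b → 8 * Q * k * (c * (r * M + MH * b)) ≡ 8 * Q * k * M * (r * c) + k * c * MH * (8 * Q * b)
            f₂ = solve-∀
            f₃ : ∀ Q Kh m M D c MH → 8 * Q * (Kh * m) * M * D + Kh * m * c * MH * M ≡
                 8 * Q * M * (Kh * (m * D)) + MH * M * (Kh * (m * c))
            f₃ = solve-∀
            f₄ : ∀ Q M MH x y → 8 * Q * M * (MH * x) + MH * M * y ≡ MH * M * (8 * Q * x + y)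
            f₄ = solve-∀
          step₂ : 8 * Q * (m * c) ≤ 8 * Q * (z * S) + m * Ψ * suc z + m * Ψ * z + m * (z * Ψ)
          step₂ = *-cancelˡ-≤ Kh {{m^n≢0 K h}} (begin
            Kh * (8 * Q * (m * c)) ≡⟨ f₁ Kh Q (m * c) ⟩
            8 * Q * (Kh * (m * c)) ≤⟨ step₁ ⟩
            8 * Q * (Kh * (z * S) + Kh * (m * Ψ * lv) + m * Ψ * (κ ^ h * z)) + Kh * (m * c)
              ≡⟨ f₂ Q Kh (z * S) (m * Ψ) lv (κ ^ h) z (m * c) ⟩
            8 * Q * (Kh * (z * S)) + Kh * (m * Ψ) * (8 * Q * lv) + m * Ψ * z * (8 * Q * κ ^ h) + Kh * (m * c)
              ≤⟨ +-mono-≤ (+-mono-≤ (+-monoʳ-≤ (8 * Q * (Kh * (z * S))) (*-monoʳ-≤ (Kh * (m * Ψ)) lv≤)) (*-monoʳ-≤ (m * Ψ * z) κ≤))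
                   (*-monoʳ-≤ Kh (*-monoʳ-≤ m c≤)) ⟩
            8 * Q * (Kh * (z * S)) + Kh * (m * Ψ) * suc z + m * Ψ * z * Kh + Kh * (m * (z * Ψ))
              ≡⟨ f₃ Q Kh (z * S) (m * Ψ) z (m * (z * Ψ)) ⟩
            Kh * (8 * Q * (z * S) + m * Ψ * suc z + m * Ψ * z + m * (z * Ψ)) ∎)
            where
            f₁ : ∀ k Q x → k * (8 * Q * x) ≡ 8 * Q * (k * x)
            f₁ = solve-∀
            f₂ : ∀ Q k a p lv κh z c → 8 * Q * (k * a + k * (p * lv) + p * (κh * z)) + k * c ≡
                 8 * Q * (k * a) + k * p * (8 * Q * lv) + p * z * (8 * Q * κh) + k * c
            f₂ = solve-∀
            f₃ : ∀ Q k a p z c → 8 * Q * (k * a) + k * p * suc z + p * z * k + k * c ≡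
                 k * (8 * Q * a + p * suc z + p * z + c)
            f₃ = solve-∀

-- Walks in the pool of free vertices

module Graph {n : ℕ} (G : Digraph n) where

  V : Set
  V = Fin n

  -- arcs leaving u (true) or entering u (false)
  Eg : Bool → V → V → Bool
  Eg true  u v = adj G u v
  Eg false u v = adj G v u

  Eg-flip : ∀ s u v → Eg (not s) u v ≡ Eg s v u
  Eg-flip true  u v = refl
  Eg-flip false u v = refl

  Eg-loopless : ∀ s u → Eg s u u ≡ false
  Eg-loopless true  u = loopless G u
  Eg-loopless false u = loopless G u

  cnt : Bool → V → List V → ℕ
  cnt s w B = ΣL (λ v → ⟦ Eg s w v ⟧) B

  RichPool : ℕ → List V → Set
  RichPool q B = ∀ s w → (q + 2) * length B ≤ 2 * q * cnt s w B

  module Pool (B : List V) (q : ℕ) (0<q : 0 < q) (rich : RichPool q B) (large : 2 * q ≤ length B) where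

    m : ℕ
    m = length B

    0<m : 0 < m
    0<m = ≤-trans (*-mono-≤ (s≤s {0} {1} z≤n) 0<q) large

    E : Bool → Fin m → Fin m → Bool
    E s i j = Eg s (lookup B i) (lookup B j)

    row-sum : ∀ s i → sum (λ j → ⟦ E s i j ⟧) ≡ cnt s (lookup B i) B
    row-sum s i = ΣL-lookup (λ v → ⟦ Eg s (lookup B i) v ⟧) B

    col-sum : ∀ s j → sum (λ i → ⟦ E s i j ⟧) ≡ cnt (not s) (lookup B j) B
    col-sum s j = trans (sum-cong (λ i → cong ⟦_⟧ (sym (Eg-flip s (lookup B j) (lookup B i)))))
                        (ΣL-lookup (λ v → ⟦ Eg (not s) (lookup B j) v ⟧) B)

    E-dense : Dense q (E true)
    E-dense = record
      { row = λ i → ≤-trans (rich true (lookup B i)) (≤-reflexive (cong (2 * q *_) (sym (row-sum true i))))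
      ; col = λ j → ≤-trans (rich false (lookup B j)) (≤-reflexive (cong (2 * q *_) (sym (col-sum true j))))
      }

    b C K : ℕ
    -- Blocks of length m / (2q) are short enough to be protected. Rounding down at most halves this
    -- number, which is at least 1, so 4q blocks cover all rows. `K` compares M ^ 2 with m ^ 2 / q.
    b = 4 * q
    C = 4 * q * b + b
    K = b * b * q

    private
      instance
        2q-nonZero : NonZero (2 * q)
        2q-nonZero = >-nonZero (*-mono-≤ (s≤s {0} {1} z≤n) 0<q)

      s = m / (2 * q)

      s-small : 2 * q * s ≤ m
      s-small = ≤-trans (≤-reflexive (*-comm (2 * q) s)) (m/n*n≤m m (2 * q))

      m< : m < 2 * q + s * (2 * q)
      m< = subst (_< 2 * q + s * (2 * q)) (sym (m≡m%n+[m/n]*n m (2 * q))) (+-monoˡ-< (s * (2 * q)) (m%n<n m (2 * q)))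

      0<s : 0 < s
      0<s with s | m<
      ... | zero  | lt = ⊥-elim (<-irrefl refl (<-≤-trans lt (≤-trans (≤-reflexive (+-identityʳ _)) large)))
      ... | suc _ | _  = s≤s z≤n

      b-large : m ≤ b * s
      b-large = ≤-trans (<⇒≤ m<) (≤-trans (+-monoˡ-≤ (s * (2 * q)) (m≤m*n (2 * q) s {{>-nonZero 0<s}})) (≤-reflexive (e q s)))
        where e : ∀ q s → 2 * q * s + s * (2 * q) ≡ 4 * q * s
              e = solve-∀

    signed-kernel : SignedKernel E (m * b) C
    signed-kernel = record
      -- Walking against the arcs is the transposed matrix, which is doubly stochastic as well.
      { W   = λ { true → W ; false i j → W j i }
      ; row = λ { true → row ; false → col }
      ; col = λ { true → col ; false → row }
      ; sup = λ { true → sup ; false i j → sup j i }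
      ; cov = λ { true → cov ; false i j → cov j i }
      ; cap = λ { true → cap ; false i j → cap j i }
      }
      where open Kernel (kernel E-dense 0<m s b 0<q 0<s s-small b-large)

    -- Two vertices have at least 2m/q common neighbours, so m/q may be rounded upwards, as `M²≤`
    -- requires.
    η : ℕ
    η = suc (m / q) where instance _ = >-nonZero 0<q

    qη≤ : q * η ≤ 2 * m
    qη≤ = begin
      q * suc (m / q)       ≡⟨ *-suc q _ ⟩
      q + q * (m / q)       ≤⟨ +-mono-≤ (≤-trans (m≤n*m q 2) large) (≤-trans (≤-reflexive (*-comm q _)) (m/n*n≤m m q)) ⟩
      m + m                 ≡⟨ cong (m +_) (sym (+-identityʳ m)) ⟩
      2 * m                 ∎
      where open ≤-Reasoning
            instance _ = >-nonZero 0<q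

    m≤qη : m ≤ q * η
    m≤qη = begin
      m                      ≡⟨ m≡m%n+[m/n]*n m q ⟩
      m % q + m / q * q      ≤⟨ +-monoˡ-≤ _ (<⇒≤ (m%n<n m q)) ⟩
      q + m / q * q          ≡⟨ trans (cong (q +_) (*-comm (m / q) q)) (sym (*-suc q _)) ⟩
      q * suc (m / q)        ∎
      where open ≤-Reasoning
            instance _ = >-nonZero 0<q

    two-step : ∀ s s′ i w → η ≤ sum (λ j → ⟦ E s i j ⟧ * ⟦ E s′ j w ⟧)
    two-step s s′ i w = *-cancelˡ-≤ (2 * q) (+-cancelˡ-≤ (2 * q * m) _ _ (begin
      2 * q * m + 2 * q * η         ≡⟨ cong (2 * q * m +_) (*-assoc 2 q η) ⟩
      2 * q * m + 2 * (q * η)       ≤⟨ +-monoʳ-≤ (2 * q * m) (*-monoʳ-≤ 2 qη≤) ⟩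
      2 * q * m + 2 * (2 * m)       ≡⟨ e₁ q m ⟩
      (q + 2) * m + (q + 2) * m     ≤⟨ +-mono-≤ (rich s (lookup B i)) (rich (not s′) (lookup B w)) ⟩
      2 * q * cnt s (lookup B i) B + 2 * q * cnt (not s′) (lookup B w) B
        ≡⟨ sym (*-distribˡ-+ (2 * q) _ _) ⟩
      2 * q * (cnt s (lookup B i) B + cnt (not s′) (lookup B w) B) ≤⟨ *-monoʳ-≤ (2 * q) both ⟩
      2 * q * (m + T₀)               ≡⟨ *-distribˡ-+ (2 * q) m T₀ ⟩
      2 * q * m + 2 * q * T₀         ∎))
      where
      open ≤-Reasoning
      T₀ = sum (λ j → ⟦ E s i j ⟧ * ⟦ E s′ j w ⟧)
      e₁ : ∀ q m → 2 * q * m + 2 * (2 * m) ≡ (q + 2) * m + (q + 2) * m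
      e₁ = solve-∀
      pt : ∀ a b → ⟦ a ⟧ + ⟦ b ⟧ ≤ 1 + ⟦ a ⟧ * ⟦ b ⟧
      pt true  true  = ≤-refl
      pt true  false = ≤-refl
      pt false c     = ⟦⟧≤1 c
      both : cnt s (lookup B i) B + cnt (not s′) (lookup B w) B ≤ m + T₀
      both = begin
        cnt s (lookup B i) B + cnt (not s′) (lookup B w) B
          ≡⟨ cong₂ _+_ (sym (row-sum s i)) (sym (col-sum s′ w)) ⟩
        sum (λ j → ⟦ E s i j ⟧) + sum (λ j → ⟦ E s′ j w ⟧) ≡⟨ sym (sum-+ (λ j → ⟦ E s i j ⟧) _) ⟩
        sum (λ j → ⟦ E s i j ⟧ + ⟦ E s′ j w ⟧) ≤⟨ sum-mono (λ j → pt (E s i j) (E s′ j w)) ⟩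
        sum (λ j → 1 + ⟦ E s i j ⟧ * ⟦ E s′ j w ⟧) ≡⟨ sum-+ (λ _ → 1) (λ j → ⟦ E s i j ⟧ * ⟦ E s′ j w ⟧) ⟩
        sum {m} (λ _ → 1) + T₀ ≡⟨ cong (_+ T₀) (trans (sum-const m 1) (*-identityʳ m)) ⟩
        m + T₀ ∎

    M²≤ : ∀ κ → suc κ ≡ K → m * b * (m * b) ≤ suc κ * (m * η)
    M²≤ κ e = begin
      m * b * (m * b)      ≡⟨ e₁ m b ⟩
      b * b * (m * m)      ≤⟨ *-monoʳ-≤ (b * b) (*-monoʳ-≤ m m≤qη) ⟩
      b * b * (m * (q * η)) ≡⟨ e₂ b m q η ⟩
      K * (m * η)          ≡⟨ cong (_* (m * η)) (sym e) ⟩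
      suc κ * (m * η)      ∎
      where
      open ≤-Reasoning
      e₁ : ∀ m b → m * b * (m * b) ≡ b * b * (m * m)
      e₁ = solve-∀
      e₂ : ∀ b m q η → b * b * (m * (q * η)) ≡ b * b * q * (m * η)
      e₂ = solve-∀

    module _ {A : Set} (F : Forest A) (i : Fin m) (κ h Q bad : ℕ) (κ≡ : suc κ ≡ K)
      (Q≤ : 8 * Q ≤ suc (size F)) (κ^h≤ : 8 * Q * κ ^ h ≤ suc κ ^ h)
      (lv≤ : 8 * Q * levels (double h) F ≤ suc (size F))
      (bad≤ : 8 * Q * (size F * bad) ≤ m * b) (bad< : bad < m * b) (fb≤ : C * suc (size F) ≤ bad)
      (φ : V → ℕ) (Ψ : ℕ) (φ≤Ψ : ∀ v → φ v ≤ Ψ) where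

      open TreeWalk signed-kernel 0<m (φ ∘ lookup B) Ψ (φ≤Ψ ∘ lookup B)

      pool-embed : ∃ λ js → Emb E i F js × Unique (i ∷ js) ×
        Q * m * (φ (lookup B i) + ΣL (φ ∘ lookup B) js) ≤ Q * suc (size F) * ΣL φ B + suc (size F) * m * Ψ
      pool-embed = go (Greedy.embed-piece (m * b ∸ bad) bad (sym (m∸n+n≡m (<⇒≤ bad<))) (m<n⇒0<n∸m bad<)
          κ η (M²≤ κ κ≡) two-step F i h Q Q≤ κ^h≤ lv≤ bad≤ fb≤)
        where
        go : (∃ λ js → Emb E i F js × (Unique js × All (_∉ i ∷ []) js) ×
               Q * m * (φ (lookup B i) + ΣL (φ ∘ lookup B) js) ≤ Q * suc (size F) * S + suc (size F) * m * Ψ) →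
             ∃ λ js → Emb E i F js × Unique (i ∷ js) ×
               Q * m * (φ (lookup B i) + ΣL (φ ∘ lookup B) js) ≤ Q * suc (size F) * ΣL φ B + suc (size F) * m * Ψ
        go (js , d , (u , a) , c) = js , d , All.map (λ h e → h (here (sym e))) a ∷ u ,
          subst (λ S → Q * m * (φ (lookup B i) + ΣL (φ ∘ lookup B) js) ≤ Q * suc (size F) * S + suc (size F) * m * Ψ)
            (ΣL-lookup φ B) c

-- Partial embeddings and absorbers

module _ {A : Set} where

  lookup-injective : ∀ {xs : List A} → Unique xs → ∀ i j → lookup xs i ≡ lookup xs j → i ≡ j
  lookup-injective (_ ∷ u) zero    zero    e = refl
  lookup-injective {_ ∷ xs} (h ∷ u) zero (suc j) e = ⊥-elim (All.lookup h (∈-lookup {xs = xs} j) e)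
  lookup-injective {_ ∷ xs} (h ∷ u) (suc i) zero e = ⊥-elim (All.lookup h (∈-lookup {xs = xs} i) (sym e))
  lookup-injective (_ ∷ u) (suc i) (suc j) e = cong suc (lookup-injective u i j e)

  extract₁ : ∀ {x : A} {xs} → x ∈ xs → ∃ λ ys → xs ↭ x ∷ ys
  extract₁ {x} p = let ys , zs , e = ∈-∃++ p in ys ++ zs , ↭-trans (↭-reflexive e) (↭.shift x ys zs)

  extract : ∀ ys {xs : List A} → Unique ys → (∀ {y} → y ∈ ys → y ∈ xs) → ∃ λ zs → xs ↭ ys ++ zs
  extract []       {xs} u h = xs , ↭-refl
  extract (y ∷ ys) {xs} (y∉ ∷ u) h =
    let xs′ , p = extract₁ (h (here refl))
        zs , p′ = extract ys u (λ {z} z∈ → sub z∈ (∈-resp-↭ p (h (there z∈))))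
    in zs , ↭-trans p (prep y p′)
    where
    sub : ∀ {z xs′} → z ∈ ys → z ∈ y ∷ xs′ → z ∈ xs′
    sub z∈ (here e)  = ⊥-elim (All.lookup y∉ z∈ (sym e))
    sub z∈ (there q) = q

  Unique-++ˡ : ∀ xs {ys : List A} → Unique (xs ++ ys) → Unique xs
  Unique-++ˡ []       u       = []
  Unique-++ˡ (x ∷ xs) (h ∷ u) = All.++⁻ˡ xs h ∷ Unique-++ˡ xs u

  Unique-++ʳ : ∀ xs {ys : List A} → Unique (xs ++ ys) → Unique ys
  Unique-++ʳ []       u       = u
  Unique-++ʳ (x ∷ xs) (_ ∷ u) = Unique-++ʳ xs u

  Unique-head : ∀ {x : A} {xs} → Unique (x ∷ xs) → All (x ≢_) xs
  Unique-head (h ∷ _) = h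

  Unique-disjoint : ∀ xs {ys : List A} → Unique (xs ++ ys) → ∀ {z} → z ∈ xs → z ∉ ys
  Unique-disjoint (x ∷ xs) (h ∷ u) (here refl) q = All.lookup h (∈-++⁺ʳ xs q) refl
  Unique-disjoint (x ∷ xs) (h ∷ u) (there p)   q = Unique-disjoint xs u p q

  map-≡-++ : ∀ {B : Set} (f : A → B) xs {ys as bs} → map f (xs ++ ys) ≡ as ++ bs → length xs ≡ length as →
             map f xs ≡ as × map f ys ≡ bs
  map-≡-++ f []       {as = []}     e l = refl , e
  map-≡-++ f (x ∷ xs) {as = a ∷ as} e l with List.∷-injective e
  ... | refl , e′ = let h₁ , h₂ = map-≡-++ f xs e′ (suc-injective l) in cong (f x ∷_) h₁ , h₂

  Unique-map-injective : ∀ {B : Set} {f : A → B} {xs} → Unique (map f xs) → ∀ {x y} → x ∈ xs → y ∈ xs → f x ≡ f y → x ≡ y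
  Unique-map-injective u (here refl) (here refl) e = refl
  Unique-map-injective {f = f} (h ∷ u) (here refl) (there q) e = ⊥-elim (All.lookup h (∈-map⁺ f q) e)
  Unique-map-injective {f = f} (h ∷ u) (there p) (here refl) e = ⊥-elim (All.lookup h (∈-map⁺ f p) (sym e))
  Unique-map-injective (h ∷ u) (there p) (there q) e = Unique-map-injective u p q e

  Unique-map-lookup : ∀ {xs : List A} → Unique xs → ∀ {js} → Unique js → Unique (map (lookup xs) js)
  Unique-map-lookup u uj = Unique.map⁺ (lookup-injective u _ _) uj

  All-↭ : ∀ {P : A → Set} {xs ys} → xs ↭ ys → All P xs → All P ys
  All-↭ p h = All.tabulate λ z∈ → All.lookup h (∈-resp-↭ (↭-sym p) z∈)

module _ {n : ℕ} where

  Unique-length : ∀ {xs : List (Fin n)} → Unique xs → length xs ≡ n → ∀ z → z ∈ xs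
  Unique-length {xs} u l z with extract xs u (λ {y} _ → ∈-allFin y)
  ... | zs , p = ∈-resp-↭ (↭-trans p (↭-reflexive (trans (cong (xs ++_) (empty zs len)) (List.++-identityʳ xs)))) (∈-allFin z)
    where
    empty : ∀ (zs : List (Fin n)) → length zs ≡ 0 → zs ≡ []
    empty [] _ = refl
    len : length zs ≡ 0
    len = +-cancelˡ-≡ n _ _ (begin
      n + length zs          ≡⟨ cong (_+ length zs) (sym l) ⟩
      length xs + length zs  ≡⟨ sym (List.length-++ xs) ⟩
      length (xs ++ zs)      ≡⟨ sym (↭.↭-length p) ⟩
      length (allFin n)      ≡⟨ List.length-tabulate id ⟩
      n                      ≡⟨ sym (+-identityʳ n) ⟩
      n + 0                  ∎)
      where open ≡-Reasoning

  upd : ∀ {A : Set} → (Fin n → A) → Fin n → A → Fin n → A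
  upd f x y z = if z == x then y else f z

  upd-at : ∀ {A : Set} (f : Fin n → A) x y → upd f x y x ≡ y
  upd-at f x y with x == x | ==-refl x
  ... | true | _ = refl

  upd-other : ∀ {A : Set} (f : Fin n → A) {x y z} → z ≢ x → upd f x y z ≡ f z
  upd-other f {x} {y} {z} ne with z == x in e
  ... | true  = ⊥-elim (ne (==-true e))
  ... | false = refl

  upds : ∀ {A : Set} → (Fin n → A) → List (Fin n) → List A → Fin n → A
  upds f (x ∷ xs) (y ∷ ys) = upd (upds f xs ys) x y
  upds f _        _        = f

  upds-other : ∀ {A : Set} (f : Fin n → A) xs ys {z} → z ∉ xs → upds f xs ys z ≡ f z
  upds-other f []       ys       z∉ = refl
  upds-other f (x ∷ xs) []       z∉ = refl
  upds-other f (x ∷ xs) (y ∷ ys) z∉ = trans (upd-other (upds f xs ys) (z∉ ∘ here)) (upds-other f xs ys (z∉ ∘ there))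

  map-cong-∈ : ∀ {A : Set} {f g : Fin n → A} xs → (∀ {z} → z ∈ xs → f z ≡ g z) → map f xs ≡ map g xs
  map-cong-∈ []       h = refl
  map-cong-∈ (x ∷ xs) h = cong₂ _∷_ (h (here refl)) (map-cong-∈ xs (h ∘ there))

  upds-map : ∀ {A : Set} (f : Fin n → A) xs ys → Unique xs → length xs ≡ length ys → map (upds f xs ys) xs ≡ ys
  upds-map f []       []       u l = refl
  upds-map f (x ∷ xs) (y ∷ ys) (x∉ ∷ u) l = cong₂ _∷_ (upd-at (upds f xs ys) x y)
    (trans (map-cong-∈ xs (λ {z} z∈ → upd-other (upds f xs ys) (λ e → All.lookup x∉ z∈ (sym e))))
           (upds-map f xs ys u (suc-injective l)))

module Embed {n : ℕ} (G : Digraph n) where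

  open Graph G public

  Edge : Set
  Edge = V × Bool × V

  src dst : Edge → V
  src (y , s , x) = y
  dst (y , s , x) = x

  fe : V → Forest V → List Edge
  fe y []                    = []
  fe y ((s , node x cs) ∷ F) = (y , s , x) ∷ fe x cs ++ fe y F

  fe-length : ∀ y F → length (fe y F) ≡ size F
  fe-length y [] = refl
  fe-length y ((s , node x cs) ∷ F) = cong suc (trans (List.length-++ (fe x cs)) (cong₂ _+_ (fe-length x cs) (fe-length y F)))

  Sat : (V → V) → Edge → Set
  Sat f (y , s , x) = Eg s (f y) (f x) ≡ true

  -- parents come before their children
  data Par : List V → List Edge → Set where
    []  : ∀ {ds} → Par ds []
    _∷_ : ∀ {ds y s x es} → y ∈ ds → Par (x ∷ ds) es → Par ds ((y , s , x) ∷ es)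

  Par-mono : ∀ {ds ds′ es} → (∀ {z} → z ∈ ds → z ∈ ds′) → Par ds es → Par ds′ es
  Par-mono h []      = []
  Par-mono h (y ∷ p) = h y ∷ Par-mono (λ { (here e) → here e ; (there q) → there (h q) }) p

  Par-++ : ∀ {ds es es′} → Par ds es → (∀ {ds′} → (∀ {z} → z ∈ ds ⊎ z ∈ map dst es → z ∈ ds′) → Par ds′ es′) → Par ds (es ++ es′)
  Par-++ []      h = h [ id , (λ ()) ]′
  Par-++ {ds} (_∷_ {x = x} {es} y∈ p) h =
    y∈ ∷ Par-++ p (λ sub → h λ { (inj₁ q) → sub (inj₁ (there q)) ; (inj₂ (here e)) → sub (inj₁ (here e)) ; (inj₂ (there q)) → sub (inj₂ q) })

  -- Tree and host have the same order, so both use `Fin n`; only the values of `f` on `ds` matter.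
  -- The one permutation says that `f` is injective on `ds` and that `B` lists the free vertices
  -- without repetition.
  record Images (f : V → V) (ds B : List V) : Set where
    constructor imgs
    field all-images : map f ds ++ B ↭ allFin n

  open Images

  Images-unique : ∀ {f ds B} → Images f ds B → Unique (map f ds ++ B)
  Images-unique im = Unique-↭ (↭-sym (all-images im)) (Unique.allFin⁺ n)

  Images-length : ∀ {f ds B} → Images f ds B → length ds + length B ≡ n
  Images-length {f} {ds} {B} im = begin
    length ds + length B          ≡⟨ cong (_+ length B) (sym (List.length-map f ds)) ⟩
    length (map f ds) + length B  ≡⟨ sym (List.length-++ (map f ds)) ⟩
    length (map f ds ++ B)        ≡⟨ ↭.↭-length (all-images im) ⟩
    length (allFin n)             ≡⟨ List.length-tabulate id ⟩
    n                             ∎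
    where open ≡-Reasoning

  place : ∀ {f ds B B′} xs ys → Unique xs → (∀ {z} → z ∈ ds → z ∉ xs) → length xs ≡ length ys →
          B ↭ ys ++ B′ → Images f ds B → Images (upds f xs ys) (xs ++ ds) B′
  place {f} {ds} {B} {B′} xs ys u dis l p im = imgs (↭-trans (↭-reflexive (cong (_++ B′) eq)) (↭-trans
      (↭-trans (↭.++⁺ʳ B′ (↭.++-comm ys (map f ds))) (↭-reflexive (List.++-assoc (map f ds) ys B′)))
      (↭-trans (↭.++⁺ˡ (map f ds) (↭-sym p)) (all-images im))))
    where
    eq : map (upds f xs ys) (xs ++ ds) ≡ ys ++ map f ds
    eq = trans (List.map-++ (upds f xs ys) xs ds) (cong₂ _++_ (upds-map f xs ys u l)
           (map-cong-∈ ds (λ z∈ → upds-other f xs ys (dis z∈))))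

  Ends : List V → List Edge → Set
  Ends ds es = All (λ e → src e ∈ ds × dst e ∈ ds) es

  Sat-cong : ∀ {f f′ ds es} → (∀ {z} → z ∈ ds → f′ z ≡ f z) → Ends ds es → All (Sat f) es → All (Sat f′) es
  Sat-cong h []            []      = []
  Sat-cong {es = (y , s , x) ∷ _} h ((a , b) ∷ ends) (e ∷ es) =
    trans (cong₂ (Eg s) (h a) (h b)) e ∷ Sat-cong h ends es

  Par-Ends : ∀ {ds es} → Par ds es → ∀ {ds′} → (∀ {z} → z ∈ ds ⊎ z ∈ map dst es → z ∈ ds′) → Ends ds′ es
  Par-Ends []      h = []
  Par-Ends (y ∷ p) h = (h (inj₁ y) , h (inj₂ (here refl))) ∷
    Par-Ends p (λ { (inj₁ (here e)) → h (inj₂ (here e)) ; (inj₁ (there q)) → h (inj₁ q) ; (inj₂ q) → h (inj₂ (there q)) })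

  Emb-Sat : ∀ B (f : V → V) {i} x {F : Forest V} {js} → Emb (λ s i j → Eg s (lookup B i) (lookup B j)) i F js →
    map f (map dst (fe x F)) ≡ map (lookup B) js → f x ≡ lookup B i → All (Sat f) (fe x F)
  Emb-Sat B f x [] e ex = []
  Emb-Sat B f x (cons {s = s} {x = z} {cs = cs} {F = F} {j = j} {js = js} {ks = ks} Eij d d′) e ex =
    trans (cong₂ (Eg s) ex ez) Eij ∷ All.++⁺ (Emb-Sat B f z d (proj₁ halves) ez) (Emb-Sat B f x d′ (proj₂ halves) ex)
    where
    ez : f z ≡ lookup B j
    ez = proj₁ (List.∷-injective e)
    halves : map f (map dst (fe z cs)) ≡ map (lookup B) js × map f (map dst (fe x F)) ≡ map (lookup B) ks
    halves = map-≡-++ f (map dst (fe z cs))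
      (trans (cong (map f) (sym (List.map-++ dst (fe z cs) (fe x F))))
        (trans (proj₂ (List.∷-injective e)) (List.map-++ (lookup B) js ks)))
      (trans (List.length-map dst (fe z cs)) (trans (fe-length z cs)
        (trans (sym (Emb-length d)) (sym (List.length-map (lookup B) js)))))

  cnt⇒index : ∀ s a B → 0 < cnt s a B → ∃ λ i → Eg s a (lookup B i) ≡ true
  cnt⇒index s a B h = let i , p = sum->0 _ (subst (0 <_) (sym (ΣL-lookup (λ v → ⟦ Eg s a v ⟧) B)) h) in i , ⟦⟧>0 p

  record Placed (f : V → V) (ds B : List V) (es : List Edge) : Set where
    field
      f′     : V → V
      B′ ys  : List V
      agree  : ∀ {z} → z ∈ ds → f′ z ≡ f z
      sat    : All (Sat f′) es
      images : Images f′ (map dst es ++ ds) B′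
      split  : B ↭ ys ++ B′
      placed : length ys ≡ length es
      onto   : map f′ (map dst es) ≡ ys

  place-piece : ∀ {f ds B} y s x cs i js → Images f ds B → y ∈ ds → Unique (map dst (fe y ((s , node x cs) ∷ [])) ++ ds) →
    Eg s (f y) (lookup B i) ≡ true → Emb (λ s i j → Eg s (lookup B i) (lookup B j)) i cs js → Unique (i ∷ js) →
    Σ (Placed f ds B (fe y ((s , node x cs) ∷ []))) λ P → Placed.ys P ≡ map (lookup B) (i ∷ js)
  place-piece {f} {ds} {B} y s x cs i js im y∈ u Ey d uj = record
    { f′ = f′ ; B′ = B′ ; ys = ys
    ; agree = agree
    ; sat = trans (cong₂ (Eg s) (agree y∈) ex) Ey ∷ subst (All (Sat f′)) (sym (List.++-identityʳ (fe x cs)))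
        (Emb-Sat B f′ x d (proj₂ (List.∷-injective eq)) ex)
    ; images = subst (λ xs → Images f′ (xs ++ ds) B′) (sym xs≡) (place xs ys uxs dis len p im)
    ; split = p
    ; placed = trans (sym len) (trans (cong length (sym xs≡)) (List.length-map dst (fe y ((s , node x cs) ∷ []))))
    ; onto = trans (cong (map f′) xs≡) eq } , refl
    where
    xs = x ∷ map dst (fe x cs)
    xs≡ : map dst (fe y ((s , node x cs) ∷ [])) ≡ xs
    xs≡ = cong (λ z → x ∷ map dst z) (List.++-identityʳ (fe x cs))
    ys = map (lookup B) (i ∷ js)
    uB : Unique B
    uB = Unique-++ʳ (map f ds) (Images-unique im)
    ext : ∃ λ B′ → B ↭ ys ++ B′
    ext = extract ys (Unique-map-lookup uB uj) λ z∈ → let j , _ , e = ∈-map⁻ (lookup B) z∈ in subst (_∈ B) (sym e) (∈-lookup j)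
    B′ = proj₁ ext
    p = proj₂ ext
    u′ : Unique (xs ++ ds)
    u′ = subst (λ xs → Unique (xs ++ ds)) xs≡ u
    uxs : Unique xs
    uxs = Unique-++ˡ xs u′
    dis : ∀ {z} → z ∈ ds → z ∉ xs
    dis z∈ z∈′ = Unique-disjoint xs u′ z∈′ z∈
    len : length xs ≡ length ys
    len = cong suc (trans (List.length-map dst (fe x cs)) (trans (fe-length x cs)
            (trans (sym (Emb-length d)) (sym (List.length-map (lookup B) js)))))
    f′ = upds f xs ys
    agree : ∀ {z} → z ∈ ds → f′ z ≡ f z
    agree z∈ = upds-other f xs ys (dis z∈)
    eq : map f′ xs ≡ ys
    eq = upds-map f xs ys uxs len
    ex : f′ x ≡ lookup B i
    ex = proj₁ (List.∷-injective eq)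

  -- q may move to any vertex r that fits its neighbours p and cs
  record Absorber : Set where
    constructor absorber
    field
      p q : V
      sq  : Bool
      cs  : List (Bool × V)

    labs : List V
    labs = p ∷ q ∷ map proj₂ cs

    edges : List Edge
    edges = (p , sq , q) ∷ map (λ (s , c) → q , s , c) cs

  open Absorber using (labs)

  fits : (V → V) → List (Bool × V) → V → Bool
  fits f []             r = true
  fits f ((s , c) ∷ cs) r = Eg s r (f c) ∧ fits f cs r

  -- `r` suits the neighbours of `q`, and the image that `q` gives up is a neighbour, in direction
  -- `s`, of the image `a` of a waiting vertex's parent.
  hit : (V → V) → V → V → Bool → Absorber → Bool
  hit f r a s (absorber p q sq cs) = Eg sq (f p) r ∧ (Eg s a (f q) ∧ fits f cs r)

  hits : (V → V) → V → V → Bool → List Absorber → ℕ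
  hits f r a s abs = ΣL (λ A → ⟦ hit f r a s A ⟧) abs

  -- All edges at `q` belong to the absorber, so moving `q` affects only edges that `hit` has
  -- checked.
  Local : List Edge → Absorber → Set
  Local es (absorber p q sq cs) = All (λ e → (src e ≡ q → ∃₂ λ s c → (s , c) ∈ cs × e ≡ (q , s , c)) × (dst e ≡ q → e ≡ (p , sq , q))) es

  fits-cong : ∀ {f f′} cs r → (∀ {z} → z ∈ map proj₂ cs → f′ z ≡ f z) → fits f′ cs r ≡ fits f cs r
  fits-cong []             r h = refl
  fits-cong ((s , c) ∷ cs) r h = cong₂ _∧_ (cong (Eg s r) (h (here refl))) (fits-cong cs r (h ∘ there))

  hit-cong : ∀ {f f′} r a s A → (∀ {z} → z ∈ labs A → f′ z ≡ f z) → hit f′ r a s A ≡ hit f r a s A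
  hit-cong r a s (absorber p q sq cs) h = cong₂ _∧_ (cong (λ v → Eg sq v r) (h (here refl)))
    (cong₂ _∧_ (cong (Eg s a) (h (there (here refl)))) (fits-cong cs r (h ∘ there ∘ there)))

  hits-cong : ∀ {f f′} r a s abs → (∀ {z} → z ∈ concatMap labs abs → f′ z ≡ f z) → hits f′ r a s abs ≡ hits f r a s abs
  hits-cong r a s []        h = refl
  hits-cong r a s (A ∷ abs) h = cong₂ _+_ (cong ⟦_⟧ (hit-cong r a s A (h ∘ ∈-++⁺ˡ))) (hits-cong r a s abs (h ∘ ∈-++⁺ʳ (labs A)))

  fits-∈ : ∀ {f cs r} → fits f cs r ≡ true → ∀ {s c} → (s , c) ∈ cs → Eg s r (f c) ≡ true
  fits-∈ {cs = _ ∷ _} h (here refl) = proj₁ (∧-true h)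
  fits-∈ {cs = _ ∷ _} h (there p)   = fits-∈ (proj₂ (∧-true h)) p

  concatMap-↭ : ∀ {abs abs′} → abs ↭ abs′ → concatMap labs abs ↭ concatMap labs abs′
  concatMap-↭ Permutation.refl         = ↭-refl
  concatMap-↭ (Permutation.prep A p)   = ↭.++⁺ˡ (labs A) (concatMap-↭ p)
  concatMap-↭ (Permutation.swap {xs} {ys} A A′ p) = ↭-trans (↭.shifts (labs A) (labs A′)) (↭.++⁺ˡ (labs A′) (↭.++⁺ˡ (labs A) (concatMap-↭ p)))
  concatMap-↭ (Permutation.trans p p′) = ↭-trans (concatMap-↭ p) (concatMap-↭ p′)

  Completion : List Edge → Set
  Completion es = ∃ λ f → (∀ {x y} → f x ≡ f y → x ≡ y) × All (Sat f) es

  module Absorb {f : V → V} {ds : List V} {p q : V} {sq : Bool} {cs : List (Bool × V)} {r x y : V} {s : Bool}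
    (x∉ : x ∉ ds) (y∈ : y ∈ ds) (labs⊆ : ∀ {z} → z ∈ p ∷ q ∷ map proj₂ cs → z ∈ ds)
    (u : Unique (p ∷ q ∷ map proj₂ cs))
    (h : hit f r (f y) s (absorber p q sq cs) ≡ true) where

    absorbed : V → V
    absorbed = upd (upd f q r) x (f q)

    private
      x≢ : ∀ {z} → z ∈ ds → z ≢ x
      x≢ z∈ refl = x∉ z∈

      q∈ : q ∈ ds
      q∈ = labs⊆ (there (here refl))

      keep : ∀ {z} → z ∈ ds → z ≢ q → absorbed z ≡ f z
      keep z∈ ne = trans (upd-other (upd f q r) (x≢ z∈)) (upd-other f ne)

      at-q : absorbed q ≡ r
      at-q = trans (upd-other (upd f q r) (x≢ q∈)) (upd-at f q r)

      p≢q : p ≢ q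
      p≢q = All.head (Unique-head u)

      c≢q : ∀ {c} → c ∈ map proj₂ cs → c ≢ q
      c≢q c∈ e = All.lookup (Unique-head (Unique-++ʳ (p ∷ []) u)) c∈ (sym e)

      h₁ : Eg sq (f p) r ≡ true
      h₁ = proj₁ (∧-true h)
      h₂ : Eg s (f y) (f q) ≡ true
      h₂ = proj₁ (∧-true (proj₂ (∧-true {Eg sq (f p) r} h)))
      h₃ : fits f cs r ≡ true
      h₃ = proj₂ (∧-true {Eg s (f y) (f q)} (proj₂ (∧-true {Eg sq (f p) r} h)))

      -- If y were q, its image would be its own neighbour. Hence the parent of x keeps its place
      -- while q moves.
      y≢q : y ≢ q
      y≢q refl = true≢false h₂ (Eg-loopless s (f y))

    absorbed-new : Sat absorbed (y , s , x)
    absorbed-new = trans (cong₂ (Eg s) (keep y∈ y≢q) (upd-at (upd f q r) x (f q))) h₂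

    absorbed-keep : ∀ {z} → z ∈ ds → z ≢ q → absorbed z ≡ f z
    absorbed-keep = keep

    absorbed-sat : ∀ {de} → Ends ds de → Local de (absorber p q sq cs) → All (Sat f) de → All (Sat absorbed) de
    absorbed-sat [] [] [] = []
    absorbed-sat {(y₁ , s₁ , x₁) ∷ _} ((a , b) ∷ ends) ((l₁ , l₂) ∷ ls) (e ∷ es) = one (y₁ Fin.≟ q) (x₁ Fin.≟ q) ∷ absorbed-sat ends ls es
      where
      one : Dec (y₁ ≡ q) → Dec (x₁ ≡ q) → Sat absorbed (y₁ , s₁ , x₁)
      one (no n₁) (no n₂) = trans (cong₂ (Eg s₁) (keep a n₁) (keep b n₂)) e
      one (yes e₁) _ = let s₂ , c , c∈ , e₂ = l₁ e₁ in
        subst (Sat absorbed) (sym e₂)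
          (trans (cong₂ (Eg s₂) at-q (keep (subst (λ e → dst e ∈ ds) e₂ b) (c≢q (∈-map⁺ proj₂ c∈)))) (fits-∈ h₃ c∈))
      one (no n₁) (yes e₂) = subst (Sat absorbed) (sym (l₂ e₂))
        (trans (cong₂ (Eg sq) (keep (subst (λ e → src e ∈ ds) (l₂ e₂) a) p≢q) at-q) h₁)

    absorbed-images : ∀ {B} → Unique ds → Images f ds (r ∷ B) → Images absorbed (x ∷ ds) B
    absorbed-images {B} uds im = imgs (↭-trans (↭.++⁺ʳ B new) (↭-trans
        (↭-trans (prep (f q) (↭-sym (↭.shift r (map f ds₁) B))) (↭-sym (↭.++⁺ʳ (r ∷ B) old))) (all-images im)))
      where
      e₁ : ∃ λ ds₁ → ds ↭ q ∷ ds₁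
      e₁ = extract₁ q∈
      ds₁ = proj₁ e₁
      pds = proj₂ e₁
      u₁ : Unique (q ∷ ds₁)
      u₁ = Unique-↭ pds uds
      q∉ : q ∉ ds₁
      q∉ q∈ = Unique.Unique[x∷xs]⇒x∉xs u₁ q∈
      old : map f ds ↭ f q ∷ map f ds₁
      old = ↭.map⁺ f pds
      new : map absorbed (x ∷ ds) ↭ f q ∷ r ∷ map f ds₁
      new = ↭-trans (↭-reflexive (cong (_∷ map absorbed ds) (upd-at (upd f q r) x (f q)))) (prep (f q)
        (↭-trans (↭.map⁺ absorbed pds) (↭-reflexive (cong₂ _∷_ at-q
          (map-cong-∈ ds₁ λ z∈ → keep (∈-resp-↭ (↭-sym pds) (there z∈)) (λ { refl → q∉ z∈ }))))))

  -- Each step consumes one edge, one free vertex and one absorber. Absorbers have disjoint labels,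
  -- so the others keep their images and every hit count drops by at most one, just as the number of
  -- open edges does. Any free vertex serves as `r`; the first is taken.
  absorb-tail : ∀ {f ds B de} re abs → Unique ds → Images f ds B → Par ds re → Unique (map dst re ++ ds) →
    length re ≡ length B → All (Sat f) de → Ends ds de →
    All (λ A → Local de A × Local re A) abs → Unique (concatMap labs abs) → (∀ {z} → z ∈ concatMap labs abs → z ∈ ds) →
    (∀ r a s → length re ≤ hits f r a s abs) → Completion (de ++ re)
  absorb-tail {f} {ds} {[]} {de} [] abs uds im par u len sat ends loc uabs sub enough =
    f , inj , subst (All (Sat f)) (sym (List.++-identityʳ de)) sat
    where
    lds : length ds ≡ n
    lds = trans (sym (+-identityʳ _)) (Images-length {f} {ds} {[]} im)
    inj : ∀ {x y} → f x ≡ f y → x ≡ y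
    inj {x} {y} = Unique-map-injective (subst Unique (List.++-identityʳ (map f ds)) (Images-unique {f} {ds} {[]} im))
      (Unique-length uds lds x) (Unique-length uds lds y)
  absorb-tail {f} {ds} {r ∷ B} {de} ((y , s , x) ∷ re) abs uds im (y∈ ∷ par) (x∉ ∷ u) len sat ends loc uabs sub enough =
    go (ΣL->0 (λ A → ⟦ hit f r (f y) s A ⟧) abs (≤-trans (s≤s z≤n) (enough r (f y) s)))
    where
    x∉ds : x ∉ ds
    x∉ds x∈ = All.lookup x∉ (∈-++⁺ʳ (map dst re) x∈) refl
    go : (∃ λ A → A ∈ abs × 0 < ⟦ hit f r (f y) s A ⟧) → Completion (de ++ (y , s , x) ∷ re)
    go (absorber p q sq cs , A∈ , pos) = reorder (absorb-tail {f′} {x ∷ ds} {B} {(y , s , x) ∷ de} re abs′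
        (All.tabulate (λ { z∈ refl → x∉ds z∈ }) ∷ uds)
        (absorbed-images uds im)
        par
        (Unique-↭ (↭-sym (↭.shift x (map dst re) ds)) (x∉ ∷ u))
        (suc-injective len)
        (absorbed-new ∷ absorbed-sat ends (proj₁ (All.lookup loc A∈)) sat)
        ((there y∈ , here refl) ∷ All.map (λ (a , b) → there a , there b) ends)
        (All.map (λ { (l , l₁ ∷ l₂) → l₁ ∷ l , l₂ }) loc′)
        (Unique-++ʳ (labs A) uabs′)
        (λ z∈ → there (sub′ (∈-++⁺ʳ (labs A) z∈)))
        enough′)
      where
      A = absorber p q sq cs
      h : hit f r (f y) s A ≡ true
      h = ⟦⟧>0 pos
      pull = extract₁ A∈
      abs′ = proj₁ pull
      pab = proj₂ pull
      uabs′ : Unique (labs A ++ concatMap labs abs′)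
      uabs′ = Unique-↭ (concatMap-↭ pab) uabs
      sub′ : ∀ {z} → z ∈ labs A ++ concatMap labs abs′ → z ∈ ds
      sub′ z∈ = sub (∈-resp-↭ (↭-sym (concatMap-↭ pab)) z∈)
      labs⊆ : ∀ {z} → z ∈ labs A → z ∈ ds
      labs⊆ z∈ = sub′ (∈-++⁺ˡ z∈)
      uA : Unique (labs A)
      uA = Unique-++ˡ (labs A) uabs′
      loc′ : All (λ A → Local de A × Local ((y , s , x) ∷ re) A) abs′
      loc′ = All.tabulate λ z∈ → All.lookup loc (∈-resp-↭ (↭-sym pab) (there z∈))
      open Absorb {f} {ds} {p} {q} {sq} {cs} {r} {x} {y} {s} x∉ds y∈ labs⊆ uA h
      f′ = absorbed
      enough′ : ∀ r a s → length re ≤ hits f′ r a s abs′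
      enough′ r₁ a₁ s₁ = ≤-pred (begin
        suc (length re)                                    ≤⟨ enough r₁ a₁ s₁ ⟩
        hits f r₁ a₁ s₁ abs                                ≡⟨ ΣL-↭ (λ A → ⟦ hit f r₁ a₁ s₁ A ⟧) pab ⟩
        ⟦ hit f r₁ a₁ s₁ A ⟧ + hits f r₁ a₁ s₁ abs′        ≤⟨ +-monoˡ-≤ _ (⟦⟧≤1 (hit f r₁ a₁ s₁ A)) ⟩
        suc (hits f r₁ a₁ s₁ abs′)                         ≡⟨ cong suc (sym (hits-cong r₁ a₁ s₁ abs′ keep′)) ⟩
        suc (hits f′ r₁ a₁ s₁ abs′)                        ∎)
        where
        open ≤-Reasoning
        keep′ : ∀ {z} → z ∈ concatMap labs abs′ → f′ z ≡ f z
        keep′ z∈ = absorbed-keep (sub′ (∈-++⁺ʳ (labs A) z∈))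
          (λ { refl → Unique-disjoint (labs A) uabs′ (there (here refl)) z∈ })
      reorder : Completion ((y , s , x) ∷ de ++ re) → Completion (de ++ (y , s , x) ∷ re)
      reorder (g , gi , gs) = g , gi , All-↭ (↭-sym (↭.shift (y , s , x) de re)) gs

-- The potential

-- Bernoulli's inequality for (1 + 1/r) ^ k, cleared of denominators.
pow-lower : ∀ r k → r ^ k * (r + k) ≤ suc r ^ k * r
pow-lower r zero    = ≤-reflexive (cong (1 *_) (+-identityʳ r))
pow-lower r (suc k) = begin
  r * r ^ k * (r + suc k)              ≤⟨ ≤-by (r ^ k * k) (e₁ r k (r ^ k)) ⟩
  r * (r ^ k * (r + k)) + r ^ k * (r + k) ≤⟨ +-mono-≤ (*-monoʳ-≤ r (pow-lower r k)) (pow-lower r k) ⟩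
  r * (suc r ^ k * r) + suc r ^ k * r  ≡⟨ e₂ r (suc r ^ k) ⟩
  suc r * suc r ^ k * r                ∎
  where
  open ≤-Reasoning
  e₁ : ∀ r k x → r * (x * (r + k)) + x * (r + k) ≡ r * x * (r + suc k) + x * k
  e₁ = solve-∀
  e₂ : ∀ r y → r * (y * r) + y * r ≡ suc r * y * r
  e₂ = solve-∀

-- The companion of `pow-lower`: while k ≤ r, the expansion of (1 + 1/r) ^ k beyond 1 + k/r is at
-- most (k/r) ^ 2.
pow-upper : ∀ r k → k ≤ r → r * r * suc r ^ k ≤ r ^ k * (r * r + k * r + k * k)
pow-upper r zero    _  = ≤-reflexive (e r)
  where e : ∀ r → r * r * 1 ≡ 1 * (r * r + 0 * r + 0 * 0)
        e = solve-∀
pow-upper r (suc k) le = begin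
  r * r * (suc r * suc r ^ k)                 ≡⟨ e₁ r (suc r ^ k) ⟩
  suc r * (r * r * suc r ^ k)                 ≤⟨ *-monoʳ-≤ (suc r) (pow-upper r k (<⇒≤ le)) ⟩
  suc r * (r ^ k * (r * r + k * r + k * k))   ≡⟨ e₂ r k (r ^ k) ⟩
  r ^ k * (r * (r * r + k * r + r + k * k + k) + k * k)
    ≤⟨ *-monoʳ-≤ (r ^ k) (+-monoʳ-≤ _ (*-monoˡ-≤ k (<⇒≤ le))) ⟩
  r ^ k * (r * (r * r + k * r + r + k * k + k) + r * k) ≤⟨ *-monoʳ-≤ (r ^ k) (≤-by r (e₃ r k)) ⟩
  r ^ k * (r * (r * r + suc k * r + suc k * suc k)) ≡⟨ e₄ r (r ^ k) (r * r + suc k * r + suc k * suc k) ⟩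
  r * r ^ k * (r * r + suc k * r + suc k * suc k) ∎
  where
  open ≤-Reasoning
  e₁ : ∀ r y → r * r * (suc r * y) ≡ suc r * (r * r * y)
  e₁ = solve-∀
  e₂ : ∀ r k x → suc r * (x * (r * r + k * r + k * k)) ≡ x * (r * (r * r + k * r + r + k * k + k) + k * k)
  e₂ = solve-∀
  e₃ : ∀ r k → r * (r * r + suc k * r + suc k * suc k) ≡ r * (r * r + k * r + r + k * k + k) + r * k + r
  e₃ = solve-∀
  e₄ : ∀ r x y → x * (r * y) ≡ r * x * y
  e₄ = solve-∀

-- For a test τ let c be its count in the pool B, of size m, after u vertices have been placed. The
-- potential is ((r + 1) / r) ^ (g m − h c), made integral by the factor D = (r + 1) ^ (h n) r ^ (g n).
module Potential {V : Set} {N : ℕ} (X : Fin N → V → Bool) (g h r : ℕ) (0<r : 0 < r) where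

  private instance
    r-nonZero : NonZero r
    r-nonZero = >-nonZero 0<r

  c d : Fin N → List V → ℕ
  c τ B = ΣL (λ v → ⟦ X τ v ⟧) B
  d τ B = ΣL (λ v → ⟦ not (X τ v) ⟧) B

  c+d : ∀ τ B → c τ B + d τ B ≡ length B
  c+d τ B = trans (sym (ΣL-+ (λ v → ⟦ X τ v ⟧) _ B)) (trans (ΣL-cong (λ v → pt (X τ v)) B) (trans (ΣL-const 1 B) (*-identityʳ _)))
    where pt : ∀ b → ⟦ b ⟧ + ⟦ not b ⟧ ≡ 1
          pt true = refl
          pt false = refl

  z : Fin N → ℕ → List V → ℕ
  z τ u B = suc r ^ (g * length B + h * u + h * d τ B) * r ^ (h * c τ B + g * u)

  Z : ℕ → List V → ℕ
  Z u B = sum (λ τ → z τ u B)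

  D : ℕ → ℕ
  D n = suc r ^ (h * n) * r ^ (g * n)

  -- The price of taking `v` out of the pool: up to the factor h / r, the first-order increase of
  -- `Z`.
  φ : ℕ → List V → V → ℕ
  φ u B v = sum (λ τ → z τ u B * ⟦ X τ v ⟧)

  φ≤Z : ∀ u B v → φ u B v ≤ Z u B
  φ≤Z u B v = sum-mono (λ τ → ≤-trans (*-monoʳ-≤ (z τ u B) (⟦⟧≤1 (X τ v))) (≤-reflexive (*-identityʳ _)))

  ΣL-φ : ∀ u B ys → ΣL (φ u B) ys ≡ sum (λ τ → z τ u B * c τ ys)
  ΣL-φ u B ys = trans (ΣL-sum (λ τ v → z τ u B * ⟦ X τ v ⟧) ys) (sum-cong (λ τ → ΣL-*ˡ (z τ u B) (λ v → ⟦ X τ v ⟧) ys))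

  -- Placing s vertices, x of which the test counts, multiplies the term by (1 + 1/r) ^ (h x - g s);
  -- this is `relate`. The two powers are then estimated in opposite directions.
  z-decay : ∀ τ u B B′ ys → B ↭ ys ++ B′ → h * length ys ≤ r →
    z τ (u + length ys) B′ * (r * (r + g * length ys)) ≤ z τ u B * (r * r + h * c τ ys * (r + h * length ys))
  z-decay τ u B B′ ys p hs≤r = *-cancelˡ-≤ (P * Q) {{m*n≢0 P Q {{m^n≢0 r (g * s)}} {{m^n≢0 r (h * x)}}}} (begin
    P * Q * (z₁ * (r * (r + g * s)))              ≡⟨ e₁ P Q z₁ r (r + g * s) ⟩
    z₁ * Q * r * (P * (r + g * s))                ≤⟨ *-monoʳ-≤ (z₁ * Q * r) (pow-lower r (g * s)) ⟩
    z₁ * Q * r * (suc r ^ (g * s) * r)            ≡⟨ e₂ z₁ Q r (suc r ^ (g * s)) ⟩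
    r * r * (z₁ * (suc r ^ (g * s) * Q))          ≡⟨ cong (r * r *_) relate ⟩
    r * r * (z₀ * (suc r ^ (h * x) * P))          ≡⟨ e₃ r z₀ (suc r ^ (h * x)) P ⟩
    z₀ * P * (r * r * suc r ^ (h * x))            ≤⟨ *-monoʳ-≤ (z₀ * P) (pow-upper r (h * x) (≤-trans (*-monoʳ-≤ h x≤s) hs≤r)) ⟩
    z₀ * P * (Q * (r * r + h * x * r + h * x * (h * x)))
      ≤⟨ *-monoʳ-≤ (z₀ * P) (*-monoʳ-≤ Q (+-monoʳ-≤ (r * r + h * x * r) (*-monoʳ-≤ (h * x) (*-monoʳ-≤ h x≤s)))) ⟩
    z₀ * P * (Q * (r * r + h * x * r + h * x * (h * s))) ≡⟨ e₄ z₀ P Q r (h * x) (h * s) ⟩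
    P * Q * (z₀ * (r * r + h * x * (r + h * s)))  ∎)
    where
    open ≤-Reasoning
    s = length ys
    x = c τ ys
    y = d τ ys
    z₀ = z τ u B
    z₁ = z τ (u + s) B′
    P = r ^ (g * s)
    Q = r ^ (h * x)
    x≤s : x ≤ s
    x≤s = ΣL-length (λ v → ⟦⟧≤1 (X τ v)) ys
    cB : c τ B ≡ x + c τ B′
    cB = trans (ΣL-↭ _ p) (ΣL-++ _ ys B′)
    dB : d τ B ≡ y + d τ B′
    dB = trans (ΣL-↭ _ p) (ΣL-++ _ ys B′)
    lB : length B ≡ s + length B′
    lB = trans (↭.↭-length p) (List.length-++ ys)
    relate : z₁ * (suc r ^ (g * s) * Q) ≡ z₀ * (suc r ^ (h * x) * P)
    relate = trans (e₅ (suc r ^ a₁) (r ^ b₁) (suc r ^ (g * s)) Q) (trans (cong₂ _*_ up low)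
      (sym (e₅ (suc r ^ a₀) (r ^ b₀) (suc r ^ (h * x)) P)))
      where
      a₁ = g * length B′ + h * (u + s) + h * d τ B′
      b₁ = h * c τ B′ + g * (u + s)
      a₀ = g * length B + h * u + h * d τ B
      b₀ = h * c τ B + g * u
      e₅ : ∀ a b p q → a * b * (p * q) ≡ (a * p) * (b * q)
      e₅ = solve-∀
      up : suc r ^ a₁ * suc r ^ (g * s) ≡ suc r ^ a₀ * suc r ^ (h * x)
      up = trans (sym (^-distribˡ-+-* (suc r) a₁ (g * s))) (trans (cong (suc r ^_) ex) (^-distribˡ-+-* (suc r) a₀ (h * x)))
        where
        f : ∀ g h m u s x y d → g * m + h * (u + (x + y)) + h * d + g * s ≡ g * (s + m) + h * u + h * (y + d) + h * x
        f = solve-∀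
        ex : a₁ + g * s ≡ a₀ + h * x
        ex = trans (cong (λ t → g * length B′ + h * (u + t) + h * d τ B′ + g * s) (sym (c+d τ ys)))
          (trans (f g h (length B′) u s x y (d τ B′)) (cong₂ (λ m d → g * m + h * u + h * d + h * x) (sym lB) (sym dB)))
      low : r ^ b₁ * Q ≡ r ^ b₀ * P
      low = trans (sym (^-distribˡ-+-* r b₁ (h * x))) (trans (cong (r ^_) ex) (^-distribˡ-+-* r b₀ (g * s)))
        where
        f : ∀ g h c u s x → h * c + g * (u + s) + h * x ≡ h * (x + c) + g * u + g * s
        f = solve-∀
        ex : b₁ + h * x ≡ b₀ + g * s
        ex = trans (f g h (c τ B′) u s x) (cong (λ c → h * c + g * u + g * s) (sym cB))
    e₁ : ∀ P Q z r t → P * Q * (z * (r * t)) ≡ z * Q * r * (P * t)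
    e₁ = solve-∀
    e₂ : ∀ z Q r b → z * Q * r * (b * r) ≡ r * r * (z * (b * Q))
    e₂ = solve-∀
    e₃ : ∀ r z b P → r * r * (z * (b * P)) ≡ z * P * (r * r * b)
    e₃ = solve-∀
    e₄ : ∀ z P Q r a b → z * P * (Q * (r * r + a * r + a * b)) ≡ P * Q * (z * (r * r + a * (r + b)))
    e₄ = solve-∀

  Z-decay : ∀ u B B′ ys → B ↭ ys ++ B′ → h * length ys ≤ r →
    Z (u + length ys) B′ * (r * (r + g * length ys)) ≤ r * r * Z u B + h * (r + h * length ys) * ΣL (φ u B) ys
  Z-decay u B B′ ys p hs≤r = begin
    Z (u + s) B′ * (r * (r + g * s))                        ≡⟨ sym (sum-*ʳ _ (λ τ → z τ (u + s) B′)) ⟩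
    sum (λ τ → z τ (u + s) B′ * (r * (r + g * s)))          ≤⟨ sum-mono (λ τ → z-decay τ u B B′ ys p hs≤r) ⟩
    sum (λ τ → z τ u B * (r * r + h * c τ ys * (r + h * s))) ≡⟨ sum-cong (λ τ → e (z τ u B) r h (c τ ys) (r + h * s)) ⟩
    sum (λ τ → r * r * z τ u B + h * (r + h * s) * (z τ u B * c τ ys)) ≡⟨ sum-+ (λ τ → r * r * z τ u B) _ ⟩
    sum (λ τ → r * r * z τ u B) + sum (λ τ → h * (r + h * s) * (z τ u B * c τ ys))
      ≡⟨ cong₂ _+_ (sum-*ˡ (r * r) (λ τ → z τ u B))
           (trans (sum-*ˡ (h * (r + h * s)) (λ τ → z τ u B * c τ ys)) (cong (h * (r + h * s) *_) (sym (ΣL-φ u B ys)))) ⟩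
    r * r * Z u B + h * (r + h * s) * ΣL (φ u B) ys ∎
    where
    open ≤-Reasoning
    s = length ys
    e : ∀ z r h c t → z * (r * r + h * c * t) ≡ r * r * z + h * t * (z * c)
    e = solve-∀

  z-when-rich : ∀ τ u B y → h * c τ B ≡ g * length B + y → z τ u B * suc r ^ y ≡ D (u + length B) * r ^ y
  z-when-rich τ u B y e = begin
    suc r ^ a * r ^ b * suc r ^ y             ≡⟨ f₁ (suc r ^ a) (r ^ b) (suc r ^ y) ⟩
    suc r ^ a * suc r ^ y * r ^ b             ≡⟨ cong₂ _*_ (sym (^-distribˡ-+-* (suc r) a y)) (cong (r ^_) eb) ⟩
    suc r ^ (a + y) * r ^ (g * (u + length B) + y) ≡⟨ cong₂ _*_ (cong (suc r ^_) ea) (^-distribˡ-+-* r (g * (u + length B)) y) ⟩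
    suc r ^ (h * (u + length B)) * (r ^ (g * (u + length B)) * r ^ y) ≡⟨ sym (*-assoc (suc r ^ (h * (u + length B))) _ _) ⟩
    D (u + length B) * r ^ y                  ∎
    where
    open ≡-Reasoning
    a = g * length B + h * u + h * d τ B
    b = h * c τ B + g * u
    f₁ : ∀ x y w → x * y * w ≡ x * w * y
    f₁ = solve-∀
    eb : b ≡ g * (u + length B) + y
    eb = trans (cong (_+ g * u) e) (f g (length B) u y)
      where f : ∀ g m u y → g * m + y + g * u ≡ g * (u + m) + y
            f = solve-∀
    ea : a + y ≡ h * (u + length B)
    ea = trans (f₂ (g * length B) (h * u) (h * d τ B) y) (trans (cong (_+ (h * u + h * d τ B)) (sym e))
      (trans (f₃ h u (c τ B) (d τ B)) (cong (λ m → h * (u + m)) (c+d τ B))))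
      where f₂ : ∀ g u d y → g + u + d + y ≡ g + y + (u + d)
            f₂ = solve-∀
            f₃ : ∀ h u c d → h * c + (h * u + h * d) ≡ h * (u + (c + d))
            f₃ = solve-∀

  z-when-poor : ∀ τ u B y → g * length B ≡ h * c τ B + y → z τ u B * r ^ y ≡ D (u + length B) * suc r ^ y
  z-when-poor τ u B y e = begin
    suc r ^ a * r ^ b * r ^ y                 ≡⟨ *-assoc (suc r ^ a) _ _ ⟩
    suc r ^ a * (r ^ b * r ^ y)               ≡⟨ cong₂ _*_ (cong (suc r ^_) ea) (trans (sym (^-distribˡ-+-* r b y)) (cong (r ^_) eb)) ⟩
    suc r ^ (h * (u + length B) + y) * r ^ (g * (u + length B)) ≡⟨ cong (_* r ^ (g * (u + length B))) (^-distribˡ-+-* (suc r) (h * (u + length B)) y) ⟩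
    suc r ^ (h * (u + length B)) * suc r ^ y * r ^ (g * (u + length B)) ≡⟨ f₁ (suc r ^ (h * (u + length B))) (suc r ^ y) _ ⟩
    D (u + length B) * suc r ^ y              ∎
    where
    open ≡-Reasoning
    a = g * length B + h * u + h * d τ B
    b = h * c τ B + g * u
    f₁ : ∀ x y w → x * y * w ≡ x * w * y
    f₁ = solve-∀
    eb : b + y ≡ g * (u + length B)
    eb = trans (f (h * c τ B) (g * u) y) (trans (cong (_+ g * u) (sym e)) (f′ g (length B) u))
      where f : ∀ c u y → c + u + y ≡ c + y + u
            f = solve-∀
            f′ : ∀ g m u → g * m + g * u ≡ g * (u + m)
            f′ = solve-∀
    ea : a ≡ h * (u + length B) + y
    ea = trans (cong (λ t → t + h * u + h * d τ B) e) (trans (f h (c τ B) u (d τ B) y) (cong (λ m → h * (u + m) + y) (c+d τ B)))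
      where f : ∀ h c u d y → h * c + y + h * u + h * d ≡ h * (u + (c + d)) + y
            f = solve-∀

  z-initial : ∀ τ u B → g * length B ≤ h * c τ B → z τ u B ≤ D (u + length B)
  z-initial τ u B le = let y , e = slack le in *-cancelʳ-≤ _ _ (suc r ^ y) {{m^n≢0 (suc r) y}}
    (≤-trans (≤-reflexive (z-when-rich τ u B y e)) (*-monoʳ-≤ (D (u + length B)) (^-monoˡ-≤ y (n≤1+n r))))

  -- Only tests with an excess y = h c - g m need care. Their term is D (r / (r + 1)) ^ y, and y
  -- times this is at most r D by Bernoulli: a large excess is outweighed by the smallness of the
  -- term.
  z-weight : ∀ τ u B → h * (z τ u B * c τ B) ≤ g * length B * z τ u B + r * D (u + length B)
  z-weight τ u B with ≤-total (h * c τ B) (g * length B)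
  ... | inj₁ le = begin
    h * (z τ u B * c τ B)            ≡⟨ e h (z τ u B) (c τ B) ⟩
    h * c τ B * z τ u B              ≤⟨ *-monoˡ-≤ (z τ u B) le ⟩
    g * length B * z τ u B           ≤⟨ m≤m+n _ _ ⟩
    g * length B * z τ u B + r * D (u + length B) ∎
    where open ≤-Reasoning
          e : ∀ h z c → h * (z * c) ≡ h * c * z
          e = solve-∀
  ... | inj₂ ge = begin
    h * (z τ u B * c τ B)            ≡⟨ e h (z τ u B) (c τ B) ⟩
    h * c τ B * z τ u B              ≡⟨ trans (cong (_* z τ u B) (proj₂ (slack ge))) (*-distribʳ-+ (z τ u B) (g * length B) y) ⟩
    g * length B * z τ u B + y * z τ u B ≤⟨ +-monoʳ-≤ (g * length B * z τ u B) zy ⟩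
    g * length B * z τ u B + r * D (u + length B) ∎
    where
    open ≤-Reasoning
    e : ∀ h z c → h * (z * c) ≡ h * c * z
    e = solve-∀
    y = proj₁ (slack ge)
    zy : y * z τ u B ≤ r * D (u + length B)
    zy = *-cancelʳ-≤ _ _ (suc r ^ y) {{m^n≢0 (suc r) y}} (begin
      y * z τ u B * suc r ^ y          ≡⟨ trans (*-assoc y _ _) (cong (y *_) (z-when-rich τ u B y (proj₂ (slack ge)))) ⟩
      y * (D (u + length B) * r ^ y)   ≡⟨ e′ y (D (u + length B)) (r ^ y) ⟩
      D (u + length B) * (r ^ y * y)   ≤⟨ *-monoʳ-≤ (D (u + length B)) (≤-trans (*-monoʳ-≤ (r ^ y) (m≤n+m y r)) (pow-lower r y)) ⟩
      D (u + length B) * (suc r ^ y * r) ≡⟨ e″ (D (u + length B)) (suc r ^ y) r ⟩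
      r * D (u + length B) * suc r ^ y ∎)
      where e′ : ∀ y d x → y * (d * x) ≡ d * (x * y)
            e′ = solve-∀
            e″ : ∀ d x r → d * (x * r) ≡ r * d * x
            e″ = solve-∀

  -- A uniform vertex of the pool thus has price at most g Z / h, up to the tests in excess, which
  -- balances the decrease of g m when the pool shrinks.
  Σφ : ∀ u B → h * ΣL (φ u B) B ≤ g * length B * Z u B + r * (N * D (u + length B))
  Σφ u B = begin
    h * ΣL (φ u B) B                          ≡⟨ trans (cong (h *_) (ΣL-φ u B B)) (sym (sum-*ˡ h (λ τ → z τ u B * c τ B))) ⟩
    sum (λ τ → h * (z τ u B * c τ B))         ≤⟨ sum-mono (λ τ → z-weight τ u B) ⟩
    sum (λ τ → g * length B * z τ u B + r * D (u + length B)) ≡⟨ sum-+ (λ τ → g * length B * z τ u B) _ ⟩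
    sum (λ τ → g * length B * z τ u B) + sum {N} (λ τ → r * D (u + length B))
      ≡⟨ cong₂ _+_ (sum-*ˡ (g * length B) (λ τ → z τ u B)) (trans (sum-const N _) (e N r (D (u + length B)))) ⟩
    g * length B * Z u B + r * (N * D (u + length B)) ∎
    where
    open ≤-Reasoning
    e : ∀ N r D → N * (r * D) ≡ r * (N * D)
    e = solve-∀

  private
    -- Inserting the average price cancels the main term g s b / r. There remain three errors in b,
    -- one from the 1 / Q of the embedding and two of second order, and two errors in e; each is at
    -- most h s / (Q r) times b or e, whence the 3.
    decay-arith : ∀ Q m s a b e S k → 1 ≤ h → h * s ≤ r → Q * (g * s) ≤ r → Q * r ≤ m → 0 < m →
      a * (r * (r + g * s)) ≤ r * r * b + h * (r + h * s) * k → h * S ≤ g * m * b + r * e →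
      Q * m * k ≤ Q * s * S + s * m * b →
      Q * r * (a + e) ≤ (Q * r + 3 * (h * s)) * (b + e)
    decay-arith Q m s a b e S k 1≤h hs≤r Qgs≤r Qr≤m 0<m h₁ h₂ h₃ =
      ≤-trans (≤-reflexive (*-distribˡ-+ (Q * r) a e)) (≤-trans (+-monoˡ-≤ (Q * r * e)
        (*-cancelˡ-≤ (m * (r + g * s)) {{m*n≢0 m (r + g * s) {{>-nonZero 0<m}} {{>-nonZero (≤-trans 0<r (m≤m+n r _))}}}} main))
        (≤-reflexive (f₀ Q r (h * s) b e)))
      where
      open ≤-Reasoning
      f₀ : ∀ Q r x b e → Q * r * b + 3 * x * (b + e) + Q * r * e ≡ (Q * r + 3 * x) * (b + e)
      f₀ = solve-∀
      s≤r : s ≤ r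
      s≤r = ≤-trans (m≤n*m s h {{>-nonZero 1≤h}}) hs≤r
      main : m * (r + g * s) * (Q * r * a) ≤ m * (r + g * s) * (Q * r * b + 3 * (h * s) * (b + e))
      main = begin
        m * (r + g * s) * (Q * r * a) ≡⟨ f₁ m r (g * s) Q a ⟩
        Q * m * (a * (r * (r + g * s))) ≤⟨ *-monoʳ-≤ (Q * m) h₁ ⟩
        Q * m * (r * r * b + h * (r + h * s) * k) ≡⟨ f₂ Q m r b h (r + h * s) k ⟩
        Q * m * (r * r * b) + (r + h * s) * (h * (Q * m * k))
          ≤⟨ +-monoʳ-≤ (Q * m * (r * r * b)) (*-monoʳ-≤ (r + h * s) (*-monoʳ-≤ h h₃)) ⟩
        Q * m * (r * r * b) + (r + h * s) * (h * (Q * s * S + s * m * b)) ≡⟨ f₃ (Q * m * (r * r * b)) (r + h * s) h Q s S m b ⟩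
        Q * m * (r * r * b) + (r + h * s) * (Q * s * (h * S) + h * s * m * b)
          ≤⟨ +-monoʳ-≤ (Q * m * (r * r * b)) (*-monoʳ-≤ (r + h * s) (+-monoˡ-≤ (h * s * m * b) (*-monoʳ-≤ (Q * s) h₂))) ⟩
        Q * m * (r * r * b) + (r + h * s) * (Q * s * (g * m * b + r * e) + h * s * m * b)
          ≡⟨ f₄ Q m r b (h * s) s g e ⟩
        Q * m * (r * r * b) + Q * (g * s) * (m * r * b) + h * s * m * r * b
          + (Q * (g * s) * (h * s * m * b) + h * s * (h * s * m * b)) + (Q * r * (s * r * e) + Q * r * (h * s * s * e))
          ≤⟨ +-mono-≤ (+-monoʳ-≤ (Q * m * (r * r * b) + Q * (g * s) * (m * r * b) + h * s * m * r * b)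
               (+-mono-≤ (*-monoˡ-≤ (h * s * m * b) Qgs≤r) (*-monoˡ-≤ (h * s * m * b) hs≤r)))
               (+-mono-≤ (*-mono-≤ Qr≤m (*-monoˡ-≤ e (*-monoˡ-≤ r (m≤n*m s h {{>-nonZero 1≤h}}))))
                 (*-mono-≤ Qr≤m (*-monoˡ-≤ e (*-monoʳ-≤ (h * s) s≤r)))) ⟩
        Q * m * (r * r * b) + Q * (g * s) * (m * r * b) + h * s * m * r * b
          + (r * (h * s * m * b) + r * (h * s * m * b)) + (m * (h * s * r * e) + m * (h * s * r * e))
          ≤⟨ ≤-by (h * s * m * r * e + 3 * (h * s) * m * (g * s) * (b + e)) (f₅ Q m r b (h * s) (g * s) e) ⟩
        m * (r + g * s) * (Q * r * b + 3 * (h * s) * (b + e)) ∎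
        where
        f₁ : ∀ m r t Q a → m * (r + t) * (Q * r * a) ≡ Q * m * (a * (r * (r + t)))
        f₁ = solve-∀
        f₂ : ∀ Q m r b h t k → Q * m * (r * r * b + h * t * k) ≡ Q * m * (r * r * b) + t * (h * (Q * m * k))
        f₂ = solve-∀
        f₃ : ∀ A t h Q s S m b → A + t * (h * (Q * s * S + s * m * b)) ≡ A + t * (Q * s * (h * S) + h * s * m * b)
        f₃ = solve-∀
        f₄ : ∀ Q m r b x s g e → Q * m * (r * r * b) + (r + x) * (Q * s * (g * m * b + r * e) + x * m * b) ≡
          Q * m * (r * r * b) + Q * (g * s) * (m * r * b) + x * m * r * b
          + (Q * (g * s) * (x * m * b) + x * (x * m * b)) + (Q * r * (s * r * e) + Q * r * (x * s * e))
        f₄ = solve-∀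
        f₅ : ∀ Q m r b x t e → m * (r + t) * (Q * r * b + 3 * x * (b + e)) ≡
          Q * m * (r * r * b) + Q * t * (m * r * b) + x * m * r * b
          + (r * (x * m * b) + r * (x * m * b)) + (m * (x * r * e) + m * (x * r * e)) + (x * m * r * e + 3 * x * m * t * (b + e))
        f₅ = solve-∀

  -- the whole potential, with an additive term that absorbs the tests with g m ≤ h c
  Ψ : ℕ → List V → ℕ
  Ψ u B = Z u B + N * D (u + length B)

  -- The factor 1 + 3hs / (Q r) is weakened to a power of 1 + 1 / (Q r), so that the factors of all
  -- pieces multiply by adding exponents.
  Ψ-decay : ∀ Q .{{_ : NonZero Q}} u B B′ ys → B ↭ ys ++ B′ → 1 ≤ h → h * length ys ≤ r → Q * (g * length ys) ≤ r →
    Q * r ≤ length B → 0 < length B →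
    Q * length B * ΣL (φ u B) ys ≤ Q * length ys * ΣL (φ u B) B + length ys * length B * Z u B →
    Ψ (u + length ys) B′ * (Q * r) ^ (3 * (h * length ys)) ≤ Ψ u B * suc (Q * r) ^ (3 * (h * length ys))
  Ψ-decay Q {{Q≢0}} u B B′ ys p 1≤h hs≤r Qgs≤r Qr≤m 0<m cost = *-cancelʳ-≤ _ _ (Q * r) {{m*n≢0 Q r}} (begin
    Ψ₁ * (Q * r) ^ k * (Q * r)      ≡⟨ e₁ Ψ₁ ((Q * r) ^ k) (Q * r) ⟩
    (Q * r) ^ k * (Q * r * Ψ₁)      ≤⟨ *-monoʳ-≤ ((Q * r) ^ k) decayed ⟩
    (Q * r) ^ k * ((Q * r + k) * Ψ₀) ≡⟨ sym (*-assoc ((Q * r) ^ k) _ _) ⟩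
    (Q * r) ^ k * (Q * r + k) * Ψ₀  ≤⟨ *-monoˡ-≤ Ψ₀ (pow-lower (Q * r) k) ⟩
    suc (Q * r) ^ k * (Q * r) * Ψ₀  ≡⟨ e₂ (suc (Q * r) ^ k) (Q * r) Ψ₀ ⟩
    Ψ₀ * suc (Q * r) ^ k * (Q * r)  ∎)
    where
    open ≤-Reasoning
    s = length ys
    k = 3 * (h * s)
    Ψ₀ = Ψ u B
    Ψ₁ = Ψ (u + s) B′
    e₁ : ∀ a b c → a * b * c ≡ b * (c * a)
    e₁ = solve-∀
    e₂ : ∀ a b c → a * b * c ≡ c * a * b
    e₂ = solve-∀
    same : u + s + length B′ ≡ u + length B
    same = trans (+-assoc u s _) (cong (u +_) (sym (trans (↭.↭-length p) (List.length-++ ys))))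
    decayed : Q * r * Ψ₁ ≤ (Q * r + k) * Ψ₀
    decayed = subst (λ t → Q * r * (Z (u + s) B′ + N * D t) ≤ (Q * r + k) * Ψ₀) (sym same)
      (decay-arith Q (length B) s (Z (u + s) B′) (Z u B) (N * D (u + length B)) (ΣL (φ u B) B) (ΣL (φ u B) ys)
        1≤h hs≤r Qgs≤r Qr≤m 0<m (Z-decay u B B′ ys p hs≤r) (Σφ u B) cost)

  Ψ-initial : ∀ u B → (∀ τ → g * length B ≤ h * c τ B) → Ψ u B ≤ 2 * N * D (u + length B)
  Ψ-initial u B rich = begin
    Z u B + N * D (u + length B) ≤⟨ +-monoˡ-≤ _ (≤-trans (sum-mono (λ τ → z-initial τ u B (rich τ))) (≤-reflexive (sum-const N _))) ⟩
    N * D (u + length B) + N * D (u + length B) ≡⟨ e N (D (u + length B)) ⟩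
    2 * N * D (u + length B) ∎
    where
    open ≤-Reasoning
    e : ∀ N D → N * D + N * D ≡ 2 * N * D
    e = solve-∀

  -- A test with deficit at least `Y` would alone contribute D (1 + 1/r) ^ Y or more, whereas the
  -- whole of `Ψ` is at most 2 N D (1 + 1/ρ) ^ k₀.
  Ψ-rich : ∀ u B Y ρ k k₀ → 0 < ρ → k ≤ k₀ → Ψ u B * ρ ^ k ≤ 2 * N * D (u + length B) * suc ρ ^ k →
    2 * N * (r ^ Y * suc ρ ^ k₀) < suc r ^ Y * ρ ^ k₀ → ∀ τ → g * length B < h * c τ B + Y
  Ψ-rich u B Y ρ k k₀ 0<ρ k≤k₀ grown gap τ with g * length B <? h * c τ B + Y
  ... | yes lt = lt
  ... | no ge = ⊥-elim (<-irrefl refl (<-≤-trans gap (*-cancelˡ-≤ (Dn * (suc r ^ y′ * ρ ^ k)) {{nz}} (begin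
    Dn * (suc r ^ y′ * ρ ^ k) * (suc r ^ Y * ρ ^ k₀)
      ≡⟨ e₁ Dn (suc r ^ y′) (ρ ^ k) (suc r ^ Y) (ρ ^ k₀) ⟩
    Dn * (suc r ^ Y * suc r ^ y′) * ρ ^ k * ρ ^ k₀
      ≡⟨ cong (λ x → Dn * x * ρ ^ k * ρ ^ k₀) (sym (trans (cong (suc r ^_) ey) (^-distribˡ-+-* (suc r) Y y′))) ⟩
    Dn * suc r ^ y * ρ ^ k * ρ ^ k₀
      ≡⟨ cong (λ x → x * ρ ^ k * ρ ^ k₀) (sym (z-when-poor τ u B y (proj₂ sl))) ⟩
    z τ u B * r ^ y * ρ ^ k * ρ ^ k₀
      ≤⟨ *-monoˡ-≤ (ρ ^ k₀) (*-monoˡ-≤ (ρ ^ k) (*-monoˡ-≤ (r ^ y) (≤-trans (term≤sum (λ τ → z τ u B) τ) (m≤m+n _ _)))) ⟩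
    Ψ u B * r ^ y * ρ ^ k * ρ ^ k₀ ≡⟨ e₂ (Ψ u B) (r ^ y) (ρ ^ k) (ρ ^ k₀) ⟩
    Ψ u B * ρ ^ k * (r ^ y * ρ ^ k₀) ≤⟨ *-monoˡ-≤ (r ^ y * ρ ^ k₀) grown ⟩
    2 * N * Dn * suc ρ ^ k * (r ^ y * ρ ^ k₀)
      ≡⟨ trans (cong₂ (λ a b → 2 * N * Dn * suc ρ ^ k * (a * b))
           (trans (cong (r ^_) ey) (^-distribˡ-+-* r Y y′)) (trans (cong (ρ ^_) ek) (^-distribˡ-+-* ρ k k′)))
           (e₃ N Dn (suc ρ ^ k) (r ^ Y) (r ^ y′) (ρ ^ k) (ρ ^ k′)) ⟩
    Dn * (r ^ y′ * ρ ^ k) * (2 * N * (r ^ Y * (suc ρ ^ k * ρ ^ k′)))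
      ≤⟨ *-mono-≤ (*-monoʳ-≤ Dn (*-monoˡ-≤ (ρ ^ k) (^-monoˡ-≤ y′ (n≤1+n r))))
           (*-monoʳ-≤ (2 * N) (*-monoʳ-≤ (r ^ Y) (*-monoʳ-≤ (suc ρ ^ k) (^-monoˡ-≤ k′ (n≤1+n ρ))))) ⟩
    Dn * (suc r ^ y′ * ρ ^ k) * (2 * N * (r ^ Y * (suc ρ ^ k * suc ρ ^ k′)))
      ≡⟨ cong (λ x → Dn * (suc r ^ y′ * ρ ^ k) * (2 * N * (r ^ Y * x))) (sym (trans (cong (suc ρ ^_) ek) (^-distribˡ-+-* (suc ρ) k k′))) ⟩
    Dn * (suc r ^ y′ * ρ ^ k) * (2 * N * (r ^ Y * suc ρ ^ k₀)) ∎))))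
    where
    open ≤-Reasoning
    Dn = D (u + length B)
    Ygap : ∃ λ y′ → g * length B ≡ h * c τ B + Y + y′
    Ygap = slack (≮⇒≥ ge)
    y′ = proj₁ Ygap
    sl : ∃ λ y → g * length B ≡ h * c τ B + y
    sl = Y + y′ , trans (proj₂ Ygap) (+-assoc (h * c τ B) Y y′)
    y = proj₁ sl
    ey : y ≡ Y + y′
    ey = refl
    k′ = proj₁ (slack k≤k₀)
    ek : k₀ ≡ k + k′
    ek = proj₂ (slack k≤k₀)
    nz : NonZero (Dn * (suc r ^ y′ * ρ ^ k))
    nz = m*n≢0 Dn _ {{m*n≢0 (suc r ^ (h * (u + length B))) _ {{m^n≢0 (suc r) (h * (u + length B))}} {{m^n≢0 r (g * (u + length B))}}}}
      {{m*n≢0 (suc r ^ y′) (ρ ^ k) {{m^n≢0 (suc r) y′}} {{m^n≢0 ρ k {{>-nonZero 0<ρ}}}}}}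
    e₁ : ∀ D a b c d → D * (a * b) * (c * d) ≡ D * (c * a) * b * d
    e₁ = solve-∀
    e₂ : ∀ P a b c → P * a * b * c ≡ P * b * (a * c)
    e₂ = solve-∀
    e₃ : ∀ N D a b c d e → 2 * N * D * a * (b * c * (d * e)) ≡ D * (c * d) * (2 * N * (b * (a * e)))
    e₃ = solve-∀

-- Embedding the pieces of the tree

module MainLoop {n : ℕ} (G : Digraph n) where

  open Embed G public

  Piece : Set
  Piece = V × Bool × Tree V

  pe : List Piece → List Edge
  pe []                 = []
  pe ((y , s , t) ∷ ps) = fe y ((s , t) ∷ []) ++ pe ps

  Par-split : ∀ {ds} es {es′} → Par ds (es ++ es′) → Par (map dst es ++ ds) es′
  Par-split []       p       = p
  Par-split {ds} (e ∷ es) (_ ∷ p) = Par-mono move (Par-split es p)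
    where
    move : ∀ {z} → z ∈ map dst es ++ dst e ∷ ds → z ∈ dst e ∷ map dst es ++ ds
    move z∈ = ∈-resp-↭ (↭.shift (dst e) (map dst es) ds) z∈

  -- the edges de are embedded, the edges re are not
  record Base (de re : List Edge) : Set where
    field
      f     : V → V
      ds B  : List V
      im    : Images f ds B
      par   : Par ds re
      uniq  : Unique (map dst re ++ ds)
      len   : length re ≡ length B
      sat   : All (Sat f) de
      ends  : Ends ds de

    uds : Unique ds
    uds = Unique-++ʳ (map dst re) uniq

    uB : Unique B
    uB = Unique-++ʳ (map f ds) (Images-unique im)

  -- `loc` speaks of embedded and open edges together, so it survives the passage of edges from `re`
  -- to `de`.
  record Absorbing {de re} (S : Base de re) (k : ℕ) : Set where
    open Base S
    field
      abs    : List Absorber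
      loc    : All (Local (de ++ re)) abs
      uabs   : Unique (concatMap Absorber.labs abs)
      sub    : ∀ {z} → z ∈ concatMap Absorber.labs abs → z ∈ ds
      enough : ∀ r a s → k ≤ hits f r a s abs

  Local-++⁻ : ∀ {es es′} A → Local (es ++ es′) A → Local es A × Local es′ A
  Local-++⁻ {es} (absorber p q sq cs) l = All.++⁻ es l

  finish : ∀ {de re k} (S : Base de re) → Absorbing S k → length (Base.B S) ≤ k → Completion (de ++ re)
  finish {re = re} S ab le = absorb-tail re abs uds im par uniq len sat ends
      (All.map (λ {A} → Local-++⁻ A) loc) uabs sub (λ r a s → ≤-trans (≤-reflexive len) (≤-trans le (enough r a s)))
    where open Base S
          open Absorbing ab

  module _ {de : List Edge} (es : List Edge) {re : List Edge} (S : Base de (es ++ re)) where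
    open Base S

    base-uniq : Unique (map dst re ++ (map dst es ++ ds))
    base-uniq = Unique-↭ (↭-trans (↭-reflexive (trans (cong (_++ ds) (List.map-++ dst es re)) (List.++-assoc (map dst es) (map dst re) ds)))
      (↭.shifts (map dst es) (map dst re))) uniq

    advance : Placed f ds B es → Base (de ++ es) re
    advance P = record
      { f = f′ ; ds = map dst es ++ ds ; B = B′
      ; im = images
      ; par = Par-split es par
      ; uniq = base-uniq
      ; len = +-cancelˡ-≡ (length es) _ _ (trans (sym (List.length-++ es)) (trans len
                (trans (↭.↭-length split) (trans (List.length-++ ys) (cong (_+ length B′) placed)))))
      ; sat = All.++⁺ (Sat-cong agree ends sat) (Placed.sat P)
      ; ends = All.++⁺ (All.map (λ (a , b) → ∈-++⁺ʳ (map dst es) a , ∈-++⁺ʳ (map dst es) b) ends)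
          (Par-Ends (Par-++ˡ es par) λ { (inj₁ z∈) → ∈-++⁺ʳ (map dst es) z∈ ; (inj₂ z∈) → ∈-++⁺ˡ z∈ })
      }
      where
      open Placed P hiding (sat)
      Par-++ˡ : ∀ {ds} es {es′} → Par ds (es ++ es′) → Par ds es
      Par-++ˡ []       p       = []
      Par-++ˡ (e ∷ es) (y ∷ p) = y ∷ Par-++ˡ es p

    advance-absorbing : ∀ {k} (P : Placed f ds B es) → Absorbing S k → Absorbing (advance P) k
    advance-absorbing {k} P ab = record
      { abs = abs
      ; loc = subst (λ E → All (Local E) abs) (sym (List.++-assoc de es re)) loc
      ; uabs = uabs
      ; sub = λ z∈ → ∈-++⁺ʳ (map dst es) (sub z∈)
      ; enough = λ r a s → ≤-trans (enough r a s) (≤-reflexive (sym (hits-cong r a s abs (λ z∈ → agree (sub z∈)))))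
      }
      where open Absorbing ab
            open Placed P

  signs : Fin 2 → Bool
  signs zero    = true
  signs (suc _) = false

  test : Fin (n * 2) → V → Bool
  test τ v = Eg (signs (proj₂ (remQuot {n} 2 τ))) (proj₁ (remQuot {n} 2 τ)) v

  test-surj : ∀ s w → ∃ λ τ → ∀ v → test τ v ≡ Eg s w v
  test-surj s w = combine w (c s) , λ v →
      trans (cong (λ (a , b) → Eg (signs b) a v) (Fin.remQuot-combine {n} {2} w (c s))) (cong (λ b → Eg b w v) (sc s))
    where
    c : Bool → Fin 2
    c true  = zero
    c false = suc zero
    sc : ∀ s → signs (c s) ≡ s
    sc true  = refl
    sc false = refl

  record Params (q κ hh Q r p g₀ Y : ℕ) : Set where
    b = 4 * q
    C = 4 * q * b + b
    bad = C * p
    -- The potential guards the density g / h = 1/2 + 3/(2q). A deficit of `Y`, which is at most the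
    -- size of the pool, still leaves 1/2 + 1/q, the density in `RichPool q`.
    g = q + 3
    h = 2 * q
    field
      0<q   : 0 < q
      0<r   : 0 < r
      0<Q   : 0 < Q
      κ≡    : suc κ ≡ b * b * q
      2q≤   : 2 * q ≤ g₀
      κ^≤   : 8 * Q * κ ^ hh ≤ suc κ ^ hh
      bad≤  : 8 * Q * (p * bad) ≤ g₀ * b
      bad<  : bad < g₀ * b
      hp≤   : h * p ≤ r
      Qgp≤  : Q * (g * p) ≤ r
      Qr≤   : Q * r ≤ g₀
      Y≤    : Y ≤ g₀
      gap   : 2 * (n * 2) * (r ^ Y * suc (Q * r) ^ (3 * (h * n))) < suc r ^ Y * (Q * r) ^ (3 * (h * n))

  module Loop {q κ hh Q r p g₀ Y : ℕ} (params : Params q κ hh Q r p g₀ Y) where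

    open Params params

    GoodPiece : Piece → Set
    GoodPiece (y , s , node x cs) =
      suc (size cs) ≤ p × 8 * Q ≤ suc (size cs) × 8 * Q * levels (double hh) cs ≤ suc (size cs)

    open Potential test g h r 0<r

    -- `S` counts the vertices placed in pieces. The starting value is that of `Ψ-initial`, with two
    -- tests for each vertex.
    Grown : List V → List V → Set
    Grown ds B = ∃ λ S → S ≤ length ds ×
      Ψ (length ds) B * (Q * r) ^ (3 * (h * S)) ≤ 2 * (n * 2) * D n * suc (Q * r) ^ (3 * (h * S))

    ρ>0 : 0 < Q * r
    ρ>0 = *-mono-≤ 0<Q 0<r

    grown-rich : ∀ {f ds B} → Images f ds B → Grown ds B → g₀ ≤ length B → RichPool q B
    grown-rich {f} {ds} {B} im (S , S≤ , gr) large s w with test-surj s w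
    ... | τ , eq = begin
      (q + 2) * length B       ≤⟨ +-cancelʳ-≤ (length B) _ _ (begin
        (q + 2) * length B + length B ≡⟨ e q (length B) ⟩
        g * length B                  ≤⟨ <⇒≤ (Ψ-rich (length ds) B Y (Q * r) (3 * (h * S)) (3 * (h * n)) ρ>0
            (*-monoʳ-≤ 3 (*-monoʳ-≤ h (≤-trans S≤ (m+n≤o⇒m≤o (length ds) (≤-reflexive (Images-length im))))))
            (subst (λ t → Ψ (length ds) B * (Q * r) ^ (3 * (h * S)) ≤ 2 * (n * 2) * D t * suc (Q * r) ^ (3 * (h * S)))
              (sym (Images-length im)) gr) gap τ) ⟩
        h * c τ B + Y                 ≤⟨ +-monoʳ-≤ (h * c τ B) (≤-trans Y≤ large) ⟩
        h * c τ B + length B          ∎) ⟩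
      h * c τ B                ≡⟨ cong (h *_) (ΣL-cong (λ v → cong ⟦_⟧ (eq v)) B) ⟩
      2 * q * cnt s w B        ∎
      where
      open ≤-Reasoning
      e : ∀ q m → (q + 2) * m + m ≡ (q + 3) * m
      e = solve-∀

    rich-positive : ∀ {B} → RichPool q B → 0 < length B → ∀ s w → 0 < cnt s w B
    rich-positive {B} rich 0<B s w with cnt s w B | rich s w
    ... | suc _ | _  = s≤s z≤n
    ... | zero  | le = ⊥-elim (<-irrefl refl (<-≤-trans (*-mono-< {0} {q + 2} {0} (≤-trans (s≤s z≤n) (m≤n+m 2 q)) 0<B)
                         (≤-trans le (≤-reflexive (*-zeroʳ (2 * q))))))

    module Advance {de : List Edge} {y : V} {s : Bool} {x : V} {cs : Forest V} {re : List Edge}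
      (St : Base de (fe y ((s , node x cs) ∷ []) ++ re)) (gr : Grown (Base.ds St) (Base.B St))
      (good : GoodPiece (y , s , node x cs)) (large : g₀ < length (Base.B St)) where

      open Base St

      private
        es = fe y ((s , node x cs) ∷ [])
        u = length ds
        m = length B
        rich : RichPool q B
        rich = grown-rich im gr (<⇒≤ large)
        0<m : 0 < m
        0<m = ≤-trans (s≤s z≤n) large
        -- Any free neighbour will do for the root of the piece: its price is one of the four errors
        -- in `embed-piece`.
        start : ∃ λ i → Eg s (f y) (lookup B i) ≡ true
        start = cnt⇒index s (f y) B (rich-positive {B} rich 0<m s (f y))
        i = proj₁ start
        size≤p : size cs ≤ p
        size≤p = ≤-trans (n≤1+n _) (proj₁ good)

        module Pl = Pool B q 0<q rich (≤-trans 2q≤ (<⇒≤ large))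

        emb : ∃ λ js → Emb Pl.E i cs js × Unique (i ∷ js) ×
          Q * m * (φ u B (lookup B i) + ΣL (φ u B ∘ lookup B) js) ≤ Q * suc (size cs) * ΣL (φ u B) B + suc (size cs) * m * Z u B
        emb = Pl.pool-embed cs i κ hh Q bad κ≡ (proj₁ (proj₂ good)) κ^≤ (proj₂ (proj₂ good))
          (≤-trans (*-monoʳ-≤ (8 * Q) (*-monoˡ-≤ bad size≤p)) (≤-trans bad≤ (*-monoˡ-≤ b (<⇒≤ large))))
          (<-≤-trans bad< (*-monoˡ-≤ b (<⇒≤ large)))
          (*-monoʳ-≤ C (proj₁ good))
          (φ u B) (Z u B) (φ≤Z u B)
        js = proj₁ emb

        y∈ : y ∈ ds
        y∈ with par
        ... | y∈ ∷ _ = y∈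

        pl : Σ (Placed f ds B es) λ P → Placed.ys P ≡ map (lookup B) (i ∷ js)
        pl = place-piece y s x cs i js im y∈ (Unique-++ʳ (map dst re) (base-uniq es St)) (proj₂ start)
               (proj₁ (proj₂ emb)) (proj₁ (proj₂ (proj₂ emb)))

      P : Placed f ds B es
      P = proj₁ pl

      private
        open Placed P using (B′; ys; split; placed)

        len-es : length es ≡ suc (size cs)
        len-es = trans (fe-length y ((s , node x cs) ∷ [])) (cong suc (+-identityʳ _))

        len-ys : length ys ≡ suc (size cs)
        len-ys = trans placed len-es

        cost : Q * m * ΣL (φ u B) ys ≤ Q * length ys * ΣL (φ u B) B + length ys * m * Z u B
        cost = subst₂ (λ a k → Q * m * a ≤ Q * k * ΣL (φ u B) B + k * m * Z u B)
          (sym (trans (cong (ΣL (φ u B)) (proj₂ pl)) (ΣL-map (φ u B) (lookup B) (i ∷ js)))) (sym len-ys)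
          (proj₂ (proj₂ (proj₂ emb)))

        ys≤p : length ys ≤ p
        ys≤p = ≤-trans (≤-reflexive len-ys) (proj₁ good)

        decay : Ψ (u + length ys) B′ * (Q * r) ^ (3 * (h * length ys)) ≤ Ψ u B * suc (Q * r) ^ (3 * (h * length ys))
        decay = Ψ-decay Q {{>-nonZero 0<Q}} u B B′ ys split (*-mono-≤ (s≤s {0} {1} z≤n) 0<q)
          (≤-trans (*-monoʳ-≤ h ys≤p) hp≤) (≤-trans (*-monoʳ-≤ Q (*-monoʳ-≤ g ys≤p)) Qgp≤)
          (≤-trans Qr≤ (<⇒≤ large)) 0<m cost

        u′ : u + length ys ≡ length (map dst es ++ ds)
        u′ = trans (+-comm u _) (trans (cong (_+ u) (trans placed (sym (List.length-map dst es)))) (sym (List.length-++ (map dst es))))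

      grown′ : Grown (map dst es ++ ds) B′
      grown′ = S + length ys , ≤-trans (+-monoˡ-≤ (length ys) S≤) (≤-reflexive u′) ,
        subst (λ w → Ψ w B′ * (Q * r) ^ (3 * (h * (S + length ys))) ≤ 2 * (n * 2) * D n * suc (Q * r) ^ (3 * (h * (S + length ys)))) u′ (begin
          Ψ′ * ρ ^ (3 * (h * (S + l)))                 ≡⟨ cong (Ψ′ *_) (pw ρ) ⟩
          Ψ′ * (ρ ^ (3 * (h * S)) * ρ ^ (3 * (h * l))) ≡⟨ e₁ Ψ′ (ρ ^ (3 * (h * S))) (ρ ^ (3 * (h * l))) ⟩
          Ψ′ * ρ ^ (3 * (h * l)) * ρ ^ (3 * (h * S))   ≤⟨ *-monoˡ-≤ (ρ ^ (3 * (h * S))) decay ⟩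
          Ψ u B * suc ρ ^ (3 * (h * l)) * ρ ^ (3 * (h * S)) ≡⟨ e₂ (Ψ u B) (suc ρ ^ (3 * (h * l))) (ρ ^ (3 * (h * S))) ⟩
          Ψ u B * ρ ^ (3 * (h * S)) * suc ρ ^ (3 * (h * l)) ≤⟨ *-monoˡ-≤ (suc ρ ^ (3 * (h * l))) le ⟩
          2 * (n * 2) * D n * suc ρ ^ (3 * (h * S)) * suc ρ ^ (3 * (h * l)) ≡⟨ trans (*-assoc (2 * (n * 2) * D n) _ _) (cong (2 * (n * 2) * D n *_) (sym (pw (suc ρ)))) ⟩
          2 * (n * 2) * D n * suc ρ ^ (3 * (h * (S + l))) ∎)
        where
        open ≤-Reasoning
        S = proj₁ gr
        S≤ = proj₁ (proj₂ gr)
        le = proj₂ (proj₂ gr)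
        ρ = Q * r
        l = length ys
        Ψ′ = Ψ (u + length ys) B′
        pw : ∀ ρ → ρ ^ (3 * (h * (S + l))) ≡ ρ ^ (3 * (h * S)) * ρ ^ (3 * (h * l))
        pw ρ = trans (cong (ρ ^_) (e h S l)) (^-distribˡ-+-* ρ (3 * (h * S)) (3 * (h * l)))
          where e : ∀ h S l → 3 * (h * (S + l)) ≡ 3 * (h * S) + 3 * (h * l)
                e = solve-∀
        e₁ : ∀ a b c → a * (b * c) ≡ a * c * b
        e₁ = solve-∀
        e₂ : ∀ a b c → a * b * c ≡ a * c * b
        e₂ = solve-∀

    -- A piece is placed only while more than `g₀` vertices are free, since richness of the pool is
    -- guaranteed only so long. Once at most `g₀` are free, the absorbers take every open edge,
    -- including those inside the remaining pieces.
    main-loop : ∀ {de} ps (St : Base de (pe ps)) → Absorbing St g₀ → Grown (Base.ds St) (Base.B St) → All GoodPiece ps →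
      Completion (de ++ pe ps)
    main-loop {de} ps St ab gr good with length (Base.B St) ≤? g₀
    main-loop {de} ps St ab gr good | yes le = finish St ab le
    main-loop {de} [] St ab gr good | no gt = ⊥-elim (gt (≤-trans (≤-reflexive (sym (Base.len St))) z≤n))
    main-loop {de} ((y , s , node x cs) ∷ ps) St ab gr (gd ∷ good) | no gt =
      subst Completion (List.++-assoc de es (pe ps))
        (main-loop ps (advance es St P) (advance-absorbing es St P ab) grown′ good)
      where
      es = fe y ((s , node x cs) ∷ [])
      open Advance {de} {y} {s} {x} {cs} {pe ps} St gr gd (≰⇒> gt)

-- Embedding the absorbers

*-^ : ∀ k a b → (a * b) ^ k ≡ a ^ k * b ^ k
*-^ zero    a b = refl
*-^ (suc k) a b = trans (cong (a * b *_) (*-^ k a b)) (e a b (a ^ k) (b ^ k))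
  where e : ∀ a b x y → a * b * (x * y) ≡ a * x * (b * y)
        e = solve-∀

-- Double counting: each test is hit by a share 1/K of the choices, so some choice hits a share 1/K
-- of the total weight. This is one step of the method of conditional expectations.
pick : ∀ {N m} (Y : Fin N → ℕ) (H : Fin N → Fin m → Bool) K → 0 < m → (∀ τ → m ≤ K * sum (λ i → ⟦ H τ i ⟧)) →
  ∃ λ i → sum Y ≤ K * sum (λ τ → Y τ * ⟦ H τ i ⟧)
pick {N} {m} Y H K 0<m many = let i , lt = sum-<⇒∃ lt in i , ≤-pred lt
  where
  open ≤-Reasoning
  lt : sum {m} (λ i → sum Y) < sum (λ i → suc (K * sum (λ τ → Y τ * ⟦ H τ i ⟧)))
  lt = begin-strict
    sum {m} (λ i → sum Y)                                   ≡⟨ sum-const m _ ⟩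
    m * sum Y                                               ≡⟨ sym (sum-*ˡ m Y) ⟩
    sum (λ τ → m * Y τ)                                     ≤⟨ sum-mono (λ τ → *-monoˡ-≤ (Y τ) (many τ)) ⟩
    sum (λ τ → K * sum (λ i → ⟦ H τ i ⟧) * Y τ)             ≡⟨ sum-cong (λ τ → trans (e K _ (Y τ)) (cong (K *_) (sym (sum-*ˡ (Y τ) (λ i → ⟦ H τ i ⟧))))) ⟩
    sum (λ τ → K * sum (λ i → Y τ * ⟦ H τ i ⟧))             ≡⟨ sum-*ˡ K (λ τ → sum (λ i → Y τ * ⟦ H τ i ⟧)) ⟩
    K * sum (λ τ → sum (λ i → Y τ * ⟦ H τ i ⟧))             ≡⟨ cong (K *_) (sum-comm (λ τ i → Y τ * ⟦ H τ i ⟧)) ⟩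
    K * sum (λ i → sum (λ τ → Y τ * ⟦ H τ i ⟧))             ≡⟨ sym (sum-*ˡ K (λ i → sum (λ τ → Y τ * ⟦ H τ i ⟧))) ⟩
    sum (λ i → K * sum (λ τ → Y τ * ⟦ H τ i ⟧))             <⟨ m<n+m _ 0<m ⟩
    m + sum (λ i → K * sum (λ τ → Y τ * ⟦ H τ i ⟧))         ≡⟨ cong (_+ sum (λ i → K * sum (λ τ → Y τ * ⟦ H τ i ⟧))) (sym (trans (sum-const m 1) (*-identityʳ m))) ⟩
    sum {m} (λ i → 1) + sum (λ i → K * sum (λ τ → Y τ * ⟦ H τ i ⟧)) ≡⟨ sym (sum-+ (λ _ → 1) (λ i → K * sum (λ τ → Y τ * ⟦ H τ i ⟧))) ⟩
    sum (λ i → suc (K * sum (λ τ → Y τ * ⟦ H τ i ⟧)))       ∎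
    where e : ∀ K x y → K * x * y ≡ K * (y * x)
          e = solve-∀

both≥ : ∀ {m} (p q : Fin m → Bool) → sum (λ i → ⟦ p i ⟧) + sum (λ i → ⟦ q i ⟧) ≤ m + sum (λ i → ⟦ p i ∧ q i ⟧)
both≥ {m} p q = begin
  sum (λ i → ⟦ p i ⟧) + sum (λ i → ⟦ q i ⟧) ≡⟨ sym (sum-+ (λ i → ⟦ p i ⟧) _) ⟩
  sum (λ i → ⟦ p i ⟧ + ⟦ q i ⟧)             ≤⟨ sum-mono (λ i → ⟦∧⟧ (p i) (q i)) ⟩
  sum (λ i → 1 + ⟦ p i ∧ q i ⟧)             ≡⟨ sum-+ (λ _ → 1) (λ i → ⟦ p i ∧ q i ⟧) ⟩
  sum {m} (λ _ → 1) + sum (λ i → ⟦ p i ∧ q i ⟧) ≡⟨ cong (_+ sum (λ i → ⟦ p i ∧ q i ⟧)) (trans (sum-const m 1) (*-identityʳ m)) ⟩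
  m + sum (λ i → ⟦ p i ∧ q i ⟧)             ∎
  where open ≤-Reasoning

module Stage {n : ℕ} (G : Digraph n) where

  open MainLoop G public

  -- The edge from `y` to `p` is part of the batch, because the image of `p` too must be chosen with
  -- the tests in view.
  data Batch : Set where
    single : Edge → Batch
    absb   : V → Bool → Absorber → Batch

  bedges : Batch → List Edge
  bedges (single e)   = e ∷ []
  bedges (absb y s A) = (y , s , Absorber.p A) ∷ Absorber.edges A

  be : List Batch → List Edge
  be = concatMap bedges

  absOf : List Batch → List Absorber
  absOf []                = []
  absOf (single e ∷ bs)   = absOf bs
  absOf (absb y s A ∷ bs) = A ∷ absOf bs

  Slim : Absorber → Set
  Slim A = length (Absorber.cs A) ≤ 1

  module Greedily (A₁ L : ℕ) (0<A₁ : 0 < A₁) (L-small : A₁ * suc L ≤ n)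
    (dense : ∀ s w → (A₁ + 2) * n ≤ 2 * A₁ * sum (λ v → ⟦ Eg s w v ⟧)) where

    module Around {f ds B} (im : Images f ds B) (ds≤ : length ds ≤ L) where

      m : ℕ
      m = length B

      v : Fin m → V
      v = lookup B

      N₁ : Bool → V → ℕ
      N₁ s w = sum (λ i → ⟦ Eg s w (v i) ⟧)

      N₂ : Bool → V → Bool → V → ℕ
      N₂ s w s′ w′ = sum (λ i → ⟦ Eg s w (v i) ∧ Eg s′ w′ (v i) ⟧)

      deg≤ : ∀ s w → sum (λ x → ⟦ Eg s w x ⟧) ≤ length ds + N₁ s w
      deg≤ s w = begin
        sum (λ x → ⟦ Eg s w x ⟧)           ≡⟨ sym (ΣL-allFin n _) ⟩
        cnt s w (allFin n)                 ≡⟨ sym (ΣL-↭ _ (Images.all-images im)) ⟩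
        cnt s w (map f ds ++ B)            ≡⟨ ΣL-++ _ (map f ds) B ⟩
        cnt s w (map f ds) + cnt s w B     ≤⟨ +-mono-≤ (≤-trans (ΣL-length (λ x → ⟦⟧≤1 (Eg s w x)) (map f ds)) (≤-reflexive (List.length-map f ds)))
                                               (≤-reflexive (sym (ΣL-lookup _ B))) ⟩
        length ds + N₁ s w                 ∎
        where open ≤-Reasoning

      -- Two neighbourhoods share at least 2n / A₁ vertices, of which at most `length ds` are
      -- occupied. The summand `A₁` is one common neighbour in reserve; `enough₃` spends it on
      -- keeping the image of the child off that of `p`.
      common : ∀ s w s′ w′ → m + A₁ ≤ A₁ * N₂ s w s′ w′
      common s w s′ w′ = +-cancelʳ-≤ (A₁ * (l + n)) _ _ (begin
        m + A₁ + A₁ * (l + n)      ≡⟨ e₁ m A₁ l n ⟩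
        m + A₁ * suc l + A₁ * n    ≤⟨ +-monoˡ-≤ (A₁ * n) (+-mono-≤ (m+n≤o⇒n≤o l (≤-reflexive lm)) (≤-trans (*-monoʳ-≤ A₁ (s≤s ds≤)) L-small)) ⟩
        n + n + A₁ * n             ≡⟨ e₂ n A₁ ⟩
        (A₁ + 2) * n               ≤⟨ *-cancelˡ-≤ 2 (begin
          2 * ((A₁ + 2) * n)        ≡⟨ cong ((A₁ + 2) * n +_) (+-identityʳ _) ⟩
          (A₁ + 2) * n + (A₁ + 2) * n ≤⟨ +-mono-≤ (dense s w) (dense s′ w′) ⟩
          2 * A₁ * d + 2 * A₁ * d′    ≡⟨ e₃ A₁ d d′ ⟩
          2 * (A₁ * (d + d′))         ∎) ⟩
        A₁ * (d + d′)              ≤⟨ *-monoʳ-≤ A₁ (+-mono-≤ (deg≤ s w) (deg≤ s′ w′)) ⟩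
        A₁ * (l + N₁ s w + (l + N₁ s′ w′)) ≡⟨ e₄ A₁ l (N₁ s w) (N₁ s′ w′) ⟩
        A₁ * (l + l + (N₁ s w + N₁ s′ w′)) ≤⟨ *-monoʳ-≤ A₁ (+-monoʳ-≤ (l + l) (both≥ (λ i → Eg s w (v i)) (λ i → Eg s′ w′ (v i)))) ⟩
        A₁ * (l + l + (m + N₂ s w s′ w′))  ≡⟨ e₅ A₁ l m (N₂ s w s′ w′) ⟩
        A₁ * N₂ s w s′ w′ + A₁ * (l + (l + m)) ≡⟨ cong (λ t → A₁ * N₂ s w s′ w′ + A₁ * (l + t)) lm ⟩
        A₁ * N₂ s w s′ w′ + A₁ * (l + n) ∎)
        where
        open ≤-Reasoning
        l = length ds
        lm : l + m ≡ n
        lm = Images-length im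
        d = sum (λ x → ⟦ Eg s w x ⟧)
        d′ = sum (λ x → ⟦ Eg s′ w′ x ⟧)
        e₁ : ∀ m A l n → m + A + A * (l + n) ≡ m + A * suc l + A * n
        e₁ = solve-∀
        e₂ : ∀ n A → n + n + A * n ≡ (A + 2) * n
        e₂ = solve-∀
        e₃ : ∀ A d e → 2 * A * d + 2 * A * e ≡ 2 * (A * (d + e))
        e₃ = solve-∀
        e₄ : ∀ A l a b → A * (l + a + (l + b)) ≡ A * (l + l + (a + b))
        e₄ = solve-∀
        e₅ : ∀ A l m x → A * (l + l + (m + x)) ≡ A * x + A * (l + (l + m))
        e₅ = solve-∀

      find : ∀ s w → ∃ λ i → Eg s w (v i) ≡ true
      find s w = let i , h = sum->0 _ pos in i , proj₁ (∧-true (⟦⟧>0 h))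
        where
        pos : 0 < N₂ s w s w
        pos with N₂ s w s w | common s w s w
        ... | suc _ | _ = s≤s z≤n
        ... | zero | le = ⊥-elim (<-irrefl refl (<-≤-trans 0<A₁ (≤-trans (m≤n+m A₁ m) (≤-trans le (≤-reflexive (*-zeroʳ A₁))))))

      module Triple {N : ℕ} (dec : Fin N → V × V × Bool) (Y : Fin N → ℕ) (0<Y : 0 < sum Y) (0<m : 0 < m)
        (w : V) (s sq : Bool) where

        tr ta : Fin N → V
        tr τ = proj₁ (dec τ)
        ta τ = proj₁ (proj₂ (dec τ))
        ts : Fin N → Bool
        ts τ = proj₂ (proj₂ (dec τ))

        -- `Eg (not sq)` seen from the target `tr τ` is `Eg sq` towards it: `p` is put where `q`
        -- could later be moved to `tr τ`.
        H₁ : Fin N → Fin m → Bool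
        H₁ τ i = Eg s w (v i) ∧ Eg (not sq) (tr τ) (v i)

        drop-A₁ : ∀ {x} → m + A₁ ≤ x → m ≤ x
        drop-A₁ = ≤-trans (m≤m+n m A₁)

        first : ∃ λ i → sum Y ≤ A₁ * sum (λ τ → Y τ * ⟦ H₁ τ i ⟧)
        first = pick Y H₁ A₁ 0<m (λ τ → drop-A₁ (common s w (not sq) (tr τ)))

        i : Fin m
        i = proj₁ first

        Y₁ : Fin N → ℕ
        Y₁ τ = Y τ * ⟦ H₁ τ i ⟧

        H₂ : Fin N → Fin m → Bool
        H₂ τ j = Eg sq (v i) (v j) ∧ Eg (ts τ) (ta τ) (v j)

        second : ∃ λ j → sum Y₁ ≤ A₁ * sum (λ τ → Y₁ τ * ⟦ H₂ τ j ⟧)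
        second = pick Y₁ H₂ A₁ 0<m (λ τ → drop-A₁ (common sq (v i) (ts τ) (ta τ)))

        j : Fin m
        j = proj₁ second

        Y₂ : Fin N → ℕ
        Y₂ τ = Y₁ τ * ⟦ H₂ τ j ⟧

        total₂ : sum Y ≤ A₁ * A₁ * sum Y₂
        total₂ = ≤-trans (proj₂ first) (≤-trans (*-monoʳ-≤ A₁ (proj₂ second)) (≤-reflexive (sym (*-assoc A₁ A₁ _))))

        positive : ∀ {k x y} → 0 < x → x ≤ k * y → 0 < y
        positive {k} {x} {zero} lt le = ⊥-elim (<-irrefl refl (<-≤-trans lt (≤-trans le (≤-reflexive (*-zeroʳ k)))))
        positive {k} {x} {suc y} lt le = s≤s z≤n

        factors : ∀ {a b c} → 0 < a * ⟦ b ⟧ * ⟦ c ⟧ → b ≡ true × c ≡ true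
        factors {a} {true}  {true}  _ = refl , refl
        factors {a} {true}  {false} h = ⊥-elim (<-irrefl refl (≤-trans h (≤-reflexive (*-zeroʳ (a * 1)))))
        factors {a} {false} {c}     h = ⊥-elim (<-irrefl refl (≤-trans h (≤-reflexive (trans (cong (_* ⟦ c ⟧) (*-zeroʳ a)) refl))))

        valid₂ : Eg s w (v i) ≡ true × Eg sq (v i) (v j) ≡ true
        valid₂ = let τ , h = sum->0 Y₂ (positive {A₁ * A₁} 0<Y total₂)
                     h₁ , h₂ = factors {Y τ} h
                 in proj₁ (∧-true h₁) , proj₁ (∧-true h₂)

        module Third (sc : Bool) where

          H₃ : Fin N → Fin m → Bool
          H₃ τ k = (Eg sc (v j) (v k) ∧ Eg sc (tr τ) (v k)) ∧ not (i == k)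

          enough₃ : ∀ τ → m ≤ A₁ * sum (λ k → ⟦ H₃ τ k ⟧)
          enough₃ τ = +-cancelʳ-≤ A₁ _ _ (≤-trans (common sc (v j) sc (tr τ)) (begin
            A₁ * sum (λ k → ⟦ p k ⟧)   ≤⟨ *-monoʳ-≤ A₁ (sum-mono (λ k → pt (p k) (i == k))) ⟩
            A₁ * sum (λ k → ⟦ H₃ τ k ⟧ + ⟦ i == k ⟧) ≡⟨ cong (A₁ *_) (trans (sum-+ (λ k → ⟦ H₃ τ k ⟧) _) (cong (sum (λ k → ⟦ H₃ τ k ⟧) +_) (sum-δ₁ i))) ⟩
            A₁ * (sum (λ k → ⟦ H₃ τ k ⟧) + 1) ≡⟨ trans (*-distribˡ-+ A₁ _ 1) (cong (A₁ * sum (λ k → ⟦ H₃ τ k ⟧) +_) (*-identityʳ A₁)) ⟩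
            A₁ * sum (λ k → ⟦ H₃ τ k ⟧) + A₁ ∎))
            where
            open ≤-Reasoning
            p : Fin m → Bool
            p k = Eg sc (v j) (v k) ∧ Eg sc (tr τ) (v k)
            pt : ∀ a b → ⟦ a ⟧ ≤ ⟦ a ∧ not b ⟧ + ⟦ b ⟧
            pt true  true  = ≤-refl
            pt true  false = ≤-refl
            pt false b     = z≤n

          third : ∃ λ k → sum Y₂ ≤ A₁ * sum (λ τ → Y₂ τ * ⟦ H₃ τ k ⟧)
          third = pick Y₂ H₃ A₁ 0<m enough₃

          k : Fin m
          k = proj₁ third

          Y₃ : Fin N → ℕ
          Y₃ τ = Y₂ τ * ⟦ H₃ τ k ⟧

          total₃ : sum Y ≤ A₁ * A₁ * A₁ * sum Y₃
          total₃ = ≤-trans total₂ (≤-trans (*-monoʳ-≤ (A₁ * A₁) (proj₂ third)) (≤-reflexive (sym (*-assoc (A₁ * A₁) A₁ _))))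

          valid₃ : Eg sc (v j) (v k) ≡ true × (i == k) ≡ false
          valid₃ = let τ , h = sum->0 Y₃ (positive {A₁ * A₁ * A₁} 0<Y total₃)
                       _ , h₃ = factors {Y₁ τ} {H₂ τ j} h
                   in proj₁ (∧-true (proj₁ (∧-true h₃))) , not-true (proj₂ (∧-true {Eg sc (v j) (v k) ∧ Eg sc (tr τ) (v k)} h₃))

    κ₁ k₁ : ℕ
    k₁ = A₁ * A₁ * A₁
    κ₁ = pred (2 * k₁)

    0<k₁ : 0 < k₁
    0<k₁ = *-mono-≤ (*-mono-≤ 0<A₁ 0<A₁) 0<A₁

    suc-κ₁ : suc κ₁ ≡ 2 * k₁
    suc-κ₁ = suc-pred (2 * k₁) {{>-nonZero (*-mono-≤ (s≤s {0} {1} z≤n) 0<k₁)}}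

    N : ℕ
    N = n * (n * 2)

    dec : Fin N → V × V × Bool
    dec τ = let r , ρ = remQuot {n} (n * 2) τ
                a , b = remQuot {n} 2 ρ
            in r , a , signs b

    dec-surj : ∀ r a s → ∃ λ τ → dec τ ≡ (r , a , s)
    dec-surj r a s = combine r (combine a (c s)) ,
        trans (cong (λ (r , ρ) → r , proj₁ (remQuot {n} 2 ρ) , signs (proj₂ (remQuot {n} 2 ρ))) (Fin.remQuot-combine {n} {n * 2} r (combine a (c s))))
          (trans (cong (λ (a , b) → r , a , signs b) (Fin.remQuot-combine {n} {2} a (c s))) (cong (λ s → r , a , s) (sc s)))
      where
      c : Bool → Fin 2
      c true  = zero
      c false = suc zero
      sc : ∀ s → signs (c s) ≡ s
      sc true  = refl
      sc false = refl

    hitτ : (V → V) → Absorber → Fin N → Bool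
    hitτ f A τ = hit f (proj₁ (dec τ)) (proj₁ (proj₂ (dec τ))) (proj₂ (proj₂ (dec τ))) A

    hitsτ : (V → V) → List Absorber → Fin N → ℕ
    hitsτ f abs τ = hits f (proj₁ (dec τ)) (proj₁ (proj₂ (dec τ))) (proj₂ (proj₂ (dec τ))) abs

    -- `Y τ` is 2 to the number of absorbers that miss τ. A new absorber hits a share 1 / k₁ of the
    -- total weight and doubles the rest, so the total grows at most by the factor κ₁ / k₁ = 2 - 1 /
    -- k₁. The three factors of `k₁` come from the images of `p`, `q` and the child.
    record Weighted (f : V → V) (ds : List V) (abs : List Absorber) : Set where
      field
        Y      : Fin N → ℕ
        Y-hits : ∀ τ → Y τ * 2 ^ hitsτ f abs τ ≡ 2 ^ length abs
        Y-sum  : k₁ ^ length abs * sum Y ≤ κ₁ ^ length abs * N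
        uabs   : Unique (concatMap Absorber.labs abs)
        sub    : ∀ {z} → z ∈ concatMap Absorber.labs abs → z ∈ ds

    weighted-[] : ∀ {f ds} → Weighted f ds []
    weighted-[] = record
      { Y = λ _ → 1 ; Y-hits = λ _ → refl
      ; Y-sum = ≤-reflexive (cong (1 *_) (trans (sum-const N 1) (*-identityʳ N)))
      ; uabs = [] ; sub = λ () }

    weighted-agree : ∀ {f f′ ds ds′ abs} → (∀ {z} → z ∈ ds → f′ z ≡ f z) → (∀ {z} → z ∈ ds → z ∈ ds′) → Weighted f ds abs → Weighted f′ ds′ abs
    weighted-agree {abs = abs} agree up w = record
      { Y = Y ; Y-hits = λ τ → trans (cong (λ h → Y τ * 2 ^ h) (hits-cong (proj₁ (dec τ)) (proj₁ (proj₂ (dec τ))) (proj₂ (proj₂ (dec τ))) abs (λ z∈ → agree (sub z∈)))) (Y-hits τ)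
      ; Y-sum = Y-sum ; uabs = uabs ; sub = up ∘ sub }
      where open Weighted w

    weighted-cons : ∀ {f ds abs A} (w : Weighted f ds abs) → sum (Weighted.Y w) ≤ k₁ * sum (λ τ → Weighted.Y w τ * ⟦ hitτ f A τ ⟧) →
      Unique (Absorber.labs A ++ concatMap Absorber.labs abs) → (∀ {z} → z ∈ Absorber.labs A → z ∈ ds) → Weighted f ds (A ∷ abs)
    weighted-cons {f} {ds} {abs} {A} w progress u sub′ = record
      { Y = Y′
      ; Y-hits = yh
      ; Y-sum = begin
          k₁ * k₁ ^ l * sum Y′     ≡⟨ e₁ k₁ (k₁ ^ l) (sum Y′) ⟩
          k₁ ^ l * (k₁ * sum Y′)   ≤⟨ *-monoʳ-≤ (k₁ ^ l) shrink ⟩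
          k₁ ^ l * (κ₁ * sum Y)    ≡⟨ e₁′ (k₁ ^ l) κ₁ (sum Y) ⟩
          κ₁ * (k₁ ^ l * sum Y)    ≤⟨ *-monoʳ-≤ κ₁ Y-sum ⟩
          κ₁ * (κ₁ ^ l * N)        ≡⟨ sym (*-assoc κ₁ _ _) ⟩
          κ₁ * κ₁ ^ l * N          ∎
      ; uabs = u
      ; sub = λ z∈ → [ sub′ , sub ]′ (∈-++⁻ (Absorber.labs A) z∈)
      }
      where
      open Weighted w
      open ≤-Reasoning
      l = length abs
      Y′ : Fin N → ℕ
      Y′ τ = if hitτ f A τ then Y τ else 2 * Y τ
      e₁ : ∀ k x y → k * x * y ≡ x * (k * y)
      e₁ = solve-∀
      e₁′ : ∀ x k y → x * (k * y) ≡ k * (x * y)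
      e₁′ = solve-∀
      yh : ∀ τ → Y′ τ * 2 ^ hitsτ f (A ∷ abs) τ ≡ 2 ^ suc l
      yh τ with hitτ f A τ
      ... | true  = trans (e₁′ (Y τ) 2 _) (cong (2 *_) (Y-hits τ))
      ... | false = trans (*-assoc 2 (Y τ) _) (cong (2 *_) (Y-hits τ))
      pt : ∀ τ → Y′ τ + Y τ * ⟦ hitτ f A τ ⟧ ≡ 2 * Y τ
      pt τ with hitτ f A τ
      ... | true  = cong (Y τ +_) (*-comm (Y τ) 1)
      ... | false = trans (cong (2 * Y τ +_) (*-zeroʳ (Y τ))) (+-identityʳ _)
      shrink : k₁ * sum Y′ ≤ κ₁ * sum Y
      shrink = +-cancelʳ-≤ (sum Y) _ _ (begin
        k₁ * sum Y′ + sum Y ≤⟨ +-monoʳ-≤ (k₁ * sum Y′) progress ⟩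
        k₁ * sum Y′ + k₁ * sum (λ τ → Y τ * ⟦ hitτ f A τ ⟧) ≡⟨ sym (*-distribˡ-+ k₁ _ _) ⟩
        k₁ * (sum Y′ + sum (λ τ → Y τ * ⟦ hitτ f A τ ⟧))
          ≡⟨ cong (k₁ *_) (trans (sym (sum-+ Y′ _)) (trans (sum-cong pt) (sum-*ˡ 2 Y))) ⟩
        k₁ * (2 * sum Y) ≡⟨ trans (sym (*-assoc k₁ 2 _)) (cong (_* sum Y) (trans (*-comm k₁ 2) (sym suc-κ₁))) ⟩
        suc κ₁ * sum Y   ≡⟨ +-comm (sum Y) _ ⟩
        κ₁ * sum Y + sum Y ∎)

    -- With l absorbers, a test with fewer than k hits would alone weigh more than 2 ^ (l - k),
    -- while the total is at most (2 - 1 / k₁) ^ l N.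
    weighted-enough : ∀ {f ds abs} k → Weighted f ds abs → κ₁ ^ length abs * (N * 2 ^ k) < suc κ₁ ^ length abs →
      ∀ r a s → k ≤ hits f r a s abs
    weighted-enough {f} {ds} {abs} k w gap r a s with k ≤? hits f r a s abs
    ... | yes le = le
    ... | no gt = ⊥-elim (<-irrefl refl (<-≤-trans gap (begin
        suc κ₁ ^ l                 ≡⟨ trans (cong (_^ l) (trans suc-κ₁ (*-comm 2 k₁))) (*-^ l k₁ 2) ⟩
        k₁ ^ l * 2 ^ l             ≡⟨ cong (k₁ ^ l *_) (sym (Y-hits τ)) ⟩
        k₁ ^ l * (Y τ * 2 ^ hitsτ f abs τ) ≡⟨ sym (*-assoc (k₁ ^ l) (Y τ) _) ⟩
        k₁ ^ l * Y τ * 2 ^ hitsτ f abs τ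
          ≤⟨ *-mono-≤ (≤-trans (*-monoʳ-≤ (k₁ ^ l) (term≤sum Y τ)) Y-sum) (^-monoʳ-≤ 2 (≤-trans (≤-reflexive heq) (<⇒≤ (≰⇒> gt)))) ⟩
        κ₁ ^ l * N * 2 ^ k         ≡⟨ *-assoc (κ₁ ^ l) N _ ⟩
        κ₁ ^ l * (N * 2 ^ k)       ∎)))
      where
      open Weighted w
      open ≤-Reasoning
      l = length abs
      τ = proj₁ (dec-surj r a s)
      heq : hitsτ f abs τ ≡ hits f r a s abs
      heq = cong (λ (r , a , s) → hits f r a s abs) (proj₂ (dec-surj r a s))

    module AddBatch {de re : List Edge} {abs : List Absorber} where

      module _ {y x : V} {s : Bool} (St : Base de ((y , s , x) ∷ re)) (ds≤ : length (Base.ds St) ≤ L) where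

        open Base St
        open Around im ds≤

        private
          y∈ : y ∈ ds
          y∈ with par
          ... | y∈ ∷ _ = y∈

        place-single : Placed f ds B ((y , s , x) ∷ [])
        place-single = let i , e = find s (f y) in
          proj₁ (place-piece y s x [] i [] im y∈ (Unique-++ʳ (map dst re) (base-uniq ((y , s , x) ∷ []) St)) e [] ([] ∷ []))

      implied : ∀ {a b c h} → (b ≡ true → c ≡ true → h ≡ true) → a * ⟦ b ⟧ * ⟦ c ⟧ ≤ a * ⟦ h ⟧
      implied {a} {true}  {true}  {h} f = ≤-reflexive (trans (*-identityʳ (a * 1)) (cong (λ h → a * ⟦ h ⟧) (sym (f refl refl))))
      implied {a} {true}  {false} f = ≤-trans (≤-reflexive (*-zeroʳ (a * 1))) z≤n
      implied {a} {false} {c}     f = ≤-trans (≤-reflexive (cong (_* ⟦ c ⟧) (*-zeroʳ a))) z≤n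

      module _ {y p q : V} {s sq : Bool} where

        module _ {cs : List (Bool × V)}
          (St : Base de (bedges (absb y s (absorber p q sq cs)) ++ re)) (ds≤ : length (Base.ds St) ≤ L)
          (w : Weighted (Base.f St) (Base.ds St) abs) where

          open Base St
          open Weighted w
          open Around im ds≤

          private
            A : Absorber
            A = absorber p q sq cs

          y∈ : y ∈ ds
          y∈ with par
          ... | y∈ ∷ _ = y∈

          0<m : 0 < m
          0<m = subst (0 <_) len (s≤s z≤n)

          0<Y : 0 < sum Y
          0<Y = ≤-trans (pos (Y τ) {l = length abs} (Y-hits τ)) (term≤sum Y τ)
            where
            τ : Fin N
            τ = proj₁ (dec-surj y y true)
            pos : ∀ x {h l} → x * h ≡ 2 ^ l → 0 < x
            pos (suc x) e = s≤s z≤n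
            pos zero {h} {l} e = ⊥-elim (<-irrefl e (m^n>0 2 l))

          ues : Unique (map dst (bedges (absb y s A)) ++ ds)
          ues = Unique-++ʳ (map dst re) (base-uniq (bedges (absb y s A)) St)

          open Triple dec Y 0<Y 0<m (f y) s sq public

          no-loop : ∀ {s} {i j : Fin m} → Eg s (v i) (v j) ≡ true → i ≢ j
          no-loop {s} {i} e refl = true≢false e (Eg-loopless s (v i))

          H₁-hit : ∀ {τ} → H₁ τ i ≡ true → Eg sq (v i) (tr τ) ≡ true
          H₁-hit {τ} h = trans (sym (Eg-flip sq (tr τ) (v i))) (proj₂ (∧-true {Eg s (f y) (v i)} h))

          H₂-hit : ∀ {τ} → H₂ τ j ≡ true → Eg (ts τ) (ta τ) (v j) ≡ true
          H₂-hit {τ} h = proj₂ (∧-true {Eg sq (v i) (v j)} h)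

          labs-fresh : Unique (map dst (bedges (absb y s A)) ++ concatMap Absorber.labs abs)
          labs-fresh = Unique.++⁺ (Unique-++ˡ _ ues) uabs
            (λ (z∈ , z∈′) → Unique-disjoint (map dst (bedges (absb y s A))) ues z∈ (sub z∈′))

          extend : (P : Placed f ds B (bedges (absb y s A))) → map dst (bedges (absb y s A)) ≡ Absorber.labs A →
            sum Y ≤ k₁ * sum (λ τ → Y τ * ⟦ hitτ (Placed.f′ P) A τ ⟧) →
            Weighted (Placed.f′ P) (map dst (bedges (absb y s A)) ++ ds) (A ∷ abs)
          extend P labs≡ progress = weighted-cons (weighted-agree (Placed.agree P) (∈-++⁺ʳ (map dst (bedges (absb y s A)))) w)
            progress (subst (λ l → Unique (l ++ concatMap Absorber.labs abs)) labs≡ labs-fresh)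
            (λ {z} z∈ → ∈-++⁺ˡ (subst (z ∈_) (sym labs≡) z∈))

        Extended : ∀ {cs} → Base de (bedges (absb y s (absorber p q sq cs)) ++ re) → Set
        Extended {cs} St = Σ (Placed f ds B (bedges (absb y s A))) λ P →
            Weighted (Placed.f′ P) (map dst (bedges (absb y s A)) ++ ds) (A ∷ abs)
          where open Base St
                A = absorber p q sq cs

        place-leaf : (St : Base de (bedges (absb y s (absorber p q sq [])) ++ re)) → length (Base.ds St) ≤ L →
          Weighted (Base.f St) (Base.ds St) abs → Extended St
        place-leaf St ds≤ w = P , extend St ds≤ w P refl progress
          where
          open Base St
          open Weighted w
          open Around im ds≤ using (v; m)
          i₀ j₀ : Fin m
          i₀ = i St ds≤ w
          j₀ = j St ds≤ w
          pl : Σ (Placed f ds B (bedges (absb y s (absorber p q sq [])))) λ P → Placed.ys P ≡ map (lookup B) (i₀ ∷ j₀ ∷ [])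
          pl = place-piece y s p ((sq , node q []) ∷ []) i₀ (j₀ ∷ []) im (y∈ St ds≤ w) (ues St ds≤ w) (proj₁ (valid₂ St ds≤ w))
            (cons (proj₂ (valid₂ St ds≤ w)) [] []) ((no-loop St ds≤ w {sq} {i₀} {j₀} (proj₂ (valid₂ St ds≤ w)) ∷ []) ∷ [] ∷ [])
          P = proj₁ pl
          f′ = Placed.f′ P
          onto : f′ p ∷ f′ q ∷ [] ≡ v i₀ ∷ v j₀ ∷ []
          onto = trans (Placed.onto P) (proj₂ pl)
          progress : sum Y ≤ k₁ * sum (λ τ → Y τ * ⟦ hitτ f′ (absorber p q sq []) τ ⟧)
          progress = ≤-trans (total₂ St ds≤ w) (*-mono-≤ (m≤m*n (A₁ * A₁) A₁ {{>-nonZero 0<A₁}})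
            (sum-mono (λ τ → implied {Y τ} (λ h₁ h₂ →
              ∧-intro (subst (λ z → Eg sq z (tr St ds≤ w τ) ≡ true) (sym (proj₁ (List.∷-injective onto))) (H₁-hit St ds≤ w {τ} h₁))
                (∧-intro (subst (λ z → Eg (ts St ds≤ w τ) (ta St ds≤ w τ) z ≡ true) (sym (proj₁ (List.∷-injective (proj₂ (List.∷-injective onto))))) (H₂-hit St ds≤ w {τ} h₂)) refl)))))

        place-triple : ∀ {sc c} (St : Base de (bedges (absb y s (absorber p q sq ((sc , c) ∷ []))) ++ re)) → length (Base.ds St) ≤ L →
          Weighted (Base.f St) (Base.ds St) abs → Extended St
        place-triple {sc} {c} St ds≤ w = P , extend St ds≤ w P refl progress
          where
          open Base St
          open Weighted w
          open Around im ds≤ using (v; m)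
          module Th = Third St ds≤ w sc
          i₀ j₀ k₀ : Fin m
          i₀ = i St ds≤ w
          j₀ = j St ds≤ w
          k₀ = Th.k
          A = absorber p q sq ((sc , c) ∷ [])
          Ejk : Eg sc (v j₀) (v k₀) ≡ true
          Ejk = proj₁ Th.valid₃
          i≢k : i₀ ≢ k₀
          i≢k e = true≢false (trans (cong (i₀ ==_) (sym e)) (==-refl i₀)) (proj₂ Th.valid₃)
          pl : Σ (Placed f ds B (bedges (absb y s A))) λ P → Placed.ys P ≡ map (lookup B) (i₀ ∷ j₀ ∷ k₀ ∷ [])
          pl = place-piece y s p ((sq , node q ((sc , node c []) ∷ [])) ∷ []) i₀ (j₀ ∷ k₀ ∷ []) im (y∈ St ds≤ w) (ues St ds≤ w)
            (proj₁ (valid₂ St ds≤ w)) (cons (proj₂ (valid₂ St ds≤ w)) (cons Ejk [] []) [])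
            ((no-loop St ds≤ w {sq} {i₀} {j₀} (proj₂ (valid₂ St ds≤ w)) ∷ i≢k ∷ []) ∷
             (no-loop St ds≤ w {sc} {j₀} {k₀} Ejk ∷ []) ∷ [] ∷ [])
          P = proj₁ pl
          f′ = Placed.f′ P
          onto : f′ p ∷ f′ q ∷ f′ c ∷ [] ≡ v i₀ ∷ v j₀ ∷ v k₀ ∷ []
          onto = trans (Placed.onto P) (proj₂ pl)
          fp : f′ p ≡ v i₀
          fp = proj₁ (List.∷-injective onto)
          fq : f′ q ≡ v j₀
          fq = proj₁ (List.∷-injective (proj₂ (List.∷-injective onto)))
          fc : f′ c ≡ v k₀
          fc = proj₁ (List.∷-injective (proj₂ (List.∷-injective (proj₂ (List.∷-injective onto)))))
          hit₃ : ∀ τ → H₁ St ds≤ w τ i₀ ≡ true → H₂ St ds≤ w τ j₀ ≡ true → Th.H₃ τ k₀ ≡ true → hitτ f′ A τ ≡ true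
          hit₃ τ h₁ h₂ h₃ = ∧-intro (subst (λ z → Eg sq z (tr St ds≤ w τ) ≡ true) (sym fp) (H₁-hit St ds≤ w {τ} h₁))
            (∧-intro (subst (λ z → Eg (ts St ds≤ w τ) (ta St ds≤ w τ) z ≡ true) (sym fq) (H₂-hit St ds≤ w {τ} h₂))
              (∧-intro (subst (λ z → Eg sc (tr St ds≤ w τ) z ≡ true) (sym fc)
                (proj₂ (∧-true {Eg sc (v j₀) (v k₀)} (proj₁ (∧-true {Eg sc (v j₀) (v k₀) ∧ Eg sc (tr St ds≤ w τ) (v k₀)} h₃))))) refl))
          progress : sum Y ≤ k₁ * sum (λ τ → Y τ * ⟦ hitτ f′ A τ ⟧)
          progress = ≤-trans Th.total₃ (*-monoʳ-≤ k₁ (sum-mono (λ τ → three (Y τ) (hit₃ τ))))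
            where
            three : ∀ a {b c d h} → (b ≡ true → c ≡ true → d ≡ true → h ≡ true) → a * ⟦ b ⟧ * ⟦ c ⟧ * ⟦ d ⟧ ≤ a * ⟦ h ⟧
            three a {true}  {c} {d} {h} g = ≤-trans (≤-reflexive (cong (λ x → x * ⟦ c ⟧ * ⟦ d ⟧) (*-identityʳ a))) (implied {a} {c} {d} {h} (g refl))
            three a {false} {c} {d} {h} g = ≤-trans (≤-reflexive (cong (λ x → x * ⟦ c ⟧ * ⟦ d ⟧) (*-zeroʳ a))) z≤n

    open AddBatch

    record Embedded (es re : List Edge) (ℓ k : ℕ) : Set where
      field
        base     : Base es re
        abs      : List Absorber
        weighted : Weighted (Base.f base) (Base.ds base) abs
        loc      : All (Local (es ++ re)) abs
        ds-len   : length (Base.ds base) ≡ ℓ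
        abs-len  : length abs ≡ k

    private
      next : ∀ {de re abs k} es (St : Base de (es ++ re)) (P : Placed (Base.f St) (Base.ds St) (Base.B St) es) →
        Weighted (Placed.f′ P) (map dst es ++ Base.ds St) abs → All (Local (de ++ es ++ re)) abs → length abs ≡ k →
        Embedded (de ++ es) re (length es + length (Base.ds St)) k
      next {de} {re} {abs} es St P w loc e = record
        { base = advance es St P ; abs = abs ; weighted = w
        ; loc = subst (λ E → All (Local E) abs) (sym (List.++-assoc de es re)) loc
        ; ds-len = trans (List.length-++ (map dst es)) (cong (_+ length (Base.ds St)) (List.length-map dst es))
        ; abs-len = e }

      add-batch : ∀ {de re ℓ k} b → All Slim (absOf (b ∷ [])) → Embedded de (bedges b ++ re) ℓ k → ℓ ≤ L →
        All (Local (de ++ bedges b ++ re)) (absOf (b ∷ [])) →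
        Embedded (de ++ bedges b) re (length (bedges b) + ℓ) (length (absOf (b ∷ [])) + k)
      add-batch {de} {re} (single (y , s , x)) slim E ℓ≤ loc′ = subst (λ l → Embedded (de ++ (y , s , x) ∷ []) re (1 + l) _) ds-len
          (next ((y , s , x) ∷ []) base P (weighted-agree (Placed.agree P) there weighted) loc abs-len)
        where
        open Embedded E
        P = place-single {de} {re} {abs} base (≤-trans (≤-reflexive ds-len) ℓ≤)
      add-batch {de} {re} (absb y s (absorber p q sq [])) slim E ℓ≤ (l ∷ _) = subst (λ l → Embedded _ re (2 + l) _) ds-len
          (next (bedges (absb y s (absorber p q sq []))) base (proj₁ X) (proj₂ X) (l ∷ loc) (cong suc abs-len))
        where
        open Embedded E
        X = place-leaf {de} {re} {abs} base (≤-trans (≤-reflexive ds-len) ℓ≤) weighted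
      add-batch {de} {re} (absb y s (absorber p q sq ((sc , c) ∷ []))) slim E ℓ≤ (l ∷ _) = subst (λ l → Embedded _ re (3 + l) _) ds-len
          (next (bedges (absb y s (absorber p q sq ((sc , c) ∷ [])))) base (proj₁ X) (proj₂ X) (l ∷ loc) (cong suc abs-len))
        where
        open Embedded E
        X = place-triple {de} {re} {abs} base (≤-trans (≤-reflexive ds-len) ℓ≤) weighted
      add-batch (absb y s (absorber p q sq (_ ∷ _ ∷ _))) (s≤s () ∷ _)

      absOf-∷ : ∀ b bs → absOf (b ∷ bs) ≡ absOf (b ∷ []) ++ absOf bs
      absOf-∷ (single e)   bs = refl
      absOf-∷ (absb y s A) bs = refl

    add-batches : ∀ bs {de re ℓ k} → All Slim (absOf bs) → Embedded de (be bs ++ re) ℓ k → length (be bs) + ℓ ≤ L →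
      All (Local (de ++ be bs ++ re)) (absOf bs) →
      Embedded (de ++ be bs) re (length (be bs) + ℓ) (length (absOf bs) + k)
    add-batches [] {de} {re} {ℓ} {k} slim E ℓ≤ loc = subst (λ d → Embedded d re ℓ k) (sym (List.++-identityʳ de)) E
    add-batches (b ∷ bs) {de} {re} {ℓ} {k} slim E ℓ≤ loc =
      subst₂ (λ l k → Embedded (de ++ bedges b ++ be bs) re l k)
        (trans (e (length (be bs)) (length (bedges b)) ℓ) (cong (_+ ℓ) (sym (List.length-++ (bedges b)))))
        (trans (e (length (absOf bs)) (length (absOf (b ∷ []))) k) (cong (_+ k) (sym (trans (cong length (absOf-∷ b bs)) (List.length-++ (absOf (b ∷ [])))))))
        (subst (λ d → Embedded d re _ _) (List.++-assoc de (bedges b) (be bs))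
          (add-batches bs (All.++⁻ʳ (absOf (b ∷ [])) slim′) E₁ ℓ≤₁ loc₁))
      where
      e : ∀ a b c → a + (b + c) ≡ b + a + c
      e = solve-∀
      slim′ : All Slim (absOf (b ∷ []) ++ absOf bs)
      slim′ = subst (All Slim) (absOf-∷ b bs) slim
      loc′ : All (Local (de ++ bedges b ++ be bs ++ re)) (absOf (b ∷ []) ++ absOf bs)
      loc′ = subst₂ (λ E A → All (Local E) A) (cong (de ++_) (List.++-assoc (bedges b) (be bs) re)) (absOf-∷ b bs) loc
      E₀ : Embedded de (bedges b ++ be bs ++ re) ℓ k
      E₀ = subst (λ r → Embedded de r ℓ k) (List.++-assoc (bedges b) (be bs) re) E
      E₁ : Embedded (de ++ bedges b) (be bs ++ re) (length (bedges b) + ℓ) (length (absOf (b ∷ [])) + k)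
      E₁ = add-batch b (All.++⁻ˡ (absOf (b ∷ [])) slim′) E₀
        (≤-trans (m≤n+m ℓ (length (be (b ∷ bs)))) ℓ≤) (All.++⁻ˡ (absOf (b ∷ [])) loc′)
      ℓ≤₁ : length (be bs) + (length (bedges b) + ℓ) ≤ L
      ℓ≤₁ = ≤-trans (≤-reflexive (trans (e (length (be bs)) (length (bedges b)) ℓ) (cong (_+ ℓ) (sym (List.length-++ (bedges b)))))) ℓ≤
      loc₁ : All (Local ((de ++ bedges b) ++ be bs ++ re)) (absOf bs)
      loc₁ = subst (λ E → All (Local E) (absOf bs)) (sym (List.++-assoc de (bedges b) (be bs ++ re))) (All.++⁻ʳ (absOf (b ∷ [])) loc′)

    embedded-absorbing : ∀ {es re ℓ k} (E : Embedded es re ℓ k) g → κ₁ ^ k * (N * 2 ^ g) < suc κ₁ ^ k → Absorbing (Embedded.base E) g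
    embedded-absorbing {es} {re} {ℓ} {k} E g gap = record
      { abs = abs ; loc = loc ; uabs = Weighted.uabs weighted ; sub = Weighted.sub weighted
      ; enough = weighted-enough g weighted (subst (λ k → κ₁ ^ k * (N * 2 ^ g) < suc κ₁ ^ k) (sym abs-len) gap) }
      where open Embedded E

-- Oriented trees as rooted trees

module _ {n : ℕ} where

  Unique-count : ∀ (p : Fin n → Bool) xs → Unique xs → All (λ x → p x ≡ true) xs → length xs ≤ count p
  Unique-count p xs u h = let zs , q = extract xs u (λ {y} _ → ∈-allFin y) in begin
    length xs                          ≡⟨ sym (ones xs h) ⟩
    ΣL (λ x → ⟦ p x ⟧) xs              ≤⟨ m≤m+n _ _ ⟩
    ΣL (λ x → ⟦ p x ⟧) xs + ΣL (λ x → ⟦ p x ⟧) zs ≡⟨ sym (ΣL-++ _ xs zs) ⟩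
    ΣL (λ x → ⟦ p x ⟧) (xs ++ zs)      ≡⟨ sym (ΣL-↭ _ q) ⟩
    ΣL (λ x → ⟦ p x ⟧) (allFin n)      ≡⟨ trans (ΣL-allFin n _) (sym (count≡sum p)) ⟩
    count p                            ∎
    where
    open ≤-Reasoning
    ones : ∀ xs → All (λ x → p x ≡ true) xs → ΣL (λ x → ⟦ p x ⟧) xs ≡ length xs
    ones []       []      = refl
    ones (x ∷ xs) (e ∷ h) = cong₂ _+_ (cong ⟦_⟧ e) (ones xs h)

  -- the vertices of the chain after the first one
  data Chain (T : Digraph n) : Fin n → List (Fin n) → Fin n → Set where
    []  : ∀ {u} → Chain T u [] u
    _∷_ : ∀ {u v w xs} → und T u v ≡ true → Chain T v xs w → Chain T u (v ∷ xs) w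

  Chain-snoc : ∀ {T u xs w z} → Chain T u xs w → und T w z ≡ true → Chain T u (xs ++ z ∷ []) z
  Chain-snoc []      e = e ∷ []
  Chain-snoc (d ∷ c) e = d ∷ Chain-snoc c e

  Chain-adjacent : ∀ {T u xs w} → Chain T u xs w → ∀ i → und T (lookup (u ∷ xs) (inject₁ i)) (lookup (u ∷ xs) (suc i)) ≡ true
  Chain-adjacent (d ∷ c) zero    = d
  Chain-adjacent (d ∷ c) (suc i) = Chain-adjacent c i

  Chain-last : ∀ {T u xs w} → Chain T u xs w → lookup (u ∷ xs) (fromℕ (length xs)) ≡ w
  Chain-last []      = refl
  Chain-last (d ∷ c) = Chain-last c

  chain-not-closed : ∀ {T} → Acyclic T → ∀ {v u x xs w} → Chain T v (u ∷ x ∷ xs) w → Unique (v ∷ u ∷ x ∷ xs) → und T w v ≡ true → ⊥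
  chain-not-closed {T} ac {v} {u} {x} {xs} c uniq e = ac (length xs) (lookup (v ∷ u ∷ x ∷ xs))
    ( (λ {i} {j} → lookup-injective uniq i j)
    , Chain-adjacent c
    , trans (cong (λ z → und T z v) (Chain-last c)) e)

module Grow {n : ℕ} (G : Digraph n) (T : Digraph n) (oriented : ∀ u v → adj T u v ≡ true → adj T v u ≡ false)
  (connected : Connected T) (acyclic : Acyclic T) where

  open Stage G public
  open import Data.List.Membership.DecPropositional (Fin._≟_ {n}) using (_∈?_)

  TE : Edge → Set
  TE (y , s , x) = Graph.Eg T s y x ≡ true

  Arc∈ : V → V → List Edge → Set
  Arc∈ u v es = (u , true , v) ∈ es ⊎ (v , false , u) ∈ es

  -- `complete` says that `T` has no arcs among these vertices besides the listed edges; acyclicity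
  -- preserves this when a vertex is added.
  record Spans (ρ : V) (es : List Edge) : Set where
    field
      uniq     : Unique (ρ ∷ map dst es)
      te       : All TE es
      complete : ∀ {u v} → u ∈ ρ ∷ map dst es → v ∈ ρ ∷ map dst es → adj T u v ≡ true → Arc∈ u v es

  Spans-↭ : ∀ {ρ es es′} → es ↭ es′ → Spans ρ es → Spans ρ es′
  Spans-↭ {ρ} p S = record
    { uniq = Unique-↭ q uniq
    ; te = All-↭ p te
    ; complete = λ u∈ v∈ e → [ inj₁ ∘ ∈-resp-↭ p , inj₂ ∘ ∈-resp-↭ p ]′
        (complete (∈-resp-↭ (↭-sym q) u∈) (∈-resp-↭ (↭-sym q) v∈) e) }
    where
    open Spans S
    q = prep ρ (↭.map⁺ dst p)

  insert : ∀ {y s x} y₀ F → y ∈ y₀ ∷ map dst (fe y₀ F) → ∃ λ F′ → fe y₀ F′ ↭ (y , s , x) ∷ fe y₀ F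
  insert {y} {s} {x} y₀ F (here refl) = (s , node x []) ∷ F , ↭-refl
  insert {y} {s} {x} y₀ ((s₁ , node z cs) ∷ F) (there y∈) = go (split y∈)
    where
    split : y ∈ z ∷ map dst (fe z cs ++ fe y₀ F) → y ∈ z ∷ map dst (fe z cs) ⊎ y ∈ map dst (fe y₀ F)
    split (here e) = inj₁ (here e)
    split (there q) with ∈-++⁻ (map dst (fe z cs)) (subst (y ∈_) (List.map-++ dst (fe z cs) (fe y₀ F)) q)
    ... | inj₁ a = inj₁ (there a)
    ... | inj₂ b = inj₂ b
    go : y ∈ z ∷ map dst (fe z cs) ⊎ y ∈ map dst (fe y₀ F) → ∃ λ F′ → fe y₀ F′ ↭ (y , s , x) ∷ (y₀ , s₁ , z) ∷ fe z cs ++ fe y₀ F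
    go (inj₁ a) = let cs′ , p = insert {y} {s} {x} z cs a in
      (s₁ , node z cs′) ∷ F , ↭-trans (prep _ (↭.++⁺ʳ (fe y₀ F) p)) (Permutation.swap _ _ ↭-refl)
    go (inj₂ b) = let F′ , p = insert {y} {s} {x} y₀ F (there b) in
      (s₁ , node z cs) ∷ F′ , ↭-trans (prep _ (↭-trans (↭.++⁺ˡ (fe z cs) p) (↭.shift _ (fe z cs) (fe y₀ F)))) (Permutation.swap _ _ ↭-refl)

  und-sym : ∀ u v → und T u v ≡ true → und T v u ≡ true
  und-sym u v e with adj T u v | adj T v u
  ... | true  | true  = refl
  ... | true  | false = refl
  ... | false | true  = refl

  TE⇒und : ∀ {y s x} → TE (y , s , x) → und T y x ≡ true
  TE⇒und {y} {true}  {x} e with adj T y x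
  ... | true = refl
  TE⇒und {y} {false} {x} e with adj T y x | adj T x y
  ... | true  | _    = refl
  ... | false | true = refl

  sign : ∀ u v → und T u v ≡ true → ∃ λ s → TE (u , s , v)
  sign u v e with adj T u v in eq | adj T v u in eq′
  ... | true  | _    = true , eq
  ... | false | true = false , eq′

  crossing : ∀ {u w} (ls : List V) → Walk T u w → u ∈ ls → w ∉ ls → ∃₂ λ y x → y ∈ ls × x ∉ ls × und T y x ≡ true
  crossing ls here u∈ w∉ = ⊥-elim (w∉ u∈)
  crossing ls (step {v = v} e wk) u∈ w∉ with v ∈? ls
  ... | yes v∈ = crossing ls wk v∈ w∉
  ... | no v∉  = _ , v , u∈ , v∉ , e

  -- Paths inside the part grown so far are carried along because `only-neighbour` closes one of
  -- them to a cycle.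
  Linked : List V → Set
  Linked ls = ∀ {u w} → u ∈ ls → w ∈ ls → ∃ λ xs → Chain T u xs w × Unique (u ∷ xs) × (∀ {z} → z ∈ u ∷ xs → z ∈ ls)

  Linked-∷ : ∀ {ls y x} → y ∈ ls → x ∉ ls → und T y x ≡ true → Linked ls → Linked (x ∷ ls)
  Linked-∷ {ls} {y} {x} y∈ x∉ e link = go
    where
    go : Linked (x ∷ ls)
    go (here refl) (here refl) = [] , [] , [] ∷ [] , λ { (here e) → here e }
    go (here refl) (there w∈) = let xs , c , u , sub = link y∈ w∈ in
      y ∷ xs , und-sym y x e ∷ c , All.tabulate (λ { z∈ refl → x∉ (sub z∈) }) ∷ u ,
      λ { (here e) → here e ; (there z∈) → there (sub z∈) }
    go {u = u₀} (there u∈) (here refl) = let xs , c , u , sub = link u∈ y∈ in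
      xs ++ x ∷ [] , Chain-snoc c e ,
      Unique.++⁺ u ([] ∷ []) (λ { (p , here refl) → x∉ (sub p) }) ,
      λ {z} z∈ → [ there ∘ sub , (λ { (here e) → here e }) ]′ (∈-++⁻ (u₀ ∷ xs) z∈)
    go (there u∈) (there w∈) = let xs , c , u , sub = link u∈ w∈ in xs , c , u , there ∘ sub

  -- A second neighbour of `x` would close a cycle: from `x` along the path between the two
  -- neighbours and back.
  only-neighbour : ∀ {ls y x w} → Linked ls → y ∈ ls → x ∉ ls → und T y x ≡ true → w ∈ ls → und T w x ≡ true → w ≡ y
  only-neighbour {ls} {y} {x} {w} link y∈ x∉ e w∈ e′ with link y∈ w∈
  ... | [] , [] , _ , _ = refl
  ... | x₁ ∷ xs , c , u , sub = ⊥-elim (chain-not-closed acyclic (und-sym y x e ∷ c)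
          (All.tabulate (λ { z∈ refl → x∉ (sub z∈) }) ∷ u) e′)

  Spans-∷ : ∀ {ρ es y s x} → y ∈ ρ ∷ map dst es → x ∉ ρ ∷ map dst es → TE (y , s , x) → Linked (ρ ∷ map dst es) →
    Spans ρ es → Spans ρ ((y , s , x) ∷ es)
  Spans-∷ {ρ} {es} {y} {s} {x} y∈ x∉ e link S = record
    { uniq = Unique-↭ (Permutation.swap x ρ ↭-refl) (All.tabulate (λ { z∈ refl → x∉ z∈ }) ∷ uniq)
    ; te = e ∷ te
    ; complete = λ u∈ v∈ a → compl (out u∈) (out v∈) a }
    where
    open Spans S
    ls = ρ ∷ map dst es
    out : ∀ {u} → u ∈ ρ ∷ x ∷ map dst es → u ≡ x ⊎ u ∈ ls
    out (here e)          = inj₂ (here e)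
    out (there (here e))  = inj₁ e
    out (there (there p)) = inj₂ (there p)
    arc⇒und : ∀ {u v} → adj T u v ≡ true → und T u v ≡ true
    arc⇒und {u} {v} a with adj T u v
    ... | true = refl
    new-out : ∀ s → TE (y , s , x) → adj T y x ≡ true → Arc∈ y x ((y , s , x) ∷ es)
    new-out true  e a = inj₁ (here refl)
    new-out false e a = ⊥-elim (true≢false e (oriented y x a))
    new-in : ∀ s → TE (y , s , x) → adj T x y ≡ true → Arc∈ x y ((y , s , x) ∷ es)
    new-in true  e a = ⊥-elim (true≢false e (oriented x y a))
    new-in false e a = inj₂ (here refl)
    compl : ∀ {u v} → u ≡ x ⊎ u ∈ ls → v ≡ x ⊎ v ∈ ls → adj T u v ≡ true → Arc∈ u v ((y , s , x) ∷ es)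
    compl (inj₁ refl) (inj₁ refl) a = ⊥-elim (true≢false a (loopless T x))
    compl (inj₂ u∈) (inj₂ v∈) a = [ inj₁ ∘ there , inj₂ ∘ there ]′ (complete u∈ v∈ a)
    compl {u} (inj₂ u∈) (inj₁ refl) a = let eq = only-neighbour link y∈ x∉ (TE⇒und {y} {s} e) u∈ (arc⇒und a) in
      subst (λ u → Arc∈ u x ((y , s , x) ∷ es)) (sym eq) (new-out s e (subst (λ u → adj T u x ≡ true) eq a))
    compl {u} {v} (inj₁ refl) (inj₂ v∈) a = let eq = only-neighbour link y∈ x∉ (TE⇒und {y} {s} e) v∈ (und-sym u v (arc⇒und a)) in
      subst (λ v → Arc∈ x v ((y , s , x) ∷ es)) (sym eq) (new-in s e (subst (λ v → adj T x v ≡ true) eq a))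

  record Grown-tree (ρ : V) : Set where
    field
      F     : Forest V
      spans : Spans ρ (fe ρ F)
      all∈  : ∀ z → z ∈ ρ ∷ map dst (fe ρ F)

  grow : ∀ k ρ F → Spans ρ (fe ρ F) → Linked (ρ ∷ map dst (fe ρ F)) → length (ρ ∷ map dst (fe ρ F)) + k ≡ n → Grown-tree ρ
  grow k ρ F S link e with Fin.all? (λ z → z ∈? (ρ ∷ map dst (fe ρ F)))
  ... | yes all∈ = record { F = F ; spans = S ; all∈ = all∈ }
  grow zero ρ F S link e | no ¬all = ⊥-elim (¬all (Unique-length (Spans.uniq S) (trans (sym (+-identityʳ _)) e)))
  grow (suc k) ρ F S link e | no ¬all =
    let z , z∉ = Fin.¬∀⟶∃¬ n _ (λ z → z ∈? ls) ¬all
        y , x , y∈ , x∉ , d = crossing ls (connected ρ z) (here refl) z∉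
        s , te = sign y x d
        F′ , p = insert {y} {s} {x} ρ F y∈
    in grow k ρ F′ (Spans-↭ (↭-sym p) (Spans-∷ y∈ x∉ te link S))
         (Linked-↭ (↭-trans (Permutation.swap x ρ ↭-refl) (prep ρ (↭.map⁺ dst (↭-sym p)))) (Linked-∷ y∈ x∉ d link))
         (trans (cong (λ l → suc l + k) (trans (↭.↭-length (↭.map⁺ dst p)) refl)) (trans (sym (+-suc _ k)) e))
    where
    ls = ρ ∷ map dst (fe ρ F)
    Linked-↭ : ∀ {ls ls′} → ls ↭ ls′ → Linked ls → Linked ls′
    Linked-↭ p link u∈ w∈ = let xs , c , u , sub = link (∈-resp-↭ (↭-sym p) u∈) (∈-resp-↭ (↭-sym p) w∈) in
      xs , c , u , λ z∈ → ∈-resp-↭ p (sub z∈)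

  grown : ∀ ρ → Grown-tree ρ
  grown ρ = grow (pred n) ρ [] record { uniq = [] ∷ [] ; te = [] ; complete = λ { (here refl) (here refl) a → ⊥-elim (true≢false a (loopless T ρ)) } }
      (λ { (here refl) (here refl) → [] , [] , [] ∷ [] , λ { (here e) → here e } })
      (suc-pred n {{Fin.nonZeroIndex ρ}})

-- Re-rooting

module _ {A : Set} where

  size-++ : ∀ (F F′ : Forest A) → size (F ++ F′) ≡ size F + size F′
  size-++ [] F′ = refl
  size-++ ((s , node x cs) ∷ F) F′ = cong suc (trans (cong (size cs +_) (size-++ F F′)) (sym (+-assoc (size cs) _ _)))

  tsize : Tree A → ℕ
  tsize (node x cs) = suc (size cs)

  root : Tree A → A
  root (node x cs) = x

  few : List A → ℕ
  few []          = 1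
  few (_ ∷ [])    = 1
  few (_ ∷ _ ∷ _) = 0

  few≤1 : ∀ xs → few xs ≤ 1
  few≤1 []          = ≤-refl
  few≤1 (_ ∷ [])    = ≤-refl
  few≤1 (_ ∷ _ ∷ _) = z≤n

module _ {A : Set} where

  -- the number of vertices with at most one child, in the whole forest and among its roots
  low top : Forest A → ℕ
  low []                    = 0
  low ((s , node x cs) ∷ F) = few cs + low cs + low F
  top []                    = 0
  top ((s , node x cs) ∷ F) = few cs + top F

  top≤length : ∀ F → top F ≤ length F
  top≤length []                    = z≤n
  top≤length ((s , node x cs) ∷ F) = +-mono-≤ (few≤1 cs) (top≤length F)

  -- Each vertex has two children or is counted in `low`, so 2 is at most twice its indicator plus
  -- its number of children. Summed over the forest, the children are all vertices except the roots.
  size≤low : ∀ F → size F + length F ≤ 2 * low F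
  size≤low []                    = z≤n
  size≤low ((s , node x cs) ∷ F) = begin
    suc (size cs + size F) + suc (length F)          ≡⟨ e₁ (size cs) (size F) (length F) ⟩
    2 + (size cs + (size F + length F))              ≤⟨ +-monoˡ-≤ _ (two cs) ⟩
    2 * few cs + length cs + (size cs + (size F + length F)) ≡⟨ e₂ (few cs) (length cs) (size cs) (size F + length F) ⟩
    2 * few cs + (size cs + length cs) + (size F + length F) ≤⟨ +-mono-≤ (+-monoʳ-≤ (2 * few cs) (size≤low cs)) (size≤low F) ⟩
    2 * few cs + 2 * low cs + 2 * low F              ≡⟨ e₃ (few cs) (low cs) (low F) ⟩
    2 * (few cs + low cs + low F)                    ∎
    where
    open ≤-Reasoning
    e₁ : ∀ a b c → suc (a + b) + suc c ≡ 2 + (a + (b + c))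
    e₁ = solve-∀
    e₂ : ∀ f l s t → 2 * f + l + (s + t) ≡ 2 * f + (s + l) + t
    e₂ = solve-∀
    e₃ : ∀ a b c → 2 * a + 2 * b + 2 * c ≡ 2 * (a + b + c)
    e₃ = solve-∀
    two : ∀ (cs : Forest A) → 2 ≤ 2 * few cs + length cs
    two []          = ≤-refl
    two (_ ∷ [])    = s≤s (s≤s z≤n)
    two (_ ∷ _ ∷ _) = s≤s (s≤s z≤n)

  low-++ : ∀ F F′ → low (F ++ F′) ≡ low F + low F′
  low-++ [] F′ = refl
  low-++ ((s , node x cs) ∷ F) F′ = trans (cong (few cs + low cs +_) (low-++ F F′)) (sym (+-assoc (few cs + low cs) _ _))

  data Bd (D : ℕ) : Forest A → Set where
    []  : Bd D []
    _∷_ : ∀ {s x cs F} → length cs ≤ D × Bd D cs → Bd D F → Bd D ((s , node x cs) ∷ F)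

  Bd-++⁺ : ∀ {D F F′} → Bd D F → Bd D F′ → Bd D (F ++ F′)
  Bd-++⁺ []      b′ = b′
  Bd-++⁺ (a ∷ b) b′ = a ∷ Bd-++⁺ b b′

  Bd-++⁻ : ∀ {D} F {F′} → Bd D (F ++ F′) → Bd D F × Bd D F′
  Bd-++⁻ []      b       = [] , b
  Bd-++⁻ (_ ∷ F) (a ∷ b) = let b₁ , b₂ = Bd-++⁻ F b in a ∷ b₁ , b₂

  levels-bound : ∀ {D} d F → Bd D F → levels d F ≤ length F * suc D ^ d
  levels-bound zero    F  b = z≤n
  levels-bound (suc d) [] b = z≤n
  levels-bound {D} (suc d) ((s , node x cs) ∷ F) ((l , b) ∷ b′) = begin
    suc (levels d cs + levels (suc d) F)                    ≤⟨ s≤s (+-mono-≤ (levels-bound d cs b) (levels-bound (suc d) F b′)) ⟩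
    1 + (length cs * suc D ^ d + length F * suc D ^ suc d)  ≤⟨ +-mono-≤ (m^n>0 (suc D) d) (+-monoˡ-≤ _ (*-monoˡ-≤ (suc D ^ d) l)) ⟩
    suc D ^ d + (D * suc D ^ d + length F * suc D ^ suc d)  ≡⟨ sym (+-assoc (suc D ^ d) _ _) ⟩
    suc D ^ suc d + length F * suc D ^ suc d                ∎
    where open ≤-Reasoning

  data Occ (q : A) (ds : Forest A) : Forest A → Set where
    here : ∀ {s F} → Occ q ds ((s , node q ds) ∷ F)
    down : ∀ {s x cs F} → Occ q ds cs → Occ q ds ((s , node x cs) ∷ F)
    next : ∀ {t F} → Occ q ds F → Occ q ds (t ∷ F)

  Occ-++ʳ : ∀ {q ds} F {F′} → Occ q ds F′ → Occ q ds (F ++ F′)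
  Occ-++ʳ []      o = o
  Occ-++ʳ (_ ∷ F) o = next (Occ-++ʳ F o)

  Occ-weaken : ∀ {q ds t} F {F′} → Occ q ds (F ++ F′) → Occ q ds (F ++ t ∷ F′)
  Occ-weaken []      o        = next o
  Occ-weaken (_ ∷ F) here     = here
  Occ-weaken (_ ∷ F) (down o) = down o
  Occ-weaken (_ ∷ F) (next o) = next (Occ-weaken F o)

  heads : Forest A → List (Bool × A)
  heads = map (λ (s , t) → s , root t)

  data Split : Forest A → Set where
    leaf  : ∀ pre {sq q} post → Split (pre ++ (sq , node q []) ∷ post)
    unary : ∀ pre {sq q sc c es} post → Split (pre ++ (sq , node q ((sc , node c es) ∷ [])) ∷ post)
    none  : ∀ {F} → top F ≡ 0 → Split F

  split? : ∀ F → Split F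
  split? [] = none refl
  split? ((s , node x []) ∷ F) = leaf [] F
  split? ((s , node x ((s′ , node c es) ∷ [])) ∷ F) = unary [] F
  split? (t@(s , node x (_ ∷ _ ∷ _)) ∷ F) with split? F
  ... | leaf pre post  = leaf (t ∷ pre) post
  ... | unary pre post = unary (t ∷ pre) post
  ... | none e         = none e

  data Big (k : ℕ) : Forest A → Set where
    big   : ∀ pre {s z ds} post → k ≤ suc (size ds) → Big k (pre ++ (s , node z ds) ∷ post)
    small : ∀ {F} → All (λ t → tsize (proj₂ t) < k) F → Big k F

  big? : ∀ k F → Big k F
  big? k [] = small []
  big? k (t@(s , node z ds) ∷ F) with k ≤? suc (size ds) | big? k F
  ... | yes le | _            = big [] F le
  ... | no _   | big pre post le = big (t ∷ pre) post le
  ... | no gt  | small a      = small (≰⇒> gt ∷ a)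

  size-small : ∀ {k} {F : Forest A} → All (λ t → tsize (proj₂ t) < k) F → size F ≤ length F * k
  size-small [] = z≤n
  size-small {k} {(s , node z ds) ∷ F} (lt ∷ a) = +-mono-≤ (<⇒≤ lt) (size-small a)

module Plan {n : ℕ} (G : Digraph n) (T : Digraph n) (oriented : ∀ u v → adj T u v ≡ true → adj T v u ≡ false)
  (connected : Connected T) (acyclic : Acyclic T) where

  open Grow G T oriented connected acyclic public

  fe-++ : ∀ y F F′ → fe y (F ++ F′) ≡ fe y F ++ fe y F′
  fe-++ y [] F′ = refl
  fe-++ y ((s , node x cs) ∷ F) F′ = cong ((y , s , x) ∷_) (trans (cong (fe x cs ++_) (fe-++ y F F′)) (sym (List.++-assoc (fe x cs) _ _)))

  fe-middle : ∀ p pre {sq q ds} post → fe p (pre ++ (sq , node q ds) ∷ post) ↭ (p , sq , q) ∷ fe q ds ++ fe p (pre ++ post)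
  fe-middle p pre {sq} {q} {ds} post = ↭-trans (↭-reflexive (fe-++ p pre _)) (↭-trans
    (↭.shifts (fe p pre) ((p , sq , q) ∷ fe q ds)) (↭-reflexive (cong (λ z → (p , sq , q) ∷ fe q ds ++ z) (sym (fe-++ p pre post)))))

  Par-fe : ∀ {ds y} F → y ∈ ds → Par ds (fe y F)
  Par-fe [] y∈ = []
  Par-fe ((s , node x cs) ∷ F) y∈ = y∈ ∷ Par-++ (Par-fe cs (here refl)) (λ sub → Par-fe F (sub (inj₁ (there y∈))))

  Eg-flipT : ∀ s u v → Graph.Eg T (not s) u v ≡ Graph.Eg T s v u
  Eg-flipT = Graph.Eg-flip T

  Spans-flip : ∀ {x s z es} → Spans x ((x , s , z) ∷ es) → Spans z ((z , not s , x) ∷ es)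
  Spans-flip {x} {s} {z} {es} S = record
    { uniq = Unique-↭ (Permutation.swap x z ↭-refl) uniq
    ; te = trans (Eg-flipT s z x) (All.head te) ∷ All.tail te
    ; complete = λ u∈ v∈ a → [ fst s , snd s ]′ (complete (ex u∈) (ex v∈) a) }
    where
    open Spans S
    ex : ∀ {u} → u ∈ z ∷ x ∷ map dst es → u ∈ x ∷ z ∷ map dst es
    ex (here e)          = there (here e)
    ex (there (here e))  = here e
    ex (there (there p)) = there (there p)
    fst : ∀ s {u v} → (u , true , v) ∈ (x , s , z) ∷ es → Arc∈ u v ((z , not s , x) ∷ es)
    fst s (here refl) = inj₂ (here refl)
    fst s (there p)   = inj₁ (there p)
    snd : ∀ s {u v} → (v , false , u) ∈ (x , s , z) ∷ es → Arc∈ u v ((z , not s , x) ∷ es)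
    snd s (here refl) = inj₁ (here refl)
    snd s (there p)   = inj₂ (there p)

  -- `cs` and `v` together have at least k vertices, yet every branch in `cs` has fewer than k, so a
  -- bound on the degree bounds their number. The rest of the tree is at most one branch, `behind`;
  -- with `v` as root it can be embedded afterwards, parents first.
  record Rooted (k : ℕ) : Set where
    field
      v      : V
      behind : Forest V
      cs     : Forest V
      single-behind : length behind ≤ 1
      spans  : Spans v (fe v (behind ++ cs))
      light  : All (λ t → tsize (proj₂ t) < k) cs
      heavy  : k ≤ suc (size cs)
      total  : size behind + size cs ≡ pred n

  -- Move the root downwards as long as some subtree has at least k vertices.
  reroot : ∀ fuel k x bk cs → size cs ≤ fuel → length bk ≤ 1 → Spans x (fe x (bk ++ cs)) → k ≤ suc (size cs) →
    size bk + size cs ≡ pred n → Rooted k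
  reroot fuel k x bk cs le b≤ S hv tot with big? k cs
  ... | small a = record { v = x ; behind = bk ; cs = cs ; single-behind = b≤ ; spans = S ; light = a ; heavy = hv ; total = tot }
  reroot zero k x bk .(pre ++ (s , node z ds) ∷ post) le b≤ S hv tot | big pre {s} {z} {ds} post kz =
    ⊥-elim (<-irrefl refl (<-≤-trans (≤-trans (s≤s z≤n) (m≤n+m _ (size pre))) (≤-trans (≤-reflexive (sym (size-++ pre _))) le)))
  reroot (suc fuel) k x bk .(pre ++ (s , node z ds) ∷ post) le b≤ S hv tot | big pre {s} {z} {ds} post kz =
    reroot fuel k z ((not s , node x (bk ++ pre ++ post)) ∷ []) ds (≤-pred (≤-trans less le)) ≤-refl spans′ kz total′
    where
    sz : size (pre ++ (s , node z ds) ∷ post) ≡ size pre + suc (size ds + size post)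
    sz = size-++ pre _
    less : size ds < size (pre ++ (s , node z ds) ∷ post)
    less = ≤-trans (s≤s (m≤m+n (size ds) (size post))) (≤-trans (m≤n+m _ (size pre)) (≤-reflexive (sym sz)))
    total′ : suc (size (bk ++ pre ++ post) + 0) + size ds ≡ pred n
    total′ = trans (cong (λ t → suc (t + 0) + size ds) (trans (size-++ bk _) (cong (size bk +_) (size-++ pre post))))
      (trans (e (size bk) (size pre) (size post) (size ds)) (trans (cong (size bk +_) (sym sz)) tot))
      where e : ∀ b p q d → suc (b + (p + q) + 0) + d ≡ b + (p + suc (d + q))
            e = solve-∀
    spans′ : Spans z (fe z ((not s , node x (bk ++ pre ++ post)) ∷ [] ++ ds))
    spans′ = Spans-↭ (prep (z , not s , x) (↭.++-comm (fe z ds) (fe x (bk ++ pre ++ post))))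
      (Spans-flip {x} {s} (Spans-↭ (↭-trans (↭-reflexive (cong (fe x) (sym (List.++-assoc bk pre _))))
        (↭-trans (fe-middle x (bk ++ pre) post) (↭-reflexive (cong (λ F → (x , s , z) ∷ fe z ds ++ fe x F) (List.++-assoc bk pre post))))) S))

  roots : Forest V → List V
  roots = map (root ∘ proj₂)

  roots⊆ : ∀ {y} F {z} → z ∈ roots F → z ∈ map dst (fe y F)
  roots⊆ ((s , node x cs) ∷ F) (here refl) = here refl
  roots⊆ {y} ((s , node x cs) ∷ F) {z} (there p) =
    there (subst (z ∈_) (sym (List.map-++ dst (fe x cs) (fe y F))) (∈-++⁺ʳ (map dst (fe x cs)) (roots⊆ F p)))

  Unique-parts : ∀ {y s x cs F} → Unique (map dst (fe y ((s , node x cs) ∷ F))) →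
    Unique (x ∷ map dst (fe x cs)) × Unique (x ∷ map dst (fe y F)) × (∀ {z} → z ∈ map dst (fe x cs) → z ∉ map dst (fe y F))
  Unique-parts {y} {s} {x} {cs} {F} u = Unique-++ˡ (x ∷ map dst (fe x cs)) u′ ,
      All.++⁻ʳ (map dst (fe x cs)) (Unique-head u′) ∷ Unique-++ʳ (map dst (fe x cs)) (Unique-++ʳ (x ∷ []) u′) ,
      Unique-disjoint (map dst (fe x cs)) (Unique-++ʳ (x ∷ []) u′)
    where
    u′ : Unique (x ∷ map dst (fe x cs) ++ map dst (fe y F))
    u′ = subst (λ l → Unique (x ∷ l)) (List.map-++ dst (fe x cs) (fe y F)) u

  children≤ : ∀ y F → Unique (map dst (fe y F)) → All TE (fe y F) → length F ≤ deg T y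
  children≤ y F u te = ≤-trans (≤-reflexive (sym (List.length-map _ F))) (Unique-count (und T y) (roots F) (uroots F u) (nbrs F te))
    where
    uroots : ∀ F → Unique (map dst (fe y F)) → Unique (roots F)
    uroots [] u = []
    uroots ((s , node x cs) ∷ F) u = let _ , u₂ , _ = Unique-parts {y} {s} {x} {cs} {F} u in
      All.tabulate (λ z∈ e → All.lookup (Unique-head u₂) (roots⊆ F z∈) e) ∷ uroots F (Unique-++ʳ (x ∷ []) u₂)
    nbrs : ∀ F → All TE (fe y F) → All (λ z → und T y z ≡ true) (roots F)
    nbrs [] te = []
    nbrs ((s , node x cs) ∷ F) (t ∷ te) = TE⇒und {y} {s} t ∷ nbrs F (All.++⁻ʳ (fe x cs) te)

  bounded : ∀ {D} → (∀ v → deg T v ≤ D) → ∀ y F → Unique (map dst (fe y F)) → All TE (fe y F) → Bd D F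
  bounded Δ y [] u te = []
  bounded Δ y ((s , node x cs) ∷ F) u (t ∷ te) =
    let u₁′ , u₂′ , _ = Unique-parts {y} {s} {x} {cs} {F} u
        u₁ = Unique-++ʳ (x ∷ []) u₁′
        u₂ = Unique-++ʳ (x ∷ []) u₂′
        te₁ = All.++⁻ˡ (fe x cs) te
    in (≤-trans (children≤ x cs u₁ te₁) (Δ x) , bounded Δ x cs u₁ te₁) ∷ bounded Δ y F u₂ (All.++⁻ʳ (fe x cs) te)

  sources : ∀ {y F e} → e ∈ fe y F → (src e ≡ y × (proj₁ (proj₂ e) , dst e) ∈ heads F) ⊎ src e ∈ map dst (fe y F)
  sources {F = (s , node x cs) ∷ F} (here refl) = inj₁ (refl , here refl)
  sources {y} {(s , node x cs) ∷ F} (there p) with ∈-++⁻ (fe x cs) p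
  ... | inj₁ q with sources {x} {cs} q
  ...   | inj₁ (e , _) = inj₂ (here e)
  ...   | inj₂ r = inj₂ (there (subst (_ ∈_) (sym (List.map-++ dst (fe x cs) (fe y F))) (∈-++⁺ˡ r)))
  sources {y} {(s , node x cs) ∷ F} (there p) | inj₂ q with sources {y} {F} q
  ...   | inj₁ (e , h) = inj₁ (e , there h)
  ...   | inj₂ r = inj₂ (there (subst (_ ∈_) (sym (List.map-++ dst (fe x cs) (fe y F))) (∈-++⁺ʳ (map dst (fe x cs)) r)))

  Occ-∈ : ∀ {q ds y F} → Occ q ds F → q ∈ map dst (fe y F)
  Occ-∈ here = here refl
  Occ-∈ {q} {y = y} {(s , node x cs) ∷ F} (down o) = there (subst (q ∈_) (sym (List.map-++ dst (fe x cs) (fe y F))) (∈-++⁺ˡ (Occ-∈ o)))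
  Occ-∈ {q} {y = y} {(s , node x cs) ∷ F} (next o) = there (subst (q ∈_) (sym (List.map-++ dst (fe x cs) (fe y F))) (∈-++⁺ʳ (map dst (fe x cs)) (Occ-∈ o)))

  Kids : V → Forest V → List Edge → Set
  Kids q ds es = ∀ {e} → e ∈ es → src e ≡ q → (proj₁ (proj₂ e) , dst e) ∈ heads ds

  no-source : ∀ {q y F e} → e ∈ fe y F → y ≢ q → q ∉ map dst (fe y F) → src e ≢ q
  no-source {q} {y} {F} {e} e∈ y≢ q∉ eq = [ (λ (e≡ , _) → y≢ (trans (sym e≡) eq)) , (λ r → q∉ (subst (_∈ map dst (fe y F)) eq r)) ]′ (sources {y} {F} {e} e∈)

  -- The labels are distinct, so `q` occurs once and only its own children hang from it. This yields
  -- the part of `Local` about edges starting at `q`.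
  Occ-kids : ∀ {q ds y F} → Unique (y ∷ map dst (fe y F)) → Occ q ds F → Kids q ds (fe y F)
  Occ-kids {q} {ds} {y} {(s , node x cs) ∷ F} u o {e} e∈ eq = cases e∈ o
    where
    parts = Unique-parts {y} {s} {x} {cs} {F} (Unique-++ʳ (y ∷ []) u)
    u₁ = proj₁ parts
    u₂ = proj₁ (proj₂ parts)
    dis : ∀ {z} → z ∈ map dst (fe x cs) → z ∉ map dst (fe y F)
    dis = proj₂ (proj₂ parts)
    y≢ : y ≢ q
    y≢ e′ = All.lookup (Unique-head u) (Occ-∈ {y = y} o) e′
    uF : Unique (y ∷ map dst (fe y F))
    uF = All.tabulate (λ { z∈ refl → All.lookup (Unique-head u) (there (subst (y ∈_) (sym (List.map-++ dst (fe x cs) (fe y F)))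
      (∈-++⁺ʳ (map dst (fe x cs)) z∈))) refl }) ∷ Unique-++ʳ (x ∷ []) u₂
    inside : q ≡ x → ∀ {z} → z ∈ map dst (fe x cs) → z ≢ q
    inside refl z∈ e′ = All.lookup (Unique-head u₁) z∈ (sym e′)
    cases : e ∈ (y , s , x) ∷ fe x cs ++ fe y F → Occ q ds ((s , node x cs) ∷ F) → (proj₁ (proj₂ e) , dst e) ∈ heads ds
    cases (here refl) o = ⊥-elim (y≢ eq)
    cases (there p) o with ∈-++⁻ (fe x cs) p
    cases (there p) here | inj₁ a = [ proj₂ , (λ r → ⊥-elim (inside refl r eq)) ]′ (sources {x} {cs} {e} a)
    cases (there p) here | inj₂ b = ⊥-elim (no-source b y≢ (λ q∈ → All.lookup (Unique-head u₂) q∈ refl) eq)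
    cases (there p) (down o) | inj₁ a = Occ-kids u₁ o a eq
    cases (there p) (down o) | inj₂ b = ⊥-elim (no-source b y≢ (dis (Occ-∈ o)) eq)
    cases (there p) (next o) | inj₁ a = ⊥-elim (no-source a (λ e′ → All.lookup (Unique-head u₂) (Occ-∈ {y = y} o) e′) (λ q∈ → dis q∈ (Occ-∈ {y = y} o)) eq)
    cases (there p) (next o) | inj₂ b = Occ-kids uF o b eq

-- Cutting the tree

module Layouts {n : ℕ} (G : Digraph n) (T : Digraph n) (oriented : ∀ u v → adj T u v ≡ true → adj T v u ≡ false)
  (connected : Connected T) (acyclic : Acyclic T) where

  open Plan G T oriented connected acyclic public

  be-++ : ∀ bs bs′ → be (bs ++ bs′) ≡ be bs ++ be bs′
  be-++ []       bs′ = refl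
  be-++ (b ∷ bs) bs′ = trans (cong (bedges b ++_) (be-++ bs bs′)) (sym (List.++-assoc (bedges b) _ _))

  absOf-++ : ∀ bs bs′ → absOf (bs ++ bs′) ≡ absOf bs ++ absOf bs′
  absOf-++ []              bs′ = refl
  absOf-++ (single e ∷ bs) bs′ = absOf-++ bs bs′
  absOf-++ (absb y s A ∷ bs) bs′ = cong (A ∷_) (absOf-++ bs bs′)

  pe-++ : ∀ ps ps′ → pe (ps ++ ps′) ≡ pe ps ++ pe ps′
  pe-++ []                 ps′ = refl
  pe-++ ((y , s , t) ∷ ps) ps′ = trans (cong (fe y ((s , t) ∷ []) ++_) (pe-++ ps ps′)) (sym (List.++-assoc (fe y ((s , t) ∷ [])) _ _))

  star : V → List (Bool × V) → List Edge
  star q = map (λ (s , c) → q , s , c)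

  From : Forest V → Absorber → Set
  From F A = ∃ λ ds → Occ (Absorber.q A) ds F × Absorber.cs A ≡ heads ds

  -- In `many` the roots of `F` are exempt: their parent `y` is placed beforehand, whereas the `p`
  -- of an absorber is placed in the same batch as its `q`.
  record Batched (D : ℕ) (y : V) (F : Forest V) : Set where
    field
      bs    : List Batch
      edges : be bs ↭ fe y F
      par   : ∀ {L} → y ∈ L → Par L (be bs)
      slim  : All Slim (absOf bs)
      from  : All (From F) (absOf bs)
      many  : low F ≤ 3 * D * length (absOf bs) + top F

  -- the descendants of q below its children
  record Below (D : ℕ) (q : V) (ds : Forest V) : Set where
    field
      bs    : List Batch
      edges : star q (heads ds) ++ be bs ↭ fe q ds
      par   : ∀ {L} → (∀ {z} → z ∈ map proj₂ (heads ds) → z ∈ L) → Par L (be bs)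
      slim  : All Slim (absOf bs)
      from  : All (From ds) (absOf bs)
      many  : low ds ≤ 3 * D * length (absOf bs) + (1 + D)
      short : length (heads ds) ≤ 1

  length-absOf-++ : ∀ bs bs′ → length (absOf (bs ++ bs′)) ≡ length (absOf bs) + length (absOf bs′)
  length-absOf-++ bs bs′ = trans (cong length (absOf-++ bs bs′)) (List.length-++ (absOf bs))

  All-absOf-++ : ∀ {P : Absorber → Set} bs {bs′} → All P (absOf bs) → All P (absOf bs′) → All P (absOf (bs ++ bs′))
  All-absOf-++ bs {bs′} a b = subst (All _) (sym (absOf-++ bs bs′)) (All.++⁺ a b)

  below-[] : ∀ {D q} → Below D q []
  below-[] = record { bs = [] ; edges = ↭-refl ; par = λ _ → [] ; slim = [] ; from = [] ; many = z≤n ; short = z≤n }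

  below-one : ∀ {D q sc c es} → length es ≤ D → Batched D c es → Below D q ((sc , node c es) ∷ [])
  below-one {D} {q} {sc} {c} {es} l B = record
    { bs = bs
    ; edges = prep (q , sc , c) (↭-trans edges (↭-reflexive (sym (List.++-identityʳ (fe c es)))))
    ; par = λ sub → par (sub (here refl))
    ; slim = slim
    ; from = All.map (λ (ds , o , e) → ds , down o , e) from
    ; many = begin
        few es + low es + 0                         ≡⟨ +-identityʳ _ ⟩
        few es + low es                             ≤⟨ +-mono-≤ (few≤1 es) (≤-trans many (+-monoʳ-≤ (3 * D * a) (≤-trans (top≤length es) l))) ⟩
        1 + (3 * D * a + D)                         ≡⟨ e (3 * D * a) D ⟩
        3 * D * a + (1 + D)                         ∎
    ; short = ≤-refl }
    where
    open Batched B
    open ≤-Reasoning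
    a = length (absOf bs)
    e : ∀ x D → 1 + (x + D) ≡ x + (1 + D)
    e = solve-∀

  batched-single : ∀ {D y s x cs F} → top cs ≡ 0 → Batched D x cs → Batched D y F → Batched D y ((s , node x cs) ∷ F)
  batched-single {D} {y} {s} {x} {cs} {F} t B₁ B₂ = record
    { bs = single (y , s , x) ∷ B₁.bs ++ B₂.bs
    ; edges = prep (y , s , x) (↭-trans (↭-reflexive (be-++ B₁.bs B₂.bs)) (↭.++⁺ B₁.edges B₂.edges))
    ; par = λ y∈ → y∈ ∷ subst (Par _) (sym (be-++ B₁.bs B₂.bs)) (Par-++ (B₁.par (here refl)) (λ sub → B₂.par (sub (inj₁ (there y∈)))))
    ; slim = All-absOf-++ B₁.bs B₁.slim B₂.slim
    ; from = All-absOf-++ B₁.bs (All.map (λ (ds , o , e) → ds , down o , e) B₁.from) (All.map (λ (ds , o , e) → ds , next o , e) B₂.from)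
    ; many = begin
        few cs + low cs + low F ≤⟨ +-mono-≤ (+-monoʳ-≤ (few cs) B₁.many) B₂.many ⟩
        few cs + (3 * D * a + top cs) + (3 * D * b + top F) ≡⟨ cong (λ t → few cs + (3 * D * a + t) + (3 * D * b + top F)) t ⟩
        few cs + (3 * D * a + 0) + (3 * D * b + top F) ≡⟨ e (few cs) D a b (top F) ⟩
        3 * D * (a + b) + (few cs + top F) ≡⟨ cong (λ k → 3 * D * k + (few cs + top F)) (sym (length-absOf-++ B₁.bs B₂.bs)) ⟩
        3 * D * length (absOf (B₁.bs ++ B₂.bs)) + (few cs + top F) ∎ }
    where
    module B₁ = Batched B₁
    module B₂ = Batched B₂
    open ≤-Reasoning
    a = length (absOf B₁.bs)
    b = length (absOf B₂.bs)
    e : ∀ f D a b t → f + (3 * D * a + 0) + (3 * D * b + t) ≡ 3 * D * (a + b) + (f + t)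
    e = solve-∀

  Par-star : ∀ {L q} hs → q ∈ L → Par L (star q hs)
  Par-star []       q∈ = []
  Par-star (h ∷ hs) q∈ = q∈ ∷ Par-star hs (there q∈)

  dst-star : ∀ q hs → map dst (star q hs) ≡ map proj₂ hs
  dst-star q []       = refl
  dst-star q (h ∷ hs) = cong (proj₂ h ∷_) (dst-star q hs)

  -- An absorber wastes at most 2D + 2 vertices with at most one child: `q`, its child, at most D
  -- grandchildren and at most D siblings. This is at most 3D since D ≥ 2; the vertex `p` is
  -- accounted for in `top`.
  batched-absorber : ∀ {D y s p sq q ds F} pre post → 2 ≤ D → length (pre ++ post) ≤ D →
    Below D q ds → Batched D p (pre ++ post) → Batched D y F →
    Batched D y ((s , node p (pre ++ (sq , node q ds) ∷ post)) ∷ F)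
  batched-absorber {D} {y} {s} {p} {sq} {q} {ds} {F} pre post 2≤D l B₀ B₁ B₂ = record
    { bs = absb y s A ∷ rest
    ; edges = prep (y , s , p) (↭-trans (↭-trans (prep (p , sq , q) (↭-trans
          (↭-reflexive (trans (cong (hs ++_) (trans (be-++ B₀.bs _) (cong (be B₀.bs ++_) (be-++ B₁.bs B₂.bs)))) (sym (List.++-assoc hs _ _))))
          (↭-trans (↭.++⁺ B₀.edges (↭.++⁺ B₁.edges B₂.edges)) (↭-reflexive (sym (List.++-assoc (fe q ds) _ _))))))
          ↭-refl) (↭.++⁺ʳ (fe y F) (↭-sym (fe-middle p pre post))))
    ; par = λ {L} y∈ → y∈ ∷ (here refl ∷ Par-++ (Par-star (heads ds) (here refl))
        (λ {L₁} sub → subst (Par L₁) (sym (be-++ B₀.bs (B₁.bs ++ B₂.bs)))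
          (Par-++ (B₀.par (λ {z} z∈ → sub (inj₂ (subst (z ∈_) (sym (dst-star q (heads ds))) z∈))))
            (λ {L₂} sub₂ → subst (Par L₂) (sym (be-++ B₁.bs B₂.bs))
              (Par-++ (B₁.par (sub₂ (inj₁ (sub (inj₁ (there (here refl)))))))
                (λ sub₃ → B₂.par (sub₃ (inj₁ (sub₂ (inj₁ (sub (inj₁ (there (there y∈))))))))))))))
    ; slim = B₀.short ∷ All-absOf-++ B₀.bs B₀.slim (All-absOf-++ B₁.bs B₁.slim B₂.slim)
    ; from = (ds , down (Occ-++ʳ pre here) , refl) ∷ All-absOf-++ B₀.bs
        (All.map (λ (es , o , e) → es , down (Occ-++ʳ pre (down o)) , e) B₀.from)
        (All-absOf-++ B₁.bs (All.map (λ (es , o , e) → es , down (Occ-weaken pre o) , e) B₁.from)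
          (All.map (λ (es , o , e) → es , next o , e) B₂.from))
    ; many = begin
        f + low (pre ++ (sq , node q ds) ∷ post) + low F
          ≡⟨ cong (λ k → f + k + low F) (trans (low-++ pre _) (trans (e₀ (low pre) (few ds) (low ds) (low post)) (cong (few ds + low ds +_) (sym (low-++ pre post))))) ⟩
        f + (few ds + low ds + low (pre ++ post)) + low F
          ≤⟨ +-mono-≤ (+-monoʳ-≤ f (+-mono-≤ (+-mono-≤ (few≤1 ds) B₀.many)
               (≤-trans B₁.many (+-monoʳ-≤ (3 * D * b) (≤-trans (top≤length (pre ++ post)) l))))) B₂.many ⟩
        f + (1 + (3 * D * a + (1 + D)) + (3 * D * b + D)) + (3 * D * c + top F)
          ≡⟨ e₁ f D a b c (top F) ⟩
        2 + (2 * D + 3 * D * (a + (b + c)) + (f + top F))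
          ≤⟨ +-monoˡ-≤ _ 2≤D ⟩
        D + (2 * D + 3 * D * (a + (b + c)) + (f + top F))
          ≡⟨ e₂ D (a + (b + c)) (f + top F) ⟩
        3 * D * suc (a + (b + c)) + (f + top F)
          ≡⟨ cong (λ k → 3 * D * suc k + (f + top F)) (sym (trans (length-absOf-++ B₀.bs _) (cong (a +_) (length-absOf-++ B₁.bs B₂.bs)))) ⟩
        3 * D * suc (length (absOf rest)) + (f + top F) ∎ }
    where
    module B₀ = Below B₀
    module B₁ = Batched B₁
    module B₂ = Batched B₂
    open ≤-Reasoning
    A = absorber p q sq (heads ds)
    hs = star q (heads ds)
    rest = B₀.bs ++ B₁.bs ++ B₂.bs
    f = few (pre ++ (sq , node q ds) ∷ post)
    a = length (absOf B₀.bs)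
    b = length (absOf B₁.bs)
    c = length (absOf B₂.bs)
    e₀ : ∀ x f d z → x + (f + d + z) ≡ f + d + (x + z)
    e₀ = solve-∀
    e₁ : ∀ f D a b c t → f + (1 + (3 * D * a + (1 + D)) + (3 * D * b + D)) + (3 * D * c + t) ≡
         2 + (2 * D + 3 * D * (a + (b + c)) + (f + t))
    e₁ = solve-∀
    e₂ : ∀ D k t → D + (2 * D + 3 * D * k + t) ≡ 3 * D * suc k + t
    e₂ = solve-∀

  size-drop : ∀ pre {sq q} {ds : Forest V} post → size (pre ++ post) ≤ size (pre ++ (sq , node q ds) ∷ post)
  size-drop pre {ds = ds} post = ≤-trans (≤-reflexive (size-++ pre post)) (≤-trans (+-monoʳ-≤ (size pre) (≤-trans (m≤n+m _ (size ds)) (n≤1+n _)))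
    (≤-reflexive (sym (size-++ pre _))))

  size-mid : ∀ pre {sq q} {ds : Forest V} post → size ds ≤ size (pre ++ (sq , node q ds) ∷ post)
  size-mid pre {ds = ds} post = ≤-trans (≤-trans (m≤m+n _ (size post)) (n≤1+n _)) (≤-trans (m≤n+m _ (size pre)) (≤-reflexive (sym (size-++ pre _))))

  batched : ∀ {D} k y F → 2 ≤ D → size F ≤ k → Bd D F → Batched D y F
  batched k y [] 2≤D le b = record { bs = [] ; edges = ↭-refl ; par = λ _ → [] ; slim = [] ; from = [] ; many = z≤n }
  batched {D} (suc k) y ((s , node p cs) ∷ F) 2≤D (s≤s le) ((l , b) ∷ b′) = go (split? cs) l b (≤-trans (m≤m+n _ _) le)
    where
    rest : Batched D y F
    rest = batched k y F 2≤D (≤-trans (m≤n+m _ (size cs)) le) b′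
    length-drop : ∀ (pre : Forest V) {t} post → length (pre ++ t ∷ post) ≤ D → length (pre ++ post) ≤ D
    length-drop pre post l = ≤-trans (≤-trans (≤-reflexive (List.length-++ pre)) (≤-trans (+-monoʳ-≤ (length pre) (n≤1+n _)) (≤-reflexive (sym (List.length-++ pre))))) l
    go : ∀ {cs} → Split cs → length cs ≤ D → Bd D cs → size cs ≤ k → Batched D y ((s , node p cs) ∷ F)
    go {cs} (none t) l b le = batched-single t (batched k p cs 2≤D le b) rest
    go (leaf pre post) l b le with Bd-++⁻ pre b
    ... | b₁ , _ ∷ b₂ = batched-absorber pre post 2≤D (length-drop pre post l) below-[]
      (batched k p (pre ++ post) 2≤D (≤-trans (size-drop pre post) le) (Bd-++⁺ b₁ b₂)) rest
    go (unary pre {es = es} post) l b le with Bd-++⁻ pre b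
    ... | b₁ , (_ , (l₃ , b₃) ∷ _) ∷ b₂ = batched-absorber pre post 2≤D (length-drop pre post l)
      (below-one l₃ (batched k _ es 2≤D (≤-trans (≤-trans (m≤m+n (size es) 0) (n≤1+n _)) (≤-trans (size-mid pre post) le)) b₃))
      (batched k p (pre ++ post) 2≤D (≤-trans (size-drop pre post) le) (Bd-++⁺ b₁ b₂)) rest

  PieceShape : ℕ → ℕ → Piece → Set
  PieceShape D p₀ (y , s , node x cs) = p₀ ≤ suc (size cs) × suc (size cs) ≤ 1 + D * p₀ × length cs ≤ D × Bd D cs

  -- Cutting runs upwards: what remains attached to a vertex becomes a piece as soon as it has `p₀`
  -- vertices. The branches left below that vertex are smaller than `p₀`, so the piece has at most 1
  -- + D p₀. `res` is what is never cut off.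
  record Cut (D p₀ : ℕ) (y : V) (F : Forest V) : Set where
    field
      res    : Forest V
      ps     : List Piece
      edges  : fe y res ++ pe ps ↭ fe y F
      par    : ∀ {L} → y ∈ L → (∀ {z} → z ∈ map dst (fe y res) → z ∈ L) → Par L (pe ps)
      light  : All (λ t → tsize (proj₂ t) < p₀) res
      short  : length res ≤ length F
      shapes : All (PieceShape D p₀) ps
      bd     : Bd D res

  cut : ∀ {D} p₀ y F → Bd D F → Cut D p₀ y F
  cut p₀ y [] b = record { res = [] ; ps = [] ; edges = ↭-refl ; par = λ _ _ → [] ; light = [] ; short = z≤n ; shapes = [] ; bd = [] }
  cut {D} p₀ y ((s , node x cs) ∷ F) ((l , b) ∷ b′) = go (p₀ ≤? suc (size C₁.res))
    where
    module C₁ = Cut (cut p₀ x cs b)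
    module C₂ = Cut (cut p₀ y F b′)
    len : length C₁.res ≤ D
    len = ≤-trans C₁.short l
    go : Dec (p₀ ≤ suc (size C₁.res)) → Cut D p₀ y ((s , node x cs) ∷ F)
    go (no gt) = record
      { res = (s , node x C₁.res) ∷ C₂.res ; ps = C₁.ps ++ C₂.ps
      ; edges = prep (y , s , x) (↭-trans (↭-reflexive (trans (cong ((fe x C₁.res ++ fe y C₂.res) ++_) (pe-++ C₁.ps C₂.ps))
            (List.++-assoc (fe x C₁.res) _ _)))
          (↭-trans (↭.++⁺ˡ (fe x C₁.res) (↭.shifts (fe y C₂.res) (pe C₁.ps)))
            (↭-trans (↭-reflexive (sym (List.++-assoc (fe x C₁.res) (pe C₁.ps) _))) (↭.++⁺ C₁.edges C₂.edges))))
      ; par = λ {L} y∈ sub →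
          let sub₁ : ∀ {z} → z ∈ map dst (fe x C₁.res) → z ∈ L
              sub₁ = λ {z} z∈ → sub (there (subst (z ∈_) (sym (List.map-++ dst (fe x C₁.res) _)) (∈-++⁺ˡ z∈)))
              sub₂ : ∀ {z} → z ∈ map dst (fe y C₂.res) → z ∈ L
              sub₂ = λ {z} z∈ → sub (there (subst (z ∈_) (sym (List.map-++ dst (fe x C₁.res) _)) (∈-++⁺ʳ (map dst (fe x C₁.res)) z∈)))
          in subst (Par L) (sym (pe-++ C₁.ps C₂.ps)) (Par-++ (C₁.par (sub (here refl)) sub₁)
               (λ up → C₂.par (up (inj₁ y∈)) (up ∘ inj₁ ∘ sub₂)))
      ; light = ≰⇒> gt ∷ C₂.light
      ; short = s≤s C₂.short
      ; shapes = All.++⁺ C₁.shapes C₂.shapes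
      ; bd = (len , C₁.bd) ∷ C₂.bd }
    go (yes le) = record
      { res = C₂.res ; ps = (y , s , node x C₁.res) ∷ C₁.ps ++ C₂.ps
      ; edges = ↭-trans (↭.++⁺ˡ (fe y C₂.res) (prep (y , s , x) (↭-reflexive (trans (cong₂ _++_ (List.++-identityʳ (fe x C₁.res)) (pe-++ C₁.ps C₂.ps))
            (sym (List.++-assoc (fe x C₁.res) (pe C₁.ps) _))))))
          (↭-trans (↭.shift (y , s , x) (fe y C₂.res) _) (prep (y , s , x)
            (↭-trans (↭.shifts (fe y C₂.res) (fe x C₁.res ++ pe C₁.ps)) (↭.++⁺ C₁.edges C₂.edges))))
      ; par = λ {L} y∈ sub → Par-++ (Par-fe ((s , node x C₁.res) ∷ []) y∈) (λ {L₁} up → subst (Par L₁) (sym (pe-++ C₁.ps C₂.ps))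
          (Par-++ (C₁.par (up (inj₂ (here refl))) (λ {z} z∈ → up (inj₂ (there (subst (z ∈_) (cong (map dst) (sym (List.++-identityʳ (fe x C₁.res)))) z∈)))))
            (λ up′ → C₂.par (up′ (inj₁ (up (inj₁ y∈)))) (λ z∈ → up′ (inj₁ (up (inj₁ (sub z∈))))))))
      ; light = C₂.light
      ; short = ≤-trans C₂.short (n≤1+n _)
      ; shapes = (le , s≤s (≤-trans (size-small C₁.light) (*-monoˡ-≤ p₀ len)) , len , C₁.bd) ∷ All.++⁺ C₁.shapes C₂.shapes
      ; bd = C₂.bd }

  abs-edge∈ : ∀ {A} bs → A ∈ absOf bs → (Absorber.p A , Absorber.sq A , Absorber.q A) ∈ be bs
  abs-edge∈ (single e ∷ bs)   A∈           = there (abs-edge∈ bs A∈)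
  abs-edge∈ (absb y s A ∷ bs) (here refl)  = there (here refl)
  abs-edge∈ (absb y s A ∷ bs) (there A∈)   = ∈-++⁺ʳ (bedges (absb y s A)) (abs-edge∈ bs A∈)

  be-singles : ∀ es → be (map single es) ≡ es
  be-singles []       = refl
  be-singles (e ∷ es) = cong (e ∷_) (be-singles es)

  absOf-singles : ∀ es → absOf (map single es) ≡ []
  absOf-singles []       = refl
  absOf-singles (e ∷ es) = absOf-singles es

  record Layout (D s₀ p₀ : ℕ) : Set where
    field
      v      : V
      bs     : List Batch
      ps     : List Piece
      par    : Par (v ∷ []) (be bs ++ pe ps)
      spans  : Spans v (be bs ++ pe ps)
      total  : suc (length (be bs ++ pe ps)) ≡ n
      slim   : All Slim (absOf bs)
      loc    : All (Local (be bs ++ pe ps)) (absOf bs)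
      short  : length (be bs) ≤ D * s₀ + p₀
      many   : s₀ ≤ suc (2 * (3 * D * length (absOf bs) + D))
      shapes : All (PieceShape D p₀) ps

  module _ {D s₀ p₀ : ℕ} (Δ : ∀ v → deg T v ≤ D) (2≤D : 2 ≤ D) (s₀≤n : s₀ ≤ n) (ρ : V) where

    private
      Gr : Grown-tree ρ
      Gr = grown ρ

      module Gr = Grown-tree Gr

      n≡ : suc (size Gr.F) ≡ n
      n≡ = trans (cong suc (trans (sym (fe-length ρ Gr.F)) (sym (List.length-map dst (fe ρ Gr.F))))) (≤-antisym le ge)
        where
        ls = ρ ∷ map dst (fe ρ Gr.F)
        le : length ls ≤ n
        le = let zs , q = extract ls (Spans.uniq Gr.spans) (λ {y} _ → ∈-allFin y) in
          ≤-trans (m≤m+n _ (length zs)) (≤-reflexive (trans (sym (List.length-++ ls)) (trans (sym (↭.↭-length q)) (List.length-tabulate id))))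
        ge : n ≤ length ls
        ge = let zs , q = extract (allFin n) (Unique.allFin⁺ n) (λ {y} _ → Gr.all∈ y) in
          ≤-trans (≤-reflexive (sym (List.length-tabulate id))) (≤-trans (m≤m+n _ (length zs)) (≤-reflexive (trans (sym (List.length-++ (allFin n))) (sym (↭.↭-length q)))))

      Rt : Rooted s₀
      Rt = reroot (size Gr.F) s₀ ρ [] Gr.F ≤-refl z≤n Gr.spans (≤-trans s₀≤n (≤-reflexive (sym n≡))) (cong pred n≡)

      open Rooted Rt renaming (spans to spans₀; cs to kids; total to total₀)

      F₀ : Forest V
      F₀ = behind ++ kids

      bd₀ : Bd D F₀
      bd₀ = bounded Δ v F₀ (Unique-++ʳ (v ∷ []) (Spans.uniq spans₀)) (Spans.te spans₀)

      len₀ : length F₀ ≤ D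
      len₀ = ≤-trans (children≤ v F₀ (Unique-++ʳ (v ∷ []) (Spans.uniq spans₀)) (Spans.te spans₀)) (Δ v)

      len-kids : length kids ≤ D
      len-kids = ≤-trans (m≤n+m _ (length behind)) (≤-trans (≤-reflexive (sym (List.length-++ behind))) len₀)

      module Ba = Batched (batched (size kids) v kids 2≤D ≤-refl (proj₂ (Bd-++⁻ behind bd₀)))
      module Cu = Cut (cut p₀ v behind (proj₁ (Bd-++⁻ behind bd₀)))

      -- The remainder of `behind` is at most one tree with fewer than `p₀` vertices, too small for
      -- a piece. It is placed edge by edge before the pieces that hang from it.
      bs₀ : List Batch
      bs₀ = Ba.bs ++ map single (fe v Cu.res)

      be₀ : be bs₀ ≡ be Ba.bs ++ fe v Cu.res
      be₀ = trans (be-++ Ba.bs _) (cong (be Ba.bs ++_) (be-singles (fe v Cu.res)))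

      abs₀ : absOf bs₀ ≡ absOf Ba.bs
      abs₀ = trans (absOf-++ Ba.bs _) (trans (cong (absOf Ba.bs ++_) (absOf-singles (fe v Cu.res))) (List.++-identityʳ _))

      es = be bs₀ ++ pe Cu.ps

      es↭ : fe v F₀ ↭ es
      es↭ = ↭-sym (↭-trans (↭-reflexive (trans (cong (_++ pe Cu.ps) be₀) (List.++-assoc (be Ba.bs) _ _)))
        (↭-trans (↭.++⁺ Ba.edges Cu.edges) (↭-trans (↭.++-comm (fe v kids) (fe v behind)) (↭-reflexive (sym (fe-++ v behind kids))))))

      local : ∀ {A} → A ∈ absOf bs₀ → From kids A → Local es A
      local {absorber p q sq cs} A∈ (ds , o , refl) = All.tabulate λ {e} e∈ →
          (λ eq → proj₁ (proj₂ e) , dst e , Occ-kids (Spans.uniq spans₀) (Occ-++ʳ behind o) (∈-resp-↭ (↭-sym es↭) e∈) eq ,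
                  cong (λ z → z , proj₂ e) eq) ,
          (λ eq → Unique-map-injective (Unique-++ʳ (v ∷ []) (Spans.uniq (Spans-↭ es↭ spans₀))) e∈ (∈-++⁺ˡ (abs-edge∈ bs₀ A∈)) eq)

    layout : Layout D s₀ p₀
    layout = record
      { v = v ; bs = bs₀ ; ps = Cu.ps
      ; par = subst (λ b → Par (v ∷ []) (b ++ pe Cu.ps)) (sym be₀) (Par-++ (Par-++ (Ba.par (here refl)) (λ sub → Par-fe Cu.res (sub (inj₁ (here refl)))))
          (λ sub → Cu.par (sub (inj₁ (here refl))) (λ {z} z∈ → sub (inj₂ (subst (z ∈_) (sym (List.map-++ dst (be Ba.bs) (fe v Cu.res))) (∈-++⁺ʳ (map dst (be Ba.bs)) z∈))))))
      ; spans = Spans-↭ es↭ spans₀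
      ; total = trans (cong suc (trans (sym (↭.↭-length es↭)) (trans (fe-length v F₀) (trans (size-++ behind kids) total₀))))
          (suc-pred n {{Fin.nonZeroIndex ρ}})
      ; slim = subst (All Slim) (sym abs₀) Ba.slim
      ; loc = All.tabulate (λ {A} A∈ → local A∈ (All.lookup Ba.from (subst (A ∈_) abs₀ A∈)))
      ; short = ≤-trans (≤-reflexive (trans (cong length be₀) (List.length-++ (be Ba.bs)))) (+-mono-≤
          (≤-trans (≤-reflexive (trans (↭.↭-length Ba.edges) (fe-length v kids))) (≤-trans (size-small light) (*-monoˡ-≤ s₀ len-kids)))
          (≤-trans (≤-reflexive (fe-length v Cu.res)) (≤-trans (size-small Cu.light)
            (≤-trans (*-monoˡ-≤ p₀ (≤-trans Cu.short single-behind)) (≤-reflexive (*-identityˡ p₀))))))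
      ; many = ≤-trans heavy (s≤s (≤-trans (m≤m+n (size kids) (length kids)) (≤-trans (size≤low kids) (*-monoʳ-≤ 2
          (≤-trans Ba.many (+-mono-≤ (≤-reflexive (cong (λ a → 3 * D * length a) (sym abs₀))) (≤-trans (top≤length kids) len-kids)))))))
      ; shapes = Cu.shapes }

-- The degree bound

rising : ℕ → ℕ → ℕ
rising j zero    = 1
rising j (suc k) = rising j k * (j + k)

-- N! 2 ^ N times the N-th partial sum of the negative binomial series of (1 - 1/2) ^ (- j)
negbin : ℕ → ℕ → ℕ
negbin j zero    = 1
negbin j (suc N) = 2 * suc N * negbin j N + rising j (suc N)

rising-zero : ∀ k → rising 0 (suc k) ≡ 0
rising-zero zero    = refl
rising-zero (suc k) = cong (_* suc k) (rising-zero k)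

rising-shift : ∀ j k → rising j (suc k) ≡ j * rising (suc j) k
rising-shift j zero    = trans (*-identityˡ (j + 0)) (trans (+-identityʳ j) (sym (*-identityʳ j)))
rising-shift j (suc k) = trans (cong (_* (j + suc k)) (rising-shift j k)) (trans (*-assoc j _ _) (cong (λ x → j * (rising (suc j) k * x)) (+-suc j k)))

rising-suc : ∀ j k → rising (suc j) (suc k) ≡ suc k * rising (suc j) k + rising j (suc k)
rising-suc j k = trans (e (rising (suc j) k) j k) (cong (suc k * rising (suc j) k +_) (sym (rising-shift j k)))
  where e : ∀ x j k → x * (suc j + k) ≡ suc k * x + j * x
        e = solve-∀

-- The series for j + 1 times 1 - x, at x = 1/2, is the series for j. For partial sums the
-- truncation leaves one extra term, which is nonnegative.
negbin-double : ∀ j N → negbin (suc j) N + rising (suc j) N ≡ 2 * negbin j N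
negbin-double j zero    = refl
negbin-double j (suc N) = begin
  2 * suc N * negbin (suc j) N + rising (suc j) (suc N) + rising (suc j) (suc N)
    ≡⟨ cong (λ x → 2 * suc N * negbin (suc j) N + x + x) (rising-suc j N) ⟩
  2 * suc N * negbin (suc j) N + (suc N * rising (suc j) N + rising j (suc N)) + (suc N * rising (suc j) N + rising j (suc N))
    ≡⟨ e₁ N (negbin (suc j) N) (rising (suc j) N) (rising j (suc N)) ⟩
  2 * suc N * (negbin (suc j) N + rising (suc j) N) + 2 * rising j (suc N)
    ≡⟨ cong (λ x → 2 * suc N * x + 2 * rising j (suc N)) (negbin-double j N) ⟩
  2 * suc N * (2 * negbin j N) + 2 * rising j (suc N)
    ≡⟨ e₂ N (negbin j N) (rising j (suc N)) ⟩
  2 * (2 * suc N * negbin j N + rising j (suc N)) ∎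
  where
  open ≡-Reasoning
  e₁ : ∀ N a r s → 2 * suc N * a + (suc N * r + s) + (suc N * r + s) ≡ 2 * suc N * (a + r) + 2 * s
  e₁ = solve-∀
  e₂ : ∀ N b s → 2 * suc N * (2 * b) + 2 * s ≡ 2 * (2 * suc N * b + s)
  e₂ = solve-∀

negbin-bound : ∀ j N → negbin j N ≤ 2 ^ j * (2 ^ N * N !)
negbin-bound zero    zero    = ≤-refl
negbin-bound zero    (suc N) = begin
  2 * suc N * negbin 0 N + rising 0 (suc N) ≡⟨ trans (cong (2 * suc N * negbin 0 N +_) (rising-zero N)) (+-identityʳ _) ⟩
  2 * suc N * negbin 0 N                    ≤⟨ *-monoʳ-≤ (2 * suc N) (negbin-bound zero N) ⟩
  2 * suc N * (1 * (2 ^ N * N !))           ≡⟨ e N (2 ^ N) (N !) ⟩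
  1 * (2 * 2 ^ N * (suc N * N !))           ∎
  where
  open ≤-Reasoning
  e : ∀ N x y → 2 * suc N * (1 * (x * y)) ≡ 1 * (2 * x * (suc N * y))
  e = solve-∀
negbin-bound (suc j) N = begin
  negbin (suc j) N                      ≤⟨ m≤m+n _ _ ⟩
  negbin (suc j) N + rising (suc j) N   ≡⟨ negbin-double j N ⟩
  2 * negbin j N                        ≤⟨ *-monoʳ-≤ 2 (negbin-bound j N) ⟩
  2 * (2 ^ j * (2 ^ N * N !))           ≡⟨ sym (*-assoc 2 (2 ^ j) _) ⟩
  2 * 2 ^ j * (2 ^ N * N !)             ∎
  where open ≤-Reasoning

pow≤rising : ∀ j k → j ^ k ≤ rising j k
pow≤rising j zero    = ≤-refl
pow≤rising j (suc k) = ≤-trans (≤-reflexive (*-comm j (j ^ k))) (*-mono-≤ (pow≤rising j k) (m≤m+n j k))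

expSum≤negbin : ∀ m N → 2 ^ N * expSum m N ≤ negbin (2 * m) N
expSum≤negbin m zero    = ≤-refl
expSum≤negbin m (suc N) = begin
  2 * 2 ^ N * (suc N * expSum m N + m ^ suc N)         ≡⟨ e (2 ^ N) N (expSum m N) (m ^ suc N) ⟩
  2 * suc N * (2 ^ N * expSum m N) + 2 ^ suc N * m ^ suc N
    ≤⟨ +-mono-≤ (*-monoʳ-≤ (2 * suc N) (expSum≤negbin m N)) (≤-trans (≤-reflexive (sym (*-^ (suc N) 2 m))) (pow≤rising (2 * m) (suc N))) ⟩
  2 * suc N * negbin (2 * m) N + rising (2 * m) (suc N) ∎
  where
  open ≤-Reasoning
  e : ∀ x N s p → 2 * x * (suc N * s + p) ≡ 2 * suc N * (x * s) + 2 * x * p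
  e = solve-∀

-- The series of e ^ m is dominated term by term by that of (1 - 1/2) ^ (-2m) = 4 ^ m, because (2m)
-- ^ k is at most the rising factorial.
exp≤4^ : ∀ m N → expSum m N ≤ 4 ^ m * N !
exp≤4^ m N = *-cancelˡ-≤ (2 ^ N) {{m^n≢0 2 N}} (begin
  2 ^ N * expSum m N             ≤⟨ expSum≤negbin m N ⟩
  negbin (2 * m) N               ≤⟨ negbin-bound (2 * m) N ⟩
  2 ^ (2 * m) * (2 ^ N * N !)    ≡⟨ cong (_* (2 ^ N * N !)) (sym (^-*-assoc 2 2 m)) ⟩
  4 ^ m * (2 ^ N * N !)          ≡⟨ e (4 ^ m) (2 ^ N) (N !) ⟩
  2 ^ N * (4 ^ m * N !)          ∎)
  where
  open ≤-Reasoning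
  e : ∀ a b c → a * (b * c) ≡ b * (a * c)
  e = solve-∀

!≤^ : ∀ N → N ! ≤ N ^ N
!≤^ zero    = ≤-refl
!≤^ (suc N) = *-monoʳ-≤ (suc N) (≤-trans (!≤^ N) (^-monoˡ-≤ N (n≤1+n N)))

-- A single term of the exponential series suffices: m ^ N / N! is at least (2N) ^ N / N ^ N.
ExpLe⇒2^≤ : ∀ {m X} N → 2 * N ≤ m → ExpLe m X → 2 ^ N ≤ X
ExpLe⇒2^≤ {m} {X} zero le h = ≤-trans (h 0) (≤-reflexive (*-identityʳ X))
ExpLe⇒2^≤ {m} {X} N@(suc k) le h = *-cancelʳ-≤ _ _ (N ^ N) {{m^n≢0 N N}} (begin
  2 ^ N * N ^ N    ≡⟨ sym (*-^ N 2 N) ⟩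
  (2 * N) ^ N      ≤⟨ ^-monoˡ-≤ N le ⟩
  m ^ N            ≤⟨ m≤n+m _ _ ⟩
  expSum m N       ≤⟨ h N ⟩
  X * N !          ≤⟨ *-monoʳ-≤ X (!≤^ N) ⟩
  X * N ^ N        ∎)
  where open ≤-Reasoning

n<2^n : ∀ n → n < 2 ^ n
n<2^n zero    = s≤s z≤n
n<2^n (suc n) = ≤-trans (+-mono-≤ (m^n>0 2 n) (n<2^n n)) (≤-reflexive (cong (2 ^ n +_) (sym (+-identityʳ (2 ^ n)))))

-- t is the square root of log n / C to base 2, rounded down. The lower bound on n makes room for
-- the pieces, the upper bound turns the hypothesis on the degrees into 2 ^ t.
scale : ∀ C n t₀ → 1 ≤ C → 2 ^ (C * (t₀ * t₀)) ≤ n → ∃ λ t → t₀ ≤ t × 2 ^ (C * (t * t)) ≤ n × n < 2 ^ (C * (suc t * suc t))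
scale C n t₀ 1≤C start = go n t₀ start (<-≤-trans (n<2^n n) (^-monoʳ-≤ 2 (≤-trans (m≤n+m n t₀) (≤-trans (sq (t₀ + n)) (m≤n*m _ C {{>-nonZero 1≤C}})))))
  where
  sq : ∀ x → x ≤ x * x
  sq zero    = z≤n
  sq (suc x) = m≤m*n (suc x) (suc x)
  go : ∀ k t → 2 ^ (C * (t * t)) ≤ n → n < 2 ^ (C * ((t + k) * (t + k))) →
    ∃ λ t′ → t ≤ t′ × 2 ^ (C * (t′ * t′)) ≤ n × n < 2 ^ (C * (suc t′ * suc t′))
  go zero t le lt = ⊥-elim (<-irrefl refl (<-≤-trans lt (≤-trans (≤-reflexive (cong (λ t → 2 ^ (C * (t * t))) (+-identityʳ t))) le)))
  go (suc k) t le lt with 2 ^ (C * (suc t * suc t)) ≤? n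
  ... | no gt = t , ≤-refl , le , ≰⇒> gt
  ... | yes le′ = let t′ , a , b , c = go k (suc t) le′ (subst (λ x → n < 2 ^ (C * (x * x))) (+-suc t k) lt) in t′ , ≤-trans (n≤1+n t) a , b , c

-- If d exceeded 2 ^ t, then e ^ a ≤ 4 ^ a ≤ d for a = t / 2, so the hypothesis gives e ^ (K a ^ 2)
-- ≤ n. The constant 32 is 2 · 4 ^ 2: a factor 2 for passing from e to 2, and t + 1 ≤ 4a.
degree-bound : ∀ {C K n t d} → 32 * C ≤ K → 2 ≤ t → n < 2 ^ (C * (suc t * suc t)) → DegBound K n d → d ≤ 2 ^ t
degree-bound {C} {K} {n} {t} {d} K≥ 2≤t n< db with d ≤? 2 ^ t
... | yes le = le
... | no gt = ⊥-elim (<-irrefl refl (<-≤-trans n< (≤-trans (^-monoʳ-≤ 2 wide) (≤-trans (ExpLe⇒2^≤ (16 * C * (a * a)) enough (db a 0 exp≤d)) (≤-reflexive (*-identityʳ n))))))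
  where
  a = t / 2
  t≡ : t ≡ t % 2 + a * 2
  t≡ = m≡m%n+[m/n]*n t 2
  t≤ : t ≤ 1 + a * 2
  t≤ = ≤-trans (≤-reflexive t≡) (+-monoˡ-≤ (a * 2) (≤-pred (m%n<n t 2)))
  1≤a : 1 ≤ a
  1≤a with a | t≤
  ... | zero  | le = ⊥-elim (<-irrefl refl (≤-trans 2≤t le))
  ... | suc _ | _  = s≤s z≤n
  4^a≤d : 4 ^ a ≤ d
  4^a≤d = ≤-trans (≤-reflexive (^-*-assoc 2 2 a)) (≤-trans (^-monoʳ-≤ 2 (≤-trans (≤-reflexive (*-comm 2 a)) (≤-trans (m≤n+m (a * 2) (t % 2)) (≤-reflexive (sym t≡))))) (<⇒≤ (≰⇒> gt)))
  exp≤d : ExpLe a (d ^ 1)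
  exp≤d N = ≤-trans (exp≤4^ a N) (*-monoˡ-≤ (N !) (≤-trans 4^a≤d (≤-reflexive (sym (*-identityʳ d)))))
  enough : 2 * (16 * C * (a * a)) ≤ K * (a * a)
  enough = ≤-trans (≤-reflexive (e C (a * a))) (*-monoˡ-≤ (a * a) K≥)
    where e : ∀ C x → 2 * (16 * C * x) ≡ 32 * C * x
          e = solve-∀
  suct : suc t ≤ 4 * a
  suct = ≤-trans (s≤s t≤) (≤-trans (+-monoˡ-≤ (a * 2) (≤-trans (≤-reflexive refl) (*-monoˡ-≤ 2 1≤a))) (≤-reflexive (e a)))
    where e : ∀ a → a * 2 + a * 2 ≡ 4 * a
          e = solve-∀
  wide : C * (suc t * suc t) ≤ 16 * C * (a * a)
  wide = ≤-trans (*-monoʳ-≤ C (*-mono-≤ suct suct)) (≤-reflexive (e C a))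
    where e : ∀ C a → C * (4 * a * (4 * a)) ≡ 16 * C * (a * a)
          e = solve-∀

-- Exponential estimates

-- Three Bernoulli factors give (1 + 1/r) ^ (3ℓ) ≥ (ℓ / r) ^ 3. Cubic growth is needed because the
-- absorbers face about n ^ 2 tests while ℓ is below n.
cube : ∀ N r ℓ → 0 < r → N * (r * r * r) < ℓ * ℓ * ℓ → N * r ^ (3 * ℓ) < suc r ^ (3 * ℓ)
cube N r ℓ 0<r h = *-cancelʳ-< (r * r * r) _ _ (begin-strict
  N * r ^ (3 * ℓ) * (r * r * r)       ≡⟨ trans (cong (λ x → N * x * (r * r * r)) (three r)) (e₁ N x (r * r * r)) ⟩
  x * x * x * (N * (r * r * r))       <⟨ *-monoʳ-< (x * x * x) {{m*n≢0 _ _ {{m*n≢0 _ _ {{xn}} {{xn}}}} {{xn}}}} h ⟩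
  x * x * x * (ℓ * ℓ * ℓ)             ≡⟨ e₂ x ℓ ⟩
  (x * ℓ) * (x * ℓ) * (x * ℓ)         ≤⟨ *-mono-≤ (*-mono-≤ one one) one ⟩
  (y * r) * (y * r) * (y * r)         ≡⟨ e₃ y r ⟩
  y * y * y * (r * r * r)             ≡⟨ cong (_* (r * r * r)) (sym (three (suc r))) ⟩
  suc r ^ (3 * ℓ) * (r * r * r)       ∎)
  where
  open ≤-Reasoning
  x = r ^ ℓ
  y = suc r ^ ℓ
  xn : NonZero x
  xn = m^n≢0 r ℓ {{>-nonZero 0<r}}
  one : x * ℓ ≤ y * r
  one = ≤-trans (*-monoʳ-≤ x (m≤n+m ℓ r)) (pow-lower r ℓ)
  three : ∀ r → r ^ (3 * ℓ) ≡ r ^ ℓ * r ^ ℓ * r ^ ℓ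
  three r = trans (cong (r ^_) (e ℓ)) (trans (^-distribˡ-+-* r (ℓ + ℓ) ℓ) (cong (_* r ^ ℓ) (^-distribˡ-+-* r ℓ ℓ)))
    where e : ∀ ℓ → 3 * ℓ ≡ ℓ + ℓ + ℓ
          e = solve-∀
  e₁ : ∀ N x c → N * (x * x * x) * c ≡ x * x * x * (N * c)
  e₁ = solve-∀
  e₂ : ∀ x ℓ → x * x * x * (ℓ * ℓ * ℓ) ≡ (x * ℓ) * (x * ℓ) * (x * ℓ)
  e₂ = solve-∀
  e₃ : ∀ y r → (y * r) * (y * r) * (y * r) ≡ y * y * y * (r * r * r)
  e₃ = solve-∀

doubling : ∀ κ → 0 < κ → 2 * κ ^ κ ≤ suc κ ^ κ
doubling κ 0<κ = *-cancelʳ-≤ _ _ κ {{>-nonZero 0<κ}} (≤-trans (≤-reflexive (e κ (κ ^ κ))) (pow-lower κ κ))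
  where e : ∀ κ x → 2 * x * κ ≡ x * (κ + κ)
        e = solve-∀

doubling-^ : ∀ κ e → 0 < κ → 2 ^ e * κ ^ (κ * e) ≤ suc κ ^ (κ * e)
doubling-^ κ e 0<κ = begin
  2 ^ e * κ ^ (κ * e)     ≡⟨ cong (2 ^ e *_) (sym (^-*-assoc κ κ e)) ⟩
  2 ^ e * (κ ^ κ) ^ e     ≡⟨ sym (*-^ e 2 (κ ^ κ)) ⟩
  (2 * κ ^ κ) ^ e         ≤⟨ ^-monoˡ-≤ e (doubling κ 0<κ) ⟩
  (suc κ ^ κ) ^ e         ≡⟨ ^-*-assoc (suc κ) κ e ⟩
  suc κ ^ (κ * e)         ∎
  where open ≤-Reasoning

-- κ factors 1 + 1/κ are worth 2, so κ G of the absorbers pay for 2 ^ G, and 3ℓ more pay for the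
-- number of tests.
absorber-gap : ∀ κ N G ℓ a → 0 < κ → κ * G + 3 * ℓ ≤ a → N * (κ * κ * κ) < ℓ * ℓ * ℓ → κ ^ a * (N * 2 ^ G) < suc κ ^ a
absorber-gap κ N G ℓ a 0<κ le h with slack le
... | z , refl = begin-strict
  κ ^ (κ * G + 3 * ℓ + z) * (N * 2 ^ G)                   ≡⟨ trans (cong (_* (N * 2 ^ G)) (split κ)) (e₁ (κ ^ (κ * G)) (κ ^ (3 * ℓ)) (κ ^ z) N (2 ^ G)) ⟩
  (2 ^ G * κ ^ (κ * G)) * (N * κ ^ (3 * ℓ)) * κ ^ z       ≤⟨ *-monoˡ-≤ (κ ^ z) (*-monoˡ-≤ (N * κ ^ (3 * ℓ)) (doubling-^ κ G 0<κ)) ⟩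
  suc κ ^ (κ * G) * (N * κ ^ (3 * ℓ)) * κ ^ z             ≤⟨ *-monoʳ-≤ (suc κ ^ (κ * G) * (N * κ ^ (3 * ℓ))) (^-monoˡ-≤ z (n≤1+n κ)) ⟩
  suc κ ^ (κ * G) * (N * κ ^ (3 * ℓ)) * suc κ ^ z         <⟨ *-monoˡ-< (suc κ ^ z) {{m^n≢0 (suc κ) z}} (*-monoʳ-< (suc κ ^ (κ * G)) {{m^n≢0 (suc κ) (κ * G)}} (cube N κ ℓ 0<κ h)) ⟩
  suc κ ^ (κ * G) * suc κ ^ (3 * ℓ) * suc κ ^ z           ≡⟨ sym (split (suc κ)) ⟩
  suc κ ^ (κ * G + 3 * ℓ + z)                             ∎
  where
  open ≤-Reasoning
  split : ∀ κ′ → κ′ ^ (κ * G + 3 * ℓ + z) ≡ κ′ ^ (κ * G) * κ′ ^ (3 * ℓ) * κ′ ^ z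
  split κ′ = trans (^-distribˡ-+-* κ′ (κ * G + 3 * ℓ) z) (cong (_* κ′ ^ z) (^-distribˡ-+-* κ′ (κ * G) (3 * ℓ)))
  e₁ : ∀ a b c N g → a * b * c * (N * g) ≡ g * a * (N * b) * c
  e₁ = solve-∀

-- ((ρ + 1) / ρ) ^ Q ≤ ((r + 1) / r) ^ 2 for ρ = Q r
slow-growth : ∀ Q r → 0 < Q → 0 < r → r * r * suc (Q * r) ^ Q ≤ (Q * r) ^ Q * (suc r * suc r)
slow-growth Q r 0<Q 0<r = *-cancelˡ-≤ (Q * Q) {{m*n≢0 Q Q {{nz}} {{nz}}}} (begin
  Q * Q * (r * r * S)                                ≡⟨ e₁ Q r S ⟩
  Q * r * (Q * r) * S                                ≤⟨ pow-upper (Q * r) Q (m≤m*n Q r {{>-nonZero 0<r}}) ⟩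
  R * (Q * r * (Q * r) + Q * (Q * r) + Q * Q)        ≤⟨ ≤-by (R * (Q * Q * r)) (e₂ Q r R) ⟩
  Q * Q * (R * (suc r * suc r))                      ∎)
  where
  open ≤-Reasoning
  nz = >-nonZero 0<Q
  S = suc (Q * r) ^ Q
  R = (Q * r) ^ Q
  e₁ : ∀ Q r S → Q * Q * (r * r * S) ≡ Q * r * (Q * r) * S
  e₁ = solve-∀
  e₂ : ∀ Q r R → Q * Q * (R * (suc r * suc r)) ≡ R * (Q * r * (Q * r) + Q * (Q * r) + Q * Q) + R * (Q * Q * r)
  e₂ = solve-∀

-- By `slow-growth`, 2k of the `Y` factors pay for the growth of the potential over all pieces, and
-- 3ℓ more for the number of tests.
potential-gap : ∀ N Q r Y k₀ k ℓ → 0 < Q → 0 < r → k₀ ≤ Q * k → 2 * k + 3 * ℓ ≤ Y → N * (r * r * r) < ℓ * ℓ * ℓ →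
  N * (r ^ Y * suc (Q * r) ^ k₀) < suc r ^ Y * (Q * r) ^ k₀
potential-gap N Q r Y k₀ k ℓ 0<Q 0<r k₀≤ Y≥ h with slack k₀≤ | slack Y≥
... | j , ej | z , refl = *-cancelʳ-< (r ^ (2 * k) * ρ ^ j) _ _ (begin-strict
  N * (r ^ Y′ * σ ^ k₀) * (r ^ (2 * k) * ρ ^ j)
    ≤⟨ *-monoʳ-≤ (N * (r ^ Y′ * σ ^ k₀)) (*-monoʳ-≤ (r ^ (2 * k)) (^-monoˡ-≤ j (n≤1+n ρ))) ⟩
  N * (r ^ Y′ * σ ^ k₀) * (r ^ (2 * k) * σ ^ j)
    ≡⟨ cong (λ x → N * (x * σ ^ k₀) * (r ^ (2 * k) * σ ^ j)) (split r) ⟩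
  N * (r ^ (2 * k) * r ^ (3 * ℓ) * r ^ z * σ ^ k₀) * (r ^ (2 * k) * σ ^ j)
    ≡⟨ e₁ N (r ^ (2 * k)) (r ^ (3 * ℓ)) (r ^ z) (σ ^ k₀) (σ ^ j) ⟩
  N * r ^ (3 * ℓ) * (r ^ z * r ^ (2 * k)) * (r ^ (2 * k) * (σ ^ k₀ * σ ^ j))
    ≤⟨ *-monoʳ-≤ (N * r ^ (3 * ℓ) * (r ^ z * r ^ (2 * k))) grow ⟩
  N * r ^ (3 * ℓ) * (r ^ z * r ^ (2 * k)) * (ρ ^ k₀ * ρ ^ j * suc r ^ (2 * k))
    ≤⟨ *-monoˡ-≤ (ρ ^ k₀ * ρ ^ j * suc r ^ (2 * k)) (*-monoʳ-≤ (N * r ^ (3 * ℓ)) (*-monoˡ-≤ (r ^ (2 * k)) (^-monoˡ-≤ z (n≤1+n r)))) ⟩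
  N * r ^ (3 * ℓ) * (suc r ^ z * r ^ (2 * k)) * (ρ ^ k₀ * ρ ^ j * suc r ^ (2 * k))
    ≡⟨ e₂ (N * r ^ (3 * ℓ)) (suc r ^ z) (r ^ (2 * k)) (ρ ^ k₀) (ρ ^ j) (suc r ^ (2 * k)) ⟩
  suc r ^ z * r ^ (2 * k) * ρ ^ k₀ * ρ ^ j * suc r ^ (2 * k) * (N * r ^ (3 * ℓ))
    <⟨ *-monoʳ-< (suc r ^ z * r ^ (2 * k) * ρ ^ k₀ * ρ ^ j * suc r ^ (2 * k)) {{nz}} (cube N r ℓ 0<r h) ⟩
  suc r ^ z * r ^ (2 * k) * ρ ^ k₀ * ρ ^ j * suc r ^ (2 * k) * suc r ^ (3 * ℓ)
    ≡⟨ e₃ (suc r ^ z) (r ^ (2 * k)) (ρ ^ k₀) (ρ ^ j) (suc r ^ (2 * k)) (suc r ^ (3 * ℓ)) ⟩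
  suc r ^ (2 * k) * suc r ^ (3 * ℓ) * suc r ^ z * ρ ^ k₀ * (r ^ (2 * k) * ρ ^ j)
    ≡⟨ cong (λ x → x * ρ ^ k₀ * (r ^ (2 * k) * ρ ^ j)) (sym (split (suc r))) ⟩
  suc r ^ Y′ * ρ ^ k₀ * (r ^ (2 * k) * ρ ^ j) ∎)
  where
  open ≤-Reasoning
  ρ = Q * r
  σ = suc ρ
  Y′ = 2 * k + 3 * ℓ + z
  rn : NonZero r
  rn = >-nonZero 0<r
  ρn : NonZero ρ
  ρn = m*n≢0 Q r {{>-nonZero 0<Q}} {{rn}}
  nz : NonZero (suc r ^ z * r ^ (2 * k) * ρ ^ k₀ * ρ ^ j * suc r ^ (2 * k))
  nz = m*n≢0 _ _ {{m*n≢0 _ _ {{m*n≢0 _ _ {{m*n≢0 _ _ {{m^n≢0 (suc r) z}} {{m^n≢0 r (2 * k) {{rn}}}}}} {{m^n≢0 ρ k₀ {{ρn}}}}}} {{m^n≢0 ρ j {{ρn}}}}}} {{m^n≢0 (suc r) (2 * k)}}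
  split : ∀ b → b ^ Y′ ≡ b ^ (2 * k) * b ^ (3 * ℓ) * b ^ z
  split b = trans (^-distribˡ-+-* b (2 * k + 3 * ℓ) z) (cong (_* b ^ z) (^-distribˡ-+-* b (2 * k) (3 * ℓ)))
  square : ∀ b → (b * b) ^ k ≡ b ^ (2 * k)
  square b = trans (cong (_^ k) (cong (b *_) (sym (*-identityʳ b)))) (^-*-assoc b 2 k)
  pow-Qk : ∀ b → (b ^ Q) ^ k ≡ b ^ k₀ * b ^ j
  pow-Qk b = trans (^-*-assoc b Q k) (trans (cong (b ^_) ej) (^-distribˡ-+-* b k₀ j))
  grow : r ^ (2 * k) * (σ ^ k₀ * σ ^ j) ≤ ρ ^ k₀ * ρ ^ j * suc r ^ (2 * k)
  grow = begin
    r ^ (2 * k) * (σ ^ k₀ * σ ^ j)   ≡⟨ cong₂ _*_ (sym (square r)) (sym (pow-Qk σ)) ⟩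
    (r * r) ^ k * (σ ^ Q) ^ k        ≡⟨ sym (*-^ k (r * r) (σ ^ Q)) ⟩
    (r * r * σ ^ Q) ^ k              ≤⟨ ^-monoˡ-≤ k (slow-growth Q r 0<Q 0<r) ⟩
    (ρ ^ Q * (suc r * suc r)) ^ k    ≡⟨ *-^ k (ρ ^ Q) (suc r * suc r) ⟩
    (ρ ^ Q) ^ k * (suc r * suc r) ^ k ≡⟨ cong₂ _*_ (pow-Qk ρ) (square (suc r)) ⟩
    ρ ^ k₀ * ρ ^ j * suc r ^ (2 * k) ∎
  e₁ : ∀ N a b c d f → N * (a * b * c * d) * (a * f) ≡ N * b * (c * a) * (a * (d * f))
  e₁ = solve-∀
  e₂ : ∀ x a b c d f → x * (a * b) * (c * d * f) ≡ a * b * c * d * f * x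
  e₂ = solve-∀
  e₃ : ∀ a b c d f x → a * b * c * d * f * x ≡ f * x * a * c * (b * d)
  e₃ = solve-∀

-- Choice of the parameters


-- u exceeds all constants that depend on A₁ only and is the bound on the degrees; w is about n / u ^ 8.
module Numbers (A₁ t n w : ℕ) (0<A₁ : 0 < A₁) (const≤ : 100 * (A₁ * A₁ * A₁) ≤ 2 ^ t) where

  u q b C g h K κ Q hh X p₀ p r g₀ s₀ ℓ₀ : ℕ
  u  = 2 ^ t
  -- The host has excess density 1 / A₁ = 2 / q over one half, the first stage leaves 3 / (2q), and
  -- the walk needs 1 / q.
  q  = 2 * A₁
  b  = 4 * q
  C  = 4 * q * b + b
  g  = q + 3
  h  = 2 * q
  K  = b * b * q
  κ  = pred K
  Q  = u ^ 8
  -- κ contractions by κ / (κ + 1) halve the error, so hh of them bring it down to 2 ^ (-3 - 8t) = 1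
  -- / (8Q).
  hh = κ * (3 + t * 8)
  X  = suc u ^ double hh
  -- Below the root of a piece, the first 2hh levels have at most u X vertices; `p₀` makes them a
  -- share of at most 1 / (8Q).
  p₀ = 8 * Q * (u * X)
  p  = 1 + u * p₀
  -- A piece changes g m by at most r / Q, so the second-order terms of the potential are no larger
  -- than the errors of the embedding.
  r  = Q * (u * p)
  -- With n about w u ^ 8, the potential leaks a deficit of order h n / Q, at most w u, below g₀ = w
  -- u ^ 2. To absorb g₀ vertices takes 4 w u ^ 3 absorbers, and s₀ = w u ^ 5 vertices contain them
  -- despite the loss of a factor of order u. That subtree has about w u ^ 6 vertices at most, a
  -- small part of n.
  g₀ = w * (u * u)
  s₀ = w * (u * u * u * u * u)
  ℓ₀ = u * s₀ + p₀ + 1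

  u9 : ℕ
  u9 = u * Q

  private
    A³ = A₁ * A₁ * A₁

    instance
      A-nonZero : NonZero A₁
      A-nonZero = >-nonZero 0<A₁

    A²≤ : A₁ * A₁ ≤ A³
    A²≤ = m≤m*n (A₁ * A₁) A₁

    A≤ : A₁ ≤ A³
    A≤ = ≤-trans (m≤m*n A₁ A₁) A²≤

    1≤A³ : 1 ≤ A³
    1≤A³ = ≤-trans 0<A₁ A≤

    below : ∀ {x} → x ≤ 100 * A³ → x ≤ u
    below le = ≤-trans le const≤

    k*≤ : ∀ k {x y} → k ≤ 100 → x ≤ y → k * x ≤ 100 * y
    k*≤ k = *-mono-≤

  100≤u : 100 ≤ u
  100≤u = below (≤-trans (≤-reflexive (sym (*-identityʳ 100))) (*-monoʳ-≤ 100 1≤A³))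

  small≤u : ∀ k → k ≤ 100 → k ≤ u
  small≤u k le = ≤-trans le 100≤u

  16A≤u : 16 * A₁ ≤ u
  16A≤u = below (k*≤ 16 (≤ᵇ⇒≤ 16 100 tt) A≤)

  12h≤u : 12 * h ≤ u
  12h≤u = below (≤-trans (≤-reflexive (e A₁)) (k*≤ 48 (≤ᵇ⇒≤ 48 100 tt) A≤))
    where e : ∀ A → 12 * (2 * (2 * A)) ≡ 48 * A
          e = solve-∀

  h≤u : h ≤ u
  h≤u = ≤-trans (m≤n*m h 12) 12h≤u

  g≤u : g ≤ u
  g≤u = below (≤-trans (+-mono-≤ (*-monoʳ-≤ 2 A≤) (*-monoʳ-≤ 3 1≤A³)) (≤-by (95 * A³) (e A³)))
    where e : ∀ x → 100 * x ≡ 2 * x + 3 * x + 95 * x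
          e = solve-∀

  C≤u : C ≤ u
  C≤u = below (≤-trans (≤-reflexive (e A₁)) (≤-trans (+-mono-≤ (*-monoʳ-≤ 64 A²≤) (*-monoʳ-≤ 8 A≤)) (≤-by (28 * A³) (e′ A³))))
    where e : ∀ A → 4 * (2 * A) * (4 * (2 * A)) + 4 * (2 * A) ≡ 64 * (A * A) + 8 * A
          e = solve-∀
          e′ : ∀ x → 100 * x ≡ 64 * x + 8 * x + 28 * x
          e′ = solve-∀

  2A³≤u : 2 * A³ ≤ u
  2A³≤u = below (*-monoˡ-≤ A³ (≤ᵇ⇒≤ 2 100 tt))

  0<u : 0 < u
  0<u = ≤-trans (s≤s z≤n) 100≤u

  private
    instance
      u-nonZero : NonZero u
      u-nonZero = >-nonZero 0<u
      Q-nonZero : NonZero Q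
      Q-nonZero = m^n≢0 u 8
      X-nonZero : NonZero X
      X-nonZero = m^n≢0 (suc u) (double hh)
      uX-nonZero : NonZero (u * X)
      uX-nonZero = m*n≢0 u X
      up-nonZero : NonZero (u * p)
      up-nonZero = m*n≢0 u p
      r-nonZero : NonZero r
      r-nonZero = m*n≢0 Q (u * p)
      rr-nonZero : NonZero (r * r)
      rr-nonZero = m*n≢0 r r
      u9-nonZero : NonZero u9
      u9-nonZero = m*n≢0 u Q
      b-nonZero : NonZero b
      b-nonZero = m*n≢0 4 q {{_}} {{m*n≢0 2 A₁}}

  0<K : 0 < K
  0<K = >-nonZero⁻¹ K {{m*n≢0 (b * b) q {{m*n≢0 b b}} {{m*n≢0 2 A₁}}}}

  κ≡ : suc κ ≡ K
  κ≡ = suc-pred K {{>-nonZero 0<K}}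

  0<κ : 0 < κ
  0<κ = ≤-pred (≤-trans (≤-trans (s≤s (s≤s z≤n)) (≤-trans (*-monoʳ-≤ 2 0<A₁) (m≤n*m q (b * b) {{m*n≢0 b b}}))) (≤-reflexive (sym κ≡)))

  8Q≡ : 8 * Q ≡ 2 ^ (3 + t * 8)
  8Q≡ = trans (cong (8 *_) (^-*-assoc 2 t 8)) (sym (^-distribˡ-+-* 2 3 (t * 8)))

  Q≡ : Q ≡ u * u * u * u * u * u * u * u
  Q≡ = e u
    where e : ∀ u → u * (u * (u * (u * (u * (u * (u * (u * 1))))))) ≡ u * u * u * u * u * u * u * u
          e = solve-∀

  κ^≤ : 8 * Q * κ ^ hh ≤ suc κ ^ hh
  κ^≤ = ≤-trans (≤-reflexive (cong (_* κ ^ hh) 8Q≡)) (doubling-^ κ (3 + t * 8) 0<κ)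

  r≤u9rrr : r * r * r ≤ u9 * (r * r * r)
  r≤u9rrr = m≤n*m (r * r * r) u9

  module _ (W : u9 * (r * r * r) ≤ w) (wQ≤n : w * Q ≤ n) (n≤2wQ : n ≤ 2 * (w * Q)) where

    rrr≤w : r * r * r ≤ w
    rrr≤w = ≤-trans r≤u9rrr W

    r≤w : r ≤ w
    r≤w = ≤-trans (m≤n*m r (r * r)) rrr≤w

    0<w : 0 < w
    0<w = ≤-trans (>-nonZero⁻¹ r) r≤w

    private instance
      w-nonZero : NonZero w
      w-nonZero = >-nonZero 0<w

    w≤g₀ : w ≤ g₀
    w≤g₀ = m≤m*n w (u * u) {{m*n≢0 u u}}

    p≤r : p ≤ r
    p≤r = ≤-trans (m≤n*m p u) (m≤n*m (u * p) Q)

    up≤r : u * p ≤ r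
    up≤r = m≤n*m (u * p) Q

    w<g₀b : w < g₀ * b
    w<g₀b = <-≤-trans (≤-trans (m<m*n w 2 ≤-refl) (*-monoʳ-≤ w (≤-trans (small≤u 2 (≤ᵇ⇒≤ 2 100 tt)) (m≤m*n u u)))) (m≤m*n g₀ b)

    bad≤ : 8 * Q * (p * (C * p)) ≤ g₀ * b
    bad≤ = begin
      8 * Q * (p * (C * p))   ≤⟨ *-mono-≤ (*-monoˡ-≤ Q (small≤u 8 (≤ᵇ⇒≤ 8 100 tt))) (*-monoʳ-≤ p (*-monoˡ-≤ p C≤u)) ⟩
      u * Q * (p * (u * p))   ≡⟨ e u Q p ⟩
      r * (u * p)             ≤⟨ *-monoʳ-≤ r up≤r ⟩
      r * r                   ≤⟨ m≤m*n (r * r) r ⟩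
      r * r * r               ≤⟨ rrr≤w ⟩
      w                       ≤⟨ <⇒≤ w<g₀b ⟩
      g₀ * b                  ∎
      where
      open ≤-Reasoning
      e : ∀ u Q p → u * Q * (p * (u * p)) ≡ Q * (u * p) * (u * p)
      e = solve-∀

    potential-gap′ : 2 * (n * 2) * (r ^ g₀ * suc (Q * r) ^ (3 * (h * n))) < suc r ^ g₀ * (Q * r) ^ (3 * (h * n))
    potential-gap′ = potential-gap (2 * (n * 2)) Q r g₀ (3 * (h * n)) (6 * (h * w)) (w * u) (>-nonZero⁻¹ Q) (>-nonZero⁻¹ r) k₀≤ Y≥ (begin-strict
        2 * (n * 2) * (r * r * r)          ≤⟨ *-monoˡ-≤ (r * r * r) (*-monoʳ-≤ 2 (*-monoˡ-≤ 2 n≤2wQ)) ⟩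
        2 * (2 * (w * Q) * 2) * (r * r * r) ≡⟨ e₁ w Q (r * r * r) ⟩
        8 * (w * (Q * (r * r * r)))        ≤⟨ *-monoˡ-≤ (w * (Q * (r * r * r))) (small≤u 8 (≤ᵇ⇒≤ 8 100 tt)) ⟩
        u * (w * (Q * (r * r * r)))        ≡⟨ e₂ u w Q (r * r * r) ⟩
        w * (u9 * (r * r * r))             ≤⟨ *-monoʳ-≤ w W ⟩
        w * w                              <⟨ m<m*n (w * w) (w * (u * u * u)) {{m*n≢0 w w}} (≤-trans (≤-trans (small≤u 2 (≤ᵇ⇒≤ 2 100 tt)) (m≤n*m u (u * u) {{m*n≢0 u u}})) (m≤n*m (u * u * u) w)) ⟩
        w * w * (w * (u * u * u))          ≡⟨ e₃ w u ⟩
        w * u * (w * u) * (w * u)          ∎)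
      where
      open ≤-Reasoning
      e₁ : ∀ w Q x → 2 * (2 * (w * Q) * 2) * x ≡ 8 * (w * (Q * x))
      e₁ = solve-∀
      e₂ : ∀ u w Q x → u * (w * (Q * x)) ≡ w * (u * Q * x)
      e₂ = solve-∀
      e₃ : ∀ w u → w * w * (w * (u * u * u)) ≡ w * u * (w * u) * (w * u)
      e₃ = solve-∀
      e₄ : ∀ h w Q → 3 * (h * (2 * (w * Q))) ≡ Q * (6 * (h * w))
      e₄ = solve-∀
      e₅ : ∀ h w u → 2 * (6 * (h * w)) + 3 * (w * u) ≡ 12 * h * w + 3 * u * w
      e₅ = solve-∀
      e₆ : ∀ w u → u * w + 3 * u * w ≡ w * (4 * u)
      e₆ = solve-∀
      k₀≤ : 3 * (h * n) ≤ Q * (6 * (h * w))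
      k₀≤ = ≤-trans (*-monoʳ-≤ 3 (*-monoʳ-≤ h n≤2wQ)) (≤-reflexive (e₄ h w Q))
      Y≥ : 2 * (6 * (h * w)) + 3 * (w * u) ≤ g₀
      Y≥ = ≤-trans (≤-reflexive (e₅ h w u)) (≤-trans (+-monoˡ-≤ (3 * u * w) (*-monoˡ-≤ w 12h≤u)) (≤-trans (≤-reflexive (e₆ w u))
        (*-monoʳ-≤ w (*-monoˡ-≤ u (small≤u 4 (≤ᵇ⇒≤ 4 100 tt))))))

    stage-size : 4 * A₁ * suc ℓ₀ ≤ n
    stage-size = begin
      4 * A₁ * suc (u * s₀ + p₀ + 1)        ≤⟨ *-monoʳ-≤ (4 * A₁) le ⟩
      4 * A₁ * (4 * (w * u6))               ≡⟨ e₁ A₁ (w * u6) ⟩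
      16 * A₁ * (w * u6)                    ≤⟨ *-monoˡ-≤ (w * u6) 16A≤u ⟩
      u * (w * u6)                          ≤⟨ m≤m*n (u * (w * u6)) u ⟩
      u * (w * u6) * u                      ≡⟨ trans (e₂ u w) (cong (w *_) (sym Q≡)) ⟩
      w * Q                                 ≤⟨ wQ≤n ⟩
      n                                     ∎
      where
      open ≤-Reasoning
      u6 = u * u * u * u * u * u
      u6n : NonZero u6
      u6n = m*n≢0 _ u {{m*n≢0 _ u {{m*n≢0 _ u {{m*n≢0 _ u {{m*n≢0 u u}}}}}}}}
      p₀≤ : p₀ ≤ w * u6
      p₀≤ = ≤-trans (≤-trans (≤-trans (m≤n*m p₀ u) (n≤1+n (u * p₀))) (≤-trans p≤r r≤w)) (m≤m*n w u6 {{u6n}})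
      e₁ : ∀ A x → 4 * A * (4 * x) ≡ 16 * A * x
      e₁ = solve-∀
      e₂ : ∀ u w → u * (w * (u * u * u * u * u * u)) * u ≡ w * (u * u * u * u * u * u * u * u)
      e₂ = solve-∀
      e₃ : ∀ u w → u * (w * (u * u * u * u * u)) ≡ w * (u * u * u * u * u * u)
      e₃ = solve-∀
      e₄ : ∀ x p → suc (x + p + 1) ≡ x + p + 2
      e₄ = solve-∀
      e₅ : ∀ x → x + x + 2 * x ≡ 4 * x
      e₅ = solve-∀
      le : suc (u * s₀ + p₀ + 1) ≤ 4 * (w * u6)
      le = ≤-trans (≤-reflexive (e₄ (u * s₀) p₀)) (≤-trans (+-mono-≤ (+-mono-≤ (≤-reflexive (e₃ u w)) p₀≤)
        (*-monoʳ-≤ 2 (>-nonZero⁻¹ (w * u6) {{m*n≢0 w u6 {{w-nonZero}} {{u6n}}}}))) (≤-reflexive (e₅ (w * u6))))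

    s₀≤n : s₀ ≤ n
    s₀≤n = ≤-trans (≤-trans (m≤n*m s₀ u) (≤-trans (m≤m+n (u * s₀) p₀) (m≤m+n (u * s₀ + p₀) 1))) (≤-trans (≤-trans (n≤1+n ℓ₀) (m≤n*m (suc ℓ₀) (4 * A₁) {{m*n≢0 4 A₁}})) stage-size)

    many-absorbers : ∀ a → s₀ ≤ suc (2 * (3 * u * a + u)) → 4 * (w * (u * u * u)) ≤ a
    many-absorbers a le with 4 * (w * (u * u * u)) ≤? a
    ... | yes ok = ok
    ... | no gt = ⊥-elim (<-irrefl refl (<-≤-trans lt le))
      where
      open ≤-Reasoning
      u⁴ = w * (u * u * u * u)
      e₁ : ∀ u w → 2 * (3 * u * (4 * (w * (u * u * u))) + u) ≡ 24 * (w * (u * u * u * u)) + 2 * u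
      e₁ = solve-∀
      e₂ : ∀ x → suc (24 * x + 2 * x) + x ≡ suc (27 * x)
      e₂ = solve-∀
      e₃ : ∀ u w → u * (w * (u * u * u * u)) ≡ w * (u * u * u * u * u)
      e₃ = solve-∀
      u≤u⁴ : u ≤ u⁴
      u≤u⁴ = ≤-trans (m≤n*m u (u * u * u) {{m*n≢0 _ u {{m*n≢0 u u}}}}) (m≤n*m (u * u * u * u) w)
      lt : suc (2 * (3 * u * a + u)) < s₀
      lt = begin-strict
        suc (2 * (3 * u * a + u))                             ≤⟨ s≤s (*-monoʳ-≤ 2 (+-monoˡ-≤ u (*-monoʳ-≤ (3 * u) (<⇒≤ (≰⇒> gt))))) ⟩
        suc (2 * (3 * u * (4 * (w * (u * u * u))) + u))       ≡⟨ cong suc (e₁ u w) ⟩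
        suc (24 * u⁴ + 2 * u)                                 ≤⟨ s≤s (+-monoʳ-≤ (24 * u⁴) (*-monoʳ-≤ 2 u≤u⁴)) ⟩
        suc (24 * u⁴ + 2 * u⁴)                                <⟨ m<m+n _ (≤-trans 0<u u≤u⁴) ⟩
        suc (24 * u⁴ + 2 * u⁴) + u⁴                           ≡⟨ e₂ u⁴ ⟩
        suc (27 * u⁴)                                         ≤⟨ +-monoˡ-≤ (27 * u⁴) (≤-trans 0<u u≤u⁴) ⟩
        28 * u⁴                                               ≤⟨ *-monoˡ-≤ u⁴ (small≤u 28 (≤ᵇ⇒≤ 28 100 tt)) ⟩
        u * u⁴                                                ≡⟨ e₃ u w ⟩
        s₀                                                    ∎

    absorber-gap′ : ∀ κ₁ a → 0 < κ₁ → κ₁ ≤ u → 4 * (w * (u * u * u)) ≤ a → κ₁ ^ a * (n * (n * 2) * 2 ^ g₀) < suc κ₁ ^ a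
    absorber-gap′ κ₁ a 0<κ₁ κ₁≤u le = absorber-gap κ₁ (n * (n * 2)) g₀ (w * (u * u * u)) a 0<κ₁
      (≤-trans (+-monoˡ-≤ (3 * (w * (u * u * u))) (*-monoˡ-≤ g₀ κ₁≤u)) (≤-trans (≤-reflexive (e₁ u w)) le))
      (begin-strict
        n * (n * 2) * (κ₁ * κ₁ * κ₁)                       ≤⟨ *-mono-≤ (*-mono-≤ n≤2wQ (*-monoˡ-≤ 2 n≤2wQ)) (*-mono-≤ (*-mono-≤ κ₁≤u κ₁≤u) κ₁≤u) ⟩
        2 * (w * Q) * (2 * (w * Q) * 2) * (u * u * u)      ≡⟨ e₂ w Q u ⟩
        8 * (w * w * (Q * Q * (u * u * u)))                ≤⟨ *-monoˡ-≤ _ (small≤u 8 (≤ᵇ⇒≤ 8 100 tt)) ⟩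
        u * (w * w * (Q * Q * (u * u * u)))                ≡⟨ e₃ u w Q ⟩
        w * w * (u9 * Q) * (u * u * u)                     ≤⟨ *-monoˡ-≤ (u * u * u) (*-monoʳ-≤ (w * w) u9Q≤w) ⟩
        w * w * w * (u * u * u)                            <⟨ m<m*n (w * w * w * (u * u * u)) (u * u * u * (u * u * u)) {{m*n≢0 (w * w * w) (u * u * u) {{m*n≢0 (w * w) w {{m*n≢0 w w}}}} {{u3n}}}}
                                                               (≤-trans (small≤u 2 (≤ᵇ⇒≤ 2 100 tt)) (≤-trans (m≤n*m u (u * u) {{m*n≢0 u u}}) (m≤m*n (u * u * u) (u * u * u) {{u3n}}))) ⟩
        w * w * w * (u * u * u) * (u * u * u * (u * u * u)) ≡⟨ e₄ w (u * u * u) ⟩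
        w * (u * u * u) * (w * (u * u * u)) * (w * (u * u * u)) ∎)
      where
      open ≤-Reasoning
      u3n : NonZero (u * u * u)
      u3n = m*n≢0 _ u {{m*n≢0 u u}}
      u9Q≤w : u9 * Q ≤ w
      u9Q≤w = ≤-trans (*-monoʳ-≤ u9 (≤-trans (m≤m*n Q (u * p)) (m≤n*m r (r * r)))) W
      e₁ : ∀ u w → u * (w * (u * u)) + 3 * (w * (u * u * u)) ≡ 4 * (w * (u * u * u))
      e₁ = solve-∀
      e₂ : ∀ w Q u → 2 * (w * Q) * (2 * (w * Q) * 2) * (u * u * u) ≡ 8 * (w * w * (Q * Q * (u * u * u)))
      e₂ = solve-∀
      e₃ : ∀ u w Q → u * (w * w * (Q * Q * (u * u * u))) ≡ w * w * (u * Q * Q) * (u * u * u)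
      e₃ = solve-∀
      e₄ : ∀ w x → w * w * w * x * (x * x) ≡ w * x * (w * x) * (w * x)
      e₄ = solve-∀

-- Spanning trees


-- The first stage occupies at most n / (4A) vertices, a quarter of the excess 1 / A.
still-rich : ∀ A {n m d} l c L → (A + 2) * n ≤ 2 * A * d → d ≤ l + c → m ≤ n → l ≤ L → 4 * A * suc L ≤ n →
  (2 * A + 3) * m ≤ 2 * (2 * A) * c
still-rich A {n} {m} {d} l c L h₁ h₂ h₃ h₄ h₅ = +-cancelʳ-≤ n _ _ (begin
  (2 * A + 3) * m + n              ≤⟨ +-monoˡ-≤ n (*-monoʳ-≤ (2 * A + 3) h₃) ⟩
  (2 * A + 3) * n + n              ≡⟨ e₁ A n ⟩
  2 * ((A + 2) * n)                ≤⟨ *-monoʳ-≤ 2 h₁ ⟩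
  2 * (2 * A * d)                  ≡⟨ sym (*-assoc 2 (2 * A) d) ⟩
  2 * (2 * A) * d                  ≤⟨ *-monoʳ-≤ (2 * (2 * A)) h₂ ⟩
  2 * (2 * A) * (l + c)            ≡⟨ e₂ A l c ⟩
  2 * (2 * A) * c + 4 * A * l      ≤⟨ +-monoʳ-≤ (2 * (2 * A) * c) (≤-trans (*-monoʳ-≤ (4 * A) (≤-trans h₄ (n≤1+n L))) h₅) ⟩
  2 * (2 * A) * c + n              ∎)
  where
  open ≤-Reasoning
  e₁ : ∀ A n → (2 * A + 3) * n + n ≡ 2 * ((A + 2) * n)
  e₁ = solve-∀
  e₂ : ∀ A l c → 2 * (2 * A) * (l + c) ≡ 2 * (2 * A) * c + 4 * A * l
  e₂ = solve-∀

module Spanning {n : ℕ} (G : Digraph n) (T : Digraph n) (oriented : ∀ u v → adj T u v ≡ true → adj T v u ≡ false)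
  (connected : Connected T) (acyclic : Acyclic T)
  (A₁ t w : ℕ) (0<A₁ : 0 < A₁) (const≤ : 100 * (A₁ * A₁ * A₁) ≤ 2 ^ t)
  (dense : ∀ s v → (A₁ + 2) * n ≤ 2 * A₁ * sum (λ x → ⟦ Graph.Eg G s v x ⟧))
  (Δ : ∀ v → deg T v ≤ 2 ^ t)
  (W : Numbers.u9 A₁ t n w 0<A₁ const≤ * (Numbers.r A₁ t n w 0<A₁ const≤ * Numbers.r A₁ t n w 0<A₁ const≤ * Numbers.r A₁ t n w 0<A₁ const≤) ≤ w)
  (wQ≤n : w * Numbers.Q A₁ t n w 0<A₁ const≤ ≤ n) (n≤2wQ : n ≤ 2 * (w * Numbers.Q A₁ t n w 0<A₁ const≤)) (ρ : Fin n) where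

  open Layouts G T oriented connected acyclic
  open Numbers A₁ t n w 0<A₁ const≤

  L : Layout u s₀ p₀
  L = layout Δ (small≤u 2 (≤ᵇ⇒≤ 2 100 tt)) (s₀≤n W wQ≤n n≤2wQ) ρ

  open Layout L

  es : List Edge
  es = be bs ++ pe ps

  open Spans spans

  stage≤ : A₁ * suc ℓ₀ ≤ n
  stage≤ = ≤-trans (*-monoˡ-≤ (suc ℓ₀) (m≤n*m A₁ 4)) (stage-size W wQ≤n n≤2wQ)

  open Greedily A₁ ℓ₀ 0<A₁ stage≤ dense

  start : Base [] es
  start = record
    -- Only the value at the root counts, and the root `v` may be sent to any host vertex, here to
    -- `v` itself.
    { f = λ _ → v ; ds = v ∷ [] ; B = proj₁ ext
    ; im = imgs (↭-sym (proj₂ ext))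
    ; par = par
    ; uniq = Unique-↭ (↭.++-comm (v ∷ []) (map dst es)) uniq
    ; len = suc-injective (trans total (trans (sym (List.length-tabulate id)) (↭.↭-length (proj₂ ext))))
    ; sat = [] ; ends = [] }
    where
    ext : ∃ λ B → allFin n ↭ v ∷ B
    ext = extract₁ (∈-allFin v)

  embedded : Embedded (be bs) (pe ps) (length (be bs) + 1) (length (absOf bs) + 0)
  embedded = add-batches bs slim
    (record { base = start ; abs = [] ; weighted = weighted-[] ; loc = [] ; ds-len = refl ; abs-len = refl })
    (+-monoˡ-≤ 1 short) loc

  open Embedded embedded using (base; ds-len)

  params : Params q κ hh Q r p g₀ g₀
  params = record
    { 0<q = ≤-trans 0<A₁ (m≤n*m A₁ 2)
    ; 0<r = >-nonZero⁻¹ r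
    ; 0<Q = >-nonZero⁻¹ Q
    ; κ≡ = κ≡
    ; 2q≤ = ≤-trans h≤u (≤-trans (m≤n*m u w) (≤-trans (m≤m*n (w * u) u) (≤-reflexive (*-assoc w u u))))
    ; κ^≤ = κ^≤
    ; bad≤ = bad≤ W wQ≤n n≤2wQ
    ; bad< = ≤-<-trans (≤-trans (*-monoˡ-≤ p C≤u) (≤-trans (up≤r W wQ≤n n≤2wQ) (r≤w W wQ≤n n≤2wQ))) (w<g₀b W wQ≤n n≤2wQ)
    ; hp≤ = ≤-trans (*-monoˡ-≤ p h≤u) (up≤r W wQ≤n n≤2wQ)
    ; Qgp≤ = *-monoʳ-≤ Q (*-monoˡ-≤ p g≤u)
    ; Qr≤ = ≤-trans (≤-trans (*-mono-≤ (m≤n*m Q u) (≤-trans (m≤m*n r r) (m≤m*n (r * r) r))) W) (w≤g₀ W wQ≤n n≤2wQ)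
    ; Y≤ = ≤-refl
    ; gap = potential-gap′ W wQ≤n n≤2wQ
    }
    where
    instance
      _ = >-nonZero 0<u
      _ = >-nonZero (0<w W wQ≤n n≤2wQ)
      Qn : NonZero Q
      Qn = m^n≢0 u 8
      upn : NonZero (u * p)
      upn = m*n≢0 u p
      rn : NonZero r
      rn = m*n≢0 Q (u * p)

  open Loop params
  open Potential test g h r (Params.0<r params)

  ds≤ : length (Base.ds base) ≤ ℓ₀
  ds≤ = ≤-trans (≤-reflexive ds-len) (+-monoˡ-≤ 1 short)

  initially-rich : ∀ τ → g * length (Base.B base) ≤ h * c τ (Base.B base)
  initially-rich τ = still-rich A₁ (length ds) (c τ B) ℓ₀ (dense s x)
      (≤-trans (Around.deg≤ im ds≤ s x) (+-monoʳ-≤ (length ds) (≤-reflexive (ΣL-lookup (λ z → ⟦ Eg s x z ⟧) B))))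
      (m+n≤o⇒n≤o (length ds) (≤-reflexive (Images-length im))) ds≤ (stage-size W wQ≤n n≤2wQ)
    where
    open Base base using (ds; B; im)
    s = signs (proj₂ (remQuot {n} 2 τ))
    x = proj₁ (remQuot {n} 2 τ)

  grown₀ : Grown (Base.ds base) (Base.B base)
  grown₀ = 0 , z≤n , subst (λ k → Ψ (length ds) B * (Q * r) ^ k ≤ 2 * (n * 2) * D n * suc (Q * r) ^ k) (sym (trans (cong (3 *_) (*-zeroʳ h)) refl))
      (*-monoˡ-≤ 1 (subst (λ m → Ψ (length ds) B ≤ 2 * (n * 2) * D m) (Images-length im) (Ψ-initial (length ds) B initially-rich)))
    where open Base base using (ds; B; im)

  good : ∀ {P} → PieceShape u p₀ P → GoodPiece P
  good {y , s , node x cs} (p₀≤ , ≤p , len , bd) =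
    ≤p ,
    ≤-trans (m≤m*n (8 * Q) (u * X) {{m*n≢0 u X {{>-nonZero 0<u}} {{m^n≢0 (suc u) (double hh)}}}}) p₀≤ ,
    ≤-trans (*-monoʳ-≤ (8 * Q) (≤-trans (levels-bound (double hh) cs bd) (*-monoˡ-≤ X len))) p₀≤

  κ₁≤u : κ₁ ≤ u
  κ₁≤u = ≤-trans (n≤1+n κ₁) (≤-trans (≤-reflexive suc-κ₁) 2A³≤u)

  0<κ₁ : 0 < κ₁
  0<κ₁ = ≤-pred (≤-trans (*-monoʳ-≤ 2 0<k₁) (≤-reflexive (sym suc-κ₁)))

  completion : Completion es
  completion = main-loop ps base
    (embedded-absorbing embedded g₀ (absorber-gap′ W wQ≤n n≤2wQ κ₁ (length (absOf bs) + 0) 0<κ₁ κ₁≤u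
      (≤-trans (many-absorbers W wQ≤n n≤2wQ (length (absOf bs)) many) (m≤m+n _ 0))))
    grown₀ (All.map good shapes)

  contains : Contains G T
  contains = let f , inj , sat = completion in f , inj , λ x y a →
    [ All.lookup sat , All.lookup sat ]′ (complete (all∈ x) (all∈ y) a)
    where
    all∈ : ∀ z → z ∈ v ∷ map dst es
    all∈ = Unique-length uniq (trans (cong suc (List.length-map dst es)) total)

-- In powers of u, with x = u ^ (4hh) bounding X: r ≤ u ^ 21 x, so `u9` r ^ 3 ≤ u ^ 72 x ^ 3, and
-- the factor Q brings this to u ^ (80 + 12hh). As u = 2 ^ t and hh is at most 11 κ t, the exponent
-- of 2 is at most (80 + 132 κ) t ^ 2. This is where log n has to dominate the square of log Δ.
parameters : ∀ A₁ t n (0<A₁ : 0 < A₁) (const≤ : 100 * (A₁ * A₁ * A₁) ≤ 2 ^ t) →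
  2 ^ ((80 + 132 * Numbers.κ A₁ t n 0 0<A₁ const≤) * (t * t)) ≤ n →
  Σ ℕ λ w → let open Numbers A₁ t n w 0<A₁ const≤ in
    u9 * (r * r * r) ≤ w × w * Q ≤ n × n ≤ 2 * (w * Q)
parameters A₁ t n 0<A₁ const≤ big-n = w , W , wQ≤n , n≤2wQ
  where
  open Numbers A₁ t n 0 0<A₁ const≤ hiding (0<w)
  instance
    un : NonZero u
    un = >-nonZero 0<u
    Qn : NonZero Q
    Qn = m^n≢0 u 8
  w = n / Q
  wQ≤n : w * Q ≤ n
  wQ≤n = m/n*n≤m n Q
  E : ℕ
  E = 4 * hh
  X≤ : X ≤ u ^ E
  X≤ = begin
    suc u ^ double hh     ≤⟨ ^-monoˡ-≤ (double hh) (≤-trans (s≤s (m≤m*n u 1)) (su u (small≤u 2 (≤ᵇ⇒≤ 2 100 tt)))) ⟩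
    (u ^ 2) ^ double hh   ≡⟨ ^-*-assoc u 2 (double hh) ⟩
    u ^ (2 * double hh)   ≡⟨ cong (u ^_) (trans (cong (2 *_) (dbl hh)) (sym (*-assoc 2 2 hh))) ⟩
    u ^ E                 ∎
    where
    open ≤-Reasoning
    su : ∀ u → 2 ≤ u → suc (u * 1) ≤ u ^ 2
    su u le = ≤-trans (+-mono-≤ (≤-trans (≤-trans (s≤s z≤n) le) (≤-reflexive (sym (*-identityʳ u)))) ≤-refl)
      (≤-trans (≤-reflexive (e (u * 1))) (*-monoˡ-≤ (u * 1) le))
      where e : ∀ x → x + x ≡ 2 * x
            e = solve-∀
    dbl : ∀ k → double k ≡ 2 * k
    dbl zero    = refl
    dbl (suc k) = trans (cong (λ x → suc (suc x)) (dbl k)) (e k)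
      where e : ∀ k → suc (suc (2 * k)) ≡ 2 * suc k
            e = solve-∀
  x : ℕ
  x = u ^ E
  instance
    xn : NonZero x
    xn = m^n≢0 u E
  p≤ : p ≤ u ^ 11 * x * u
  p≤ = begin
    1 + u * (8 * Q * (u * X))         ≤⟨ +-mono-≤ {1} {u * (u * Q * (u * x))} one (*-monoʳ-≤ u (*-mono-≤ (*-monoˡ-≤ Q (small≤u 8 (≤ᵇ⇒≤ 8 100 tt))) (*-monoʳ-≤ u X≤))) ⟩
    u * (u * Q * (u * x)) + u * (u * Q * (u * x)) ≡⟨ e (u * (u * Q * (u * x))) ⟩
    2 * (u * (u * Q * (u * x)))       ≤⟨ *-monoˡ-≤ _ (small≤u 2 (≤ᵇ⇒≤ 2 100 tt)) ⟩
    u * (u * (u * Q * (u * x)))       ≡⟨ e′ u Q x ⟩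
    u * (u * (u * Q)) * x * u         ∎
    where
    open ≤-Reasoning
    one : 1 ≤ u * (u * Q * (u * x))
    one = >-nonZero⁻¹ _ {{m*n≢0 u (u * Q * (u * x)) {{un}} {{m*n≢0 (u * Q) (u * x) {{m*n≢0 u Q}} {{m*n≢0 u x}}}}}}
    e : ∀ y → y + y ≡ 2 * y
    e = solve-∀
    e′ : ∀ u Q x → u * (u * (u * Q * (u * x))) ≡ u * (u * (u * Q)) * x * u
    e′ = solve-∀
  r≤ : r ≤ u ^ 21 * x
  r≤ = ≤-trans (*-monoʳ-≤ Q (*-monoʳ-≤ u p≤)) (≤-reflexive (trans (e Q u (u ^ 11) x)
      (cong (_* x) (trans (cong (_* (u ^ 2)) (sym (^-distribˡ-+-* u 8 11))) (sym (^-distribˡ-+-* u 19 2))))))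
    where e : ∀ Q u y x → Q * (u * (y * x * u)) ≡ Q * y * (u * (u * 1)) * x
          e = solve-∀
  W′ : u9 * (r * r * r) ≤ u ^ 72 * (x * x * x)
  W′ = ≤-trans (*-monoʳ-≤ u9 (*-mono-≤ (*-mono-≤ r≤ r≤) r≤)) (≤-reflexive (trans (e u9 (u ^ 21) x)
      (cong (_* (x * x * x)) (trans (cong (u ^ 9 *_) (trans (cong (_* u ^ 21) (sym (^-distribˡ-+-* u 21 21))) (sym (^-distribˡ-+-* u 42 21)))) (sym (^-distribˡ-+-* u 9 63))))))
    where e : ∀ a y x → a * (y * x * (y * x) * (y * x)) ≡ a * (y * y * y) * (x * x * x)
          e = solve-∀
  x³≡ : x * x * x ≡ u ^ (12 * hh)
  x³≡ = trans (cong (_* x) (sym (^-distribˡ-+-* u E E))) (trans (sym (^-distribˡ-+-* u (E + E) E)) (cong (u ^_) (e hh)))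
    where e : ∀ h → 4 * h + 4 * h + 4 * h ≡ 12 * h
          e = solve-∀
  1≤t : 1 ≤ t
  1≤t = positive t (small≤u 2 (≤ᵇ⇒≤ 2 100 tt))
    where positive : ∀ t → 2 ≤ 2 ^ t → 1 ≤ t
          positive zero    (s≤s ())
          positive (suc t) _ = s≤s z≤n
  exponent : t * (80 + 12 * hh) ≤ (80 + 132 * κ) * (t * t)
  exponent = ≤-trans (*-monoʳ-≤ t (begin
      80 + 12 * (κ * (3 + t * 8))   ≤⟨ +-mono-≤ {80} {80 * t} (≤-trans (≤-reflexive (sym (*-identityʳ 80))) (*-monoʳ-≤ 80 1≤t))
                                         (*-monoʳ-≤ 12 (*-monoʳ-≤ κ (+-monoˡ-≤ (t * 8) (≤-trans (≤-reflexive (sym (*-identityʳ 3))) (*-monoʳ-≤ 3 1≤t))))) ⟩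
      80 * t + 12 * (κ * (3 * t + t * 8)) ≡⟨ e t κ ⟩
      (80 + 132 * κ) * t            ∎)) (≤-reflexive (e′ t (80 + 132 * κ)))
    where
    open ≤-Reasoning
    e : ∀ t κ → 80 * t + 12 * (κ * (3 * t + t * 8)) ≡ (80 + 132 * κ) * t
    e = solve-∀
    e′ : ∀ t c → t * (c * t) ≡ c * (t * t)
    e′ = solve-∀
  u80≤n : Q * (u ^ 72 * (x * x * x)) ≤ n
  u80≤n = begin
    Q * (u ^ 72 * (x * x * x))      ≡⟨ trans (cong (λ y → Q * (u ^ 72 * y)) x³≡) (trans (sym (*-assoc Q _ _)) (cong (_* u ^ (12 * hh)) (sym (^-distribˡ-+-* u 8 72)))) ⟩
    u ^ 80 * u ^ (12 * hh)          ≡⟨ sym (^-distribˡ-+-* u 80 (12 * hh)) ⟩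
    u ^ (80 + 12 * hh)              ≡⟨ ^-*-assoc 2 t _ ⟩
    2 ^ (t * (80 + 12 * hh))        ≤⟨ ^-monoʳ-≤ 2 exponent ⟩
    2 ^ ((80 + 132 * κ) * (t * t))  ≤⟨ big-n ⟩
    n                               ∎
    where open ≤-Reasoning
  W₀ : u ^ 72 * (x * x * x) ≤ w
  W₀ = ≤-trans (≤-reflexive (sym (trans (cong (_/ Q) (*-comm Q _)) (m*n/n≡m (u ^ 72 * (x * x * x)) Q)))) (/-monoˡ-≤ Q u80≤n)
  W : u9 * (r * r * r) ≤ w
  W = ≤-trans W′ W₀
  1≤w : 1 ≤ w
  1≤w = ≤-trans (>-nonZero⁻¹ (u ^ 72 * (x * x * x)) {{m*n≢0 (u ^ 72) _ {{m^n≢0 u 72}} {{m*n≢0 (x * x) x {{m*n≢0 x x}}}}}}) W₀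
  n≤2wQ : n ≤ 2 * (w * Q)
  n≤2wQ = begin
    n                   ≡⟨ m≡m%n+[m/n]*n n Q ⟩
    n % Q + w * Q       ≤⟨ +-monoˡ-≤ (w * Q) (≤-trans (<⇒≤ (m%n<n n Q)) (m≤n*m Q w {{>-nonZero 1≤w}})) ⟩
    w * Q + w * Q       ≡⟨ cong (w * Q +_) (sym (+-identityʳ _)) ⟩
    2 * (w * Q)         ∎
    where open ≤-Reasoning

module _ (A₁ : ℕ) (0<A₁ : 0 < A₁) where

  -- `constant` is the coefficient in `parameters` with κ written out; t ≥ `threshold` ensures 100
  -- A₁ ^ 3 ≤ 2 ^ t.
  threshold constant : ℕ
  threshold = 100 * (A₁ * A₁ * A₁)
  constant  = 80 + 132 * pred (4 * (2 * A₁) * (4 * (2 * A₁)) * (2 * A₁))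

  module _ {n K : ℕ} (G T : Digraph n) (tree : IsOrientedTree T)
    (dense : ∀ s v → (A₁ + 2) * n ≤ 2 * A₁ * sum (λ x → ⟦ Graph.Eg G s v x ⟧))
    (K-large : 32 * constant ≤ K) (n-large : 2 ^ (constant * (threshold * threshold)) ≤ n) (bound : MaxDegBound K T) where

    private
      scaled : ∃ λ t → threshold ≤ t × 2 ^ (constant * (t * t)) ≤ n × n < 2 ^ (constant * (suc t * suc t))
      scaled = scale constant n threshold (s≤s z≤n) n-large

      t = proj₁ scaled

      const≤ : 100 * (A₁ * A₁ * A₁) ≤ 2 ^ t
      const≤ = ≤-trans (proj₁ (proj₂ scaled)) (<⇒≤ (n<2^n t))

      2≤t : 2 ≤ t
      2≤t = ≤-trans (*-mono-≤ {2} {100} (≤ᵇ⇒≤ 2 100 tt) (*-mono-≤ (*-mono-≤ 0<A₁ 0<A₁) 0<A₁)) (proj₁ (proj₂ scaled))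

      degrees : ∀ v → deg T v ≤ 2 ^ t
      degrees v = degree-bound {constant} K-large 2≤t (proj₂ (proj₂ (proj₂ scaled))) (bound v)

      width : Σ ℕ λ w → let open Numbers A₁ t n w 0<A₁ const≤ in u9 * (r * r * r) ≤ w × w * Q ≤ n × n ≤ 2 * (w * Q)
      width = parameters A₁ t n 0<A₁ const≤ (proj₁ (proj₂ (proj₂ scaled)))

    spanning-tree : Contains G T
    spanning-tree = Spanning.contains G T (proj₁ tree) (proj₁ (proj₂ tree)) (proj₂ (proj₂ tree))
      A₁ t (proj₁ width) 0<A₁ const≤ dense degrees
      (proj₁ (proj₂ width)) (proj₁ (proj₂ (proj₂ width))) (proj₂ (proj₂ (proj₂ width)))
      (fromℕ< (≤-trans (m^n>0 2 (constant * (threshold * threshold))) n-large))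

semidegrees : ∀ {n} a (G : Digraph n) → MinSemiDegAtLeastHalfPlus a G →
  ∀ s v → (suc a + 2) * n ≤ 2 * suc a * sum (λ x → ⟦ Graph.Eg G s v x ⟧)
semidegrees {n} a G semi true  v = subst₂ (λ x y → x * n ≤ 2 * suc a * y) (+-suc a 2) (count≡sum _) (proj₁ (semi v))
semidegrees {n} a G semi false v = subst₂ (λ x y → x * n ≤ 2 * suc a * y) (+-suc a 2) (count≡sum _) (proj₂ (semi v))

theorem1p3 : ∀ (a : ℕ) →
    Σ ℕ λ L₀ → ∀ (l : ℕ) → L₀ ≤ l →
    Σ ℕ λ K₀ → ∀ (K : ℕ) → K₀ ≤ K →
    Σ ℕ λ n₀ → ∀ (n : ℕ) → n₀ ≤ n →
    ∀ (G : Digraph n) → MinSemiDegAtLeastHalfPlus a G →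
    ∀ (T : Digraph n) → IsOrientedTree T → MaxDegBound K T →
    ((Σ ℕ λ L → (n ≤ suc l * L) × DisjointBarePaths7 T L)
    ⊎ (Σ ℕ λ L → (n ≤ suc l * L) × DisjointLeafEdges T L)) →
    Contains G T
theorem1p3 a =
  -- K₀ is the 32 C of `degree-bound`; n₀ lets the search in `scale` begin at t = `threshold`.
  0 , λ l _ → 32 * constant (suc a) (s≤s z≤n) , λ K K-large →
  2 ^ (constant (suc a) (s≤s z≤n) * (threshold (suc a) (s≤s z≤n) * threshold (suc a) (s≤s z≤n))) , λ n n-large G semi T tree bound _ →
  spanning-tree (suc a) (s≤s z≤n) G T tree (semidegrees a G semi) K-large n-large bound
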